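{- Let $n\ge1$, $x_0=(x_1\cdots x_n)^{ -1}$, $f=1-t(x_0+x_1+\dots+x_n)$, and work over the ring $A=\mathbb{Z}[t,1/D_f(t)]$ with $D_f(t)=(n+1)(1-((n+1)t)^{n+1})$. For every $\mathbf{U}=(U_0,\dots,U_n)\in\mathbb{Z}_{\ge0}^{n+1}$ with $\min_iU_i=0$ and $|\mathbf{U}|<n$ one has \[ \omega_{\mathbf{U}}\equiv\Big(\prod_{i=0}^n\big[\theta/(n+1)\big]_{U_i}\Big)(1/f)\pmod{d\mathcal{O}_f}, \] where $\omega_{\mathbf{U}}=|\mathbf{U}|!\,t^{|\mathbf{U}|}\mathbf{x}^{\mathbf{U}}/f^{|\mathbf{U}|+1}$ and $[y]_k=y(y-1)\cdots(y-k+1)$ denotes the falling factorial.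
   Context: $\mathbf{x}^{\mathbf{U}}=x_0^{U_0}\cdots x_n^{U_n}$, $|\mathbf{U}|=\sum U_i$, $\theta=t\frac{d}{dt}$ acting on rational functions through their coefficients. $\Delta$ is the simplex with vertices $e_1,\dots,e_n,(-1,\dots,-1)$ in $\mathbb{R}^n$; $\deg(\mathbf{u})$ is the least $d\ge0$ with $\mathbf{u}\in d\Delta$. Elements of $A$ are expanded in $\mathbb{Q}[[t]]$; a Laurent polynomial $h=\sum h_{\mathbf{u}}\mathbf{x}^{\mathbf{u}}\in A[x_1^{\pm1},\dots,x_n^{\pm1}]$ is admissible if $\operatorname{ord}_t(h_{\mathbf{u}})\ge\deg(\mathbf{u})$ on its support. $\mathcal{O}_f$ is the $A$-module generated by $(m-1)!\,h/f^m$ with $m\ge1$, $h$ admissible, $\operatorname{supp}(h)\subset m\Delta$; $d\mathcal{O}_f$ is the $A$-module generated by $x_i\frac{\partial}{\partial x_i}(\eta)$, $\eta\in\mathcal{O}_f$, $1\le i\le n$. -}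

module Defs where

open import Data.Nat as ℕ using (ℕ; zero; suc; _∸_)
open import Data.Nat using (_!)
open import Data.Integer as ℤ using (ℤ; +_; -_)
open import Data.Rational as ℚ using (ℚ; 0ℚ)
open import Data.Fin as Fin using (Fin)
open import Data.Vec as Vec using (Vec; lookup; tabulate; replicate; zipWith)
import Data.Vec.Properties as VecP
open import Data.List as List using (List; []; _∷_; _++_; map; concatMap; foldr; allFin)
open import Data.List.Relation.Unary.All using (All)
open import Data.Product using (Σ; _×_; _,_; proj₂)
open import Relation.Binary.PropositionalEquality using (_≡_; _≢_)
open import Relation.Nullary using (yes; no)
open import Data.Bool using (Bool; true; false; _∧_; if_then_else_)
open import Relation.Nullary.Decidable using (⌊_⌋)

-- Elements of Z[t][x₁^{±1},…,xₙ^{±1}] are finite lists of terms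
--   (c , a , u)  meaning  c · t^a · x^u ,
-- compared extensionally through their coefficient functions.

module _ (n : ℕ) where

  Term : Set
  Term = ℤ × ℕ × Vec ℤ n

  Poly : Set
  Poly = List Term

  coeff : Poly → ℕ → Vec ℤ n → ℤ
  coeff [] a u = + 0
  coeff ((c , a' , u') ∷ P) a u =
    (if ⌊ a' ℕ.≟ a ⌋ ∧ ⌊ VecP.≡-dec ℤ._≟_ u' u ⌋ then c else + 0) ℤ.+ coeff P a u

  _≈P_ : Poly → Poly → Set
  P ≈P Q = ∀ a u → coeff P a u ≡ coeff Q a u

  0v : Vec ℤ n
  0v = replicate n (+ 0)

  const : ℤ → Poly
  const c = (c , 0 , 0v) ∷ []

  _⊕_ : Poly → Poly → Poly
  P ⊕ Q = P ++ Q

  negP : Poly → Poly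
  negP = map (λ { (c , a , u) → (- c , a , u) })

  mulT : Term → Term → Term
  mulT (c , a , u) (c' , a' , u') = (c ℤ.* c' , a ℕ.+ a' , zipWith ℤ._+_ u u')

  _⊗_ : Poly → Poly → Poly
  P ⊗ Q = concatMap (λ s → map (mulT s) Q) P

  powP : Poly → ℕ → Poly
  powP P zero = const (+ 1)
  powP P (suc k) = P ⊗ powP P k

  tP : Poly
  tP = (+ 1 , 1 , 0v) ∷ []

  x0P : Poly
  x0P = (+ 1 , 0 , replicate n (- (+ 1))) ∷ []

  xP : Fin n → Poly
  xP i = (+ 1 , 0 , tabulate (λ j → if ⌊ i Fin.≟ j ⌋ then + 1 else + 0)) ∷ []

  fP : Poly
  fP = const (+ 1) ⊕ negP (tP ⊗ (x0P ⊕ concatMap xP (allFin n)))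

  DP : Poly
  DP = const (+ suc n) ⊗ (const (+ 1) ⊕ negP (powP (const (+ suc n) ⊗ tP) (suc n)))

  -- Elements of A[x^{±1}][1/f], A = Z[t, 1/D_f], written num / (D^dk · f^fm).

  record RatFun : Set where
    constructor _/D^_f^_
    field
      num : Poly
      dk  : ℕ
      fm  : ℕ
  open RatFun public

  _≈R_ : RatFun → RatFun → Set
  r ≈R s = (num r ⊗ (powP DP (dk s) ⊗ powP fP (fm s)))
        ≈P (num s ⊗ (powP DP (dk r) ⊗ powP fP (fm r)))

  _+R_ : RatFun → RatFun → RatFun
  r +R s = ((num r ⊗ (powP DP (dk s) ⊗ powP fP (fm s)))
            ⊕ (num s ⊗ (powP DP (dk r) ⊗ powP fP (fm r))))
           /D^ (dk r ℕ.+ dk s) f^ (fm r ℕ.+ fm s)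

  negR : RatFun → RatFun
  negR r = negP (num r) /D^ dk r f^ fm r

  _-R_ : RatFun → RatFun → RatFun
  r -R s = r +R negR s

  zeroR : RatFun
  zeroR = [] /D^ 0 f^ 0

  sumR : List RatFun → RatFun
  sumR = foldr _+R_ zeroR

  -- Elements of A: p(t) / D^k with p ∈ Z[t] given as list of (c , a) = c t^a.
  record AElt : Set where
    constructor _/Dᴬ^_
    field
      anum : List (ℤ × ℕ)
      aden : ℕ
  open AElt public

  embedA : List (ℤ × ℕ) → Poly
  embedA = map (λ { (c , a) → (c , a , 0v) })

  scale : AElt → RatFun → RatFun
  scale α r = (embedA (anum α) ⊗ num r) /D^ (aden α ℕ.+ dk r) f^ fm r

  constA : ℤ → AElt
  constA c = ((c , 0) ∷ []) /Dᴬ^ 0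

  -- 1/(n+1) = (1 - (n+1)^{n+1} t^{n+1}) / D_f ∈ A
  inv-n+1 : AElt
  inv-n+1 = ((+ 1 , 0) ∷ (- (+ (suc n ℕ.^ suc n)) , suc n) ∷ []) /Dᴬ^ 1

  -- Derivations acting termwise by a weight: θ = t d/dt (weight a),
  -- xᵢ ∂/∂xᵢ (weight uᵢ); extended to quotients by the quotient rule.

  derP : (ℕ → Vec ℤ n → ℤ) → Poly → Poly
  derP w = map (λ { (c , a , u) → (w a u ℤ.* c , a , u) })

  derR : (ℕ → Vec ℤ n → ℤ) → RatFun → RatFun
  derR w r =
    ((derP w (num r) ⊗ (DP ⊗ fP))
     ⊕ (negP (const (+ dk r) ⊗ (num r ⊗ (derP w DP ⊗ fP)))
     ⊕ negP (const (+ fm r) ⊗ (num r ⊗ (derP w fP ⊗ DP)))))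
    /D^ suc (dk r) f^ suc (fm r)

  θR : RatFun → RatFun
  θR = derR (λ a u → + a)

  xdR : Fin n → RatFun → RatFun
  xdR i = derR (λ a u → lookup u i)

  Lop : ℕ → RatFun → RatFun
  Lop j r = scale inv-n+1 (θR r) -R scale (constA (+ j)) r

  fallθ : ℕ → RatFun → RatFun
  fallθ zero r = r
  fallθ (suc k) r = Lop k (fallθ k r)

  oneOverF : RatFun
  oneOverF = const (+ 1) /D^ 0 f^ 1

  rhs : Vec ℕ (suc n) → RatFun
  rhs U = Vec.foldr (λ _ → RatFun) fallθ oneOverF U

  ∣_∣U : Vec ℕ (suc n) → ℕ
  ∣ U ∣U = Vec.sum U

  -- ω_U = |U|! t^{|U|} x^U / f^{|U|+1}, with x^U = x₀^{U₀} x₁^{U₁}⋯xₙ^{Uₙ}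
  ω : Vec ℕ (suc n) → RatFun
  ω U = ((+ (∣ U ∣U !) , ∣ U ∣U ,
          tabulate (λ i → + lookup U (Fin.suc i) ℤ.- + lookup U Fin.zero)) ∷ [])
        /D^ 0 f^ suc ∣ U ∣U

  -- The simplex Δ with vertices e₁,…,eₙ,(-1,…,-1); membership u ∈ dΔ for d ∈ ℕ:
  -- u = λ₀·(-1,…,-1) + Σ λᵢ eᵢ with λ ≥ 0 rational, Σ λ = d.

  sumQ : (Fin (suc n) → ℚ) → ℚ
  sumQ l = foldr ℚ._+_ 0ℚ (map l (allFin (suc n)))

  InDilate : ℕ → Vec ℤ n → Set
  InDilate d u = Σ (Fin (suc n) → ℚ) λ l →
      (∀ i → 0ℚ ℚ.≤ l i)
    × (sumQ l ≡ (+ d) ℚ./ 1)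
    × (∀ i → (lookup u i) ℚ./ 1 ≡ l (Fin.suc i) ℚ.- l Fin.zero)

  -- h = P / D^k ∈ A[x^{±1}].  Since D_f(0) = n+1 ≠ 0, ord_t(h_u) = ord_t(P_u) and
  -- supp h = supp P.  deg(u) ≤ a  ⇔  u ∈ aΔ (a ∈ ℕ).
  Admissible : Poly → Set
  Admissible P = ∀ a u → coeff P a u ≢ + 0 → InDilate a u

  SuppIn : ℕ → Poly → Set
  SuppIn m P = ∀ a u → coeff P a u ≢ + 0 → InDilate m u

  OfGen : RatFun → Set
  OfGen r = Σ ℕ λ m → Σ Poly λ P → Σ ℕ λ k →
      (1 ℕ.≤ m) × Admissible P × SuppIn m P
    × (r ≡ (const (+ ((m ∸ 1) !)) ⊗ P) /D^ k f^ m)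

  Span : (RatFun → Set) → RatFun → Set
  Span G r = Σ (List (AElt × RatFun)) λ l →
      All (λ p → G (proj₂ p)) l
    × (r ≈R sumR (map (λ { (α , g) → scale α g }) l))

  Of : RatFun → Set
  Of = Span OfGen

  dOfGen : RatFun → Set
  dOfGen r = Σ (Fin n) λ i → Σ RatFun λ η → Of η × (r ≡ xdR i η)

  dOf : RatFun → Set
  dOf = Span dOfGen

  CongMod : RatFun → RatFun → Set
  CongMod r s = dOf (r -R s)

module Submission where

-- Write d = |U| and S = x₀ + x₁ + ⋯ + xₙ, so that θf = −tS and xᵢ∂ᵢ f = −t(xᵢ − x₀).
-- The quotient rule gives
--   θ ω_U = d ω_U + Σⱼ ω_{U+eⱼ}   and   xᵢ∂ᵢ ω_U = (Uᵢ − U₀) ω_U + ω_{U+eᵢ} − ω_{U+e₀},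
-- and eliminating Σⱼ ω_{U+eⱼ} yields, for every j,
--   ω_{U+eⱼ} ≡ (θ/(n+1) − Uⱼ) ω_U   (mod dO_f),
-- the error term being an A-combination of the xᵢ∂ᵢ ω_U (this is where 1/(n+1) ∈ A is used).
-- Next, θ maps O_f into itself: θ((m−1)! h/f^m) = (m−1)! θh/f^m + m! t h S/f^{m+1}, and
-- multiplying an admissible h by t xⱼ raises both the t-order and the simplex degree by one.
-- Since θ commutes with every xᵢ∂ᵢ, it preserves dO_f as well, so each operator θ/(n+1) − c
-- respects congruence mod dO_f.  Starting from ω_0 = 1/f and raising the exponents one at a
-- time gives the theorem (for every U, in fact).
--
-- Rational functions are formal quotients N/(D_f^k f^m) compared by cross-multiplication;
-- this comparison is transitive because D_f and f are not zero divisors, both having a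
-- nonzero integer as constant term in t.

open import Defs
open import Data.Nat using (ℕ; suc; _≤_; _<_)
open import Data.Fin using (Fin)
open import Data.Vec using (Vec; lookup; sum)
open import Data.Product using (∃)
open import Relation.Binary.PropositionalEquality using (_≡_)

open import Data.Nat as ℕ using (zero; _∸_; _!; s≤s; z≤n)
import Data.Nat.Properties as ℕP
open import Data.Nat.Induction using (<-rec)
open import Data.Integer as ℤ using (ℤ; +_; -_) renaming (_+_ to _+ᶻ_; _*_ to _*ᶻ_; _-_ to _-ᶻ_)
import Data.Integer.Properties as ℤP
open import Data.Integer.Tactic.RingSolver using (solve-∀)
open import Data.Rational as ℚ using (ℚ; 0ℚ; 1ℚ; _/_) renaming (_+_ to _+q_; _-_ to _-q_; _*_ to _*q_; _≤_ to _≤q_)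
import Data.Rational.Properties as ℚP
import Data.Rational.Unnormalised as ℚᵘ
import Data.Rational.Unnormalised.Properties as ℚᵘP
open import Data.Rational.Solver using (module +-*-Solver)
open import Data.Fin as Fin using ()
import Data.Fin.Properties as FinP
open import Data.Vec as Vec using ([]; _∷_; tabulate; replicate; zipWith)
import Data.Vec.Properties as VecP
open import Data.Vec.Relation.Binary.Pointwise.Extensional using (ext; Pointwise-≡⇒≡)
open import Data.List as List using (List; []; _∷_; _++_; map; concatMap; foldr; allFin)
import Data.List.Properties as ListP
open import Data.List.Relation.Unary.All as All using (All; []; _∷_)
import Data.List.Relation.Unary.All.Properties as AllP
open import Data.Product using (Σ; _×_; _,_; proj₁; proj₂)
open import Data.Bool using (Bool; true; false; _∧_; if_then_else_)
open import Data.Empty using (⊥-elim)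
open import Data.Maybe using (Maybe; just; nothing)
open import Function using (_∘_)
open import Level using (0ℓ)
open import Relation.Binary.PropositionalEquality
open import Relation.Binary.Structures using (IsEquivalence)
import Relation.Binary.Reasoning.Setoid as SetoidReasoning
open import Relation.Nullary using (yes; no; Dec; ¬_)
open import Relation.Nullary.Decidable using (⌊_⌋; map′)
open import Algebra.Bundles using (CommutativeRing)
open import Algebra.Structures using (IsCommutativeRing)
open import Algebra.Solver.Ring.AlmostCommutativeRing using (AlmostCommutativeRing; fromCommutativeRing; _-Raw-AlmostCommutative⟶_)


[i+j]-i≡j : ∀ y x → (x +ᶻ y) -ᶻ x ≡ y
[i+j]-i≡j = solve-∀
i+[j-i]≡j : ∀ x z → x +ᶻ (z -ᶻ x) ≡ z
i+[j-i]≡j = solve-∀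

⌊⌋-cong : ∀ {p q} {P : Set p} {Q : Set q} → (P → Q) → (Q → P) → (d : Dec P) (e : Dec Q) → ⌊ d ⌋ ≡ ⌊ e ⌋
⌊⌋-cong f g (yes p) (yes q) = refl
⌊⌋-cong f g (yes p) (no ¬q) = ⊥-elim (¬q (f p))
⌊⌋-cong f g (no ¬p) (yes q) = ⊥-elim (¬p (g q))
⌊⌋-cong f g (no ¬p) (no ¬q) = refl

if-same : ∀ {A : Set} (B : Bool) (x : A) → (if B then x else x) ≡ x
if-same true x = refl
if-same false x = refl

⌊⌋-false : ∀ {p} {P : Set p} → ¬ P → (d : Dec P) → ⌊ d ⌋ ≡ false
⌊⌋-false ¬p (yes p) = ⊥-elim (¬p p)
⌊⌋-false ¬p (no _) = refl

⌊⌋-map′ : ∀ {A B : Set} {f : A → B} {g : B → A} (d : Dec A) → ⌊ map′ f g d ⌋ ≡ ⌊ d ⌋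
⌊⌋-map′ (yes _) = refl
⌊⌋-map′ (no _) = refl

if-yes : ∀ {A P : Set} {x y : A} (d : Dec P) → P → (if ⌊ d ⌋ then x else y) ≡ x
if-yes (yes _) p = refl
if-yes (no ¬p) p = ⊥-elim (¬p p)

if-no : ∀ {A P : Set} {x y : A} (d : Dec P) → ¬ P → (if ⌊ d ⌋ then x else y) ≡ y
if-no (yes p) ¬p = ⊥-elim (¬p p)
if-no (no _) ¬p = refl

Vec-ext : ∀ {A : Set} {m} (u v : Vec A m) → (∀ i → lookup u i ≡ lookup v i) → u ≡ v
Vec-ext u v e = Pointwise-≡⇒≡ (ext e)

subᵛ : ∀ {n} → Vec ℤ n → Vec ℤ n → Vec ℤ n
subᵛ = zipWith _-ᶻ_

addᵛ≡⇒≡subᵛ : ∀ {n} (v w u : Vec ℤ n) → zipWith _+ᶻ_ v w ≡ u → w ≡ subᵛ u v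
addᵛ≡⇒≡subᵛ [] [] [] e = refl
addᵛ≡⇒≡subᵛ (x ∷ v) (y ∷ w) (z ∷ u) e with VecP.∷-injective e
... | e1 , e2 = cong₂ _∷_ (trans (sym ([i+j]-i≡j y x)) (cong (ℤ._- x) e1)) (addᵛ≡⇒≡subᵛ v w u e2)

≡subᵛ⇒addᵛ≡ : ∀ {n} (v w u : Vec ℤ n) → w ≡ subᵛ u v → zipWith _+ᶻ_ v w ≡ u
≡subᵛ⇒addᵛ≡ [] [] [] e = refl
≡subᵛ⇒addᵛ≡ (x ∷ v) (y ∷ w) (z ∷ u) e with VecP.∷-injective e
... | e1 , e2 = cong₂ _∷_ (trans (cong (λ t → x +ᶻ t) e1) (i+[j-i]≡j x z)) (≡subᵛ⇒addᵛ≡ v w u e2)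

module Coefficients (n : ℕ) where

  termCoeff : Term n → ℕ → Vec ℤ n → ℤ
  termCoeff (c , a' , u') a u = if ⌊ a' ℕ.≟ a ⌋ ∧ ⌊ VecP.≡-dec ℤ._≟_ u' u ⌋ then c else + 0

  termCoeff-0 : ∀ a' u' a u → termCoeff (+ 0 , a' , u') a u ≡ + 0
  termCoeff-0 a' u' a u = if-same (⌊ a' ℕ.≟ a ⌋ ∧ ⌊ VecP.≡-dec ℤ._≟_ u' u ⌋) (+ 0)

  sumMap : (Term n → ℤ) → List (Term n) → ℤ
  sumMap g [] = + 0
  sumMap g (s ∷ P) = g s +ᶻ sumMap g P

  coeff≡sumMap : ∀ P a u → coeff n P a u ≡ sumMap (λ s → termCoeff s a u) P
  coeff≡sumMap [] a u = refl
  coeff≡sumMap (s ∷ P) a u = cong (termCoeff s a u +ᶻ_) (coeff≡sumMap P a u)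

  sumMap-++ : ∀ g P Q → sumMap g (P ++ Q) ≡ sumMap g P +ᶻ sumMap g Q
  sumMap-++ g [] Q = sym (ℤP.+-identityˡ _)
  sumMap-++ g (s ∷ P) Q = trans (cong (g s +ᶻ_) (sumMap-++ g P Q)) (sym (ℤP.+-assoc (g s) _ _))

  sumMap-map : ∀ g h P → sumMap g (map h P) ≡ sumMap (g ∘ h) P
  sumMap-map g h [] = refl
  sumMap-map g h (s ∷ P) = cong (g (h s) +ᶻ_) (sumMap-map g h P)

  sumMap-cong : ∀ {g h} → (∀ s → g s ≡ h s) → ∀ P → sumMap g P ≡ sumMap h P
  sumMap-cong e [] = refl
  sumMap-cong e (s ∷ P) = cong₂ _+ᶻ_ (e s) (sumMap-cong e P)

  sumMap-⊗ : ∀ g P Q → sumMap g (_⊗_ n P Q) ≡ sumMap (λ s → sumMap (λ t → g (mulT n s t)) Q) P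
  sumMap-⊗ g [] Q = refl
  sumMap-⊗ g (s ∷ P) Q = trans (sumMap-++ g (map (mulT n s) Q) _) (cong₂ _+ᶻ_ (sumMap-map g (mulT n s) Q) (sumMap-⊗ g P Q))

  sumMap-0 : ∀ P → sumMap (λ _ → + 0) P ≡ + 0
  sumMap-0 [] = refl
  sumMap-0 (s ∷ P) = trans (ℤP.+-identityˡ _) (sumMap-0 P)

  sumMap-+ : ∀ g h P → sumMap (λ s → g s +ᶻ h s) P ≡ sumMap g P +ᶻ sumMap h P
  sumMap-+ g h [] = refl
  sumMap-+ g h (s ∷ P) = trans (cong ((g s +ᶻ h s) +ᶻ_) (sumMap-+ g h P)) (+-interchange (g s) (h s) _ _)
    where
    +-interchange : ∀ a b c d → (a +ᶻ b) +ᶻ (c +ᶻ d) ≡ (a +ᶻ c) +ᶻ (b +ᶻ d)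
    +-interchange = solve-∀

  sumMap-swap : ∀ (g : Term n → Term n → ℤ) P Q → sumMap (λ s → sumMap (λ t → g s t) Q) P ≡ sumMap (λ t → sumMap (λ s → g s t) P) Q
  sumMap-swap g [] Q = sym (sumMap-0 Q)
  sumMap-swap g (s ∷ P) Q = trans (cong (sumMap (g s) Q +ᶻ_) (sumMap-swap g P Q)) (sym (sumMap-+ (g s) (λ t → sumMap (λ s' → g s' t) P) Q))

  mulT-comm : ∀ s t → mulT n s t ≡ mulT n t s
  mulT-comm (c , a , u) (c' , a' , u') = cong₂ _,_ (ℤP.*-comm c c') (cong₂ _,_ (ℕP.+-comm a a') (VecP.zipWith-comm ℤP.+-comm u u'))

  mulT-assoc : ∀ s t r → mulT n (mulT n s t) r ≡ mulT n s (mulT n t r)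
  mulT-assoc (c , a , u) (c' , a' , u') (c'' , a'' , u'') = cong₂ _,_ (ℤP.*-assoc c c' c'') (cong₂ _,_ (ℕP.+-assoc a a' a'') (VecP.zipWith-assoc ℤP.+-assoc u u' u''))

  _≈_ : Poly n → Poly n → Set
  _≈_ = _≈P_ n

  infixl 6 _⊕'_
  infixl 7 _⊗'_
  _⊕'_ : Poly n → Poly n → Poly n
  _⊕'_ = _⊕_ n
  _⊗'_ : Poly n → Poly n → Poly n
  _⊗'_ = _⊗_ n

  ⊗-comm≈ : ∀ P Q → (P ⊗' Q) ≈ (Q ⊗' P)
  ⊗-comm≈ P Q a u = begin
      coeff n (P ⊗' Q) a u ≡⟨ coeff≡sumMap (P ⊗' Q) a u ⟩
      sumMap (λ s → termCoeff s a u) (P ⊗' Q) ≡⟨ sumMap-⊗ (λ s → termCoeff s a u) P Q ⟩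
      sumMap (λ s → sumMap (λ t → termCoeff (mulT n s t) a u) Q) P ≡⟨ sumMap-swap (λ s t → termCoeff (mulT n s t) a u) P Q ⟩
      sumMap (λ t → sumMap (λ s → termCoeff (mulT n s t) a u) P) Q ≡⟨ sumMap-cong (λ t → sumMap-cong (λ s → cong (λ z → termCoeff z a u) (mulT-comm s t)) P) Q ⟩
      sumMap (λ t → sumMap (λ s → termCoeff (mulT n t s) a u) P) Q ≡⟨ sym (sumMap-⊗ (λ s → termCoeff s a u) Q P) ⟩
      sumMap (λ s → termCoeff s a u) (Q ⊗' P) ≡⟨ sym (coeff≡sumMap (Q ⊗' P) a u) ⟩
      coeff n (Q ⊗' P) a u ∎
    where open ≡-Reasoning

  ⊗-assoc≈ : ∀ P Q R → ((P ⊗' Q) ⊗' R) ≈ (P ⊗' (Q ⊗' R))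
  ⊗-assoc≈ P Q R a u = begin
      coeff n ((P ⊗' Q) ⊗' R) a u ≡⟨ coeff≡sumMap ((P ⊗' Q) ⊗' R) a u ⟩
      sumMap (λ s → termCoeff s a u) ((P ⊗' Q) ⊗' R) ≡⟨ sumMap-⊗ (λ s → termCoeff s a u) (P ⊗' Q) R ⟩
      sumMap (λ x → sumMap (λ r → termCoeff (mulT n x r) a u) R) (P ⊗' Q) ≡⟨ sumMap-⊗ (λ x → sumMap (λ r → termCoeff (mulT n x r) a u) R) P Q ⟩
      sumMap (λ s → sumMap (λ t → sumMap (λ r → termCoeff (mulT n (mulT n s t) r) a u) R) Q) P
        ≡⟨ sumMap-cong (λ s → sumMap-cong (λ t → sumMap-cong (λ r → cong (λ z → termCoeff z a u) (mulT-assoc s t r)) R) Q) P ⟩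
      sumMap (λ s → sumMap (λ t → sumMap (λ r → termCoeff (mulT n s (mulT n t r)) a u) R) Q) P
        ≡⟨ sumMap-cong (λ s → sym (sumMap-⊗ (λ y → termCoeff (mulT n s y) a u) Q R)) P ⟩
      sumMap (λ s → sumMap (λ y → termCoeff (mulT n s y) a u) (Q ⊗' R)) P ≡⟨ sym (sumMap-⊗ (λ s → termCoeff s a u) P (Q ⊗' R)) ⟩
      sumMap (λ s → termCoeff s a u) (P ⊗' (Q ⊗' R)) ≡⟨ sym (coeff≡sumMap (P ⊗' (Q ⊗' R)) a u) ⟩
      coeff n (P ⊗' (Q ⊗' R)) a u ∎
    where open ≡-Reasoning

  coeff-++ : ∀ P Q a u → coeff n (P ++ Q) a u ≡ coeff n P a u +ᶻ coeff n Q a u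
  coeff-++ P Q a u = trans (coeff≡sumMap (P ++ Q) a u) (trans (sumMap-++ _ P Q) (sym (cong₂ _+ᶻ_ (coeff≡sumMap P a u) (coeff≡sumMap Q a u))))

  ⊗-distribˡ≈ : ∀ P Q R → (P ⊗' (Q ⊕' R)) ≈ ((P ⊗' Q) ⊕' (P ⊗' R))
  ⊗-distribˡ≈ P Q R a u = begin
      coeff n (P ⊗' (Q ⊕' R)) a u ≡⟨ coeff≡sumMap (P ⊗' (Q ⊕' R)) a u ⟩
      sumMap (λ s → termCoeff s a u) (P ⊗' (Q ⊕' R)) ≡⟨ sumMap-⊗ (λ s → termCoeff s a u) P (Q ⊕' R) ⟩
      sumMap (λ s → sumMap (λ t → termCoeff (mulT n s t) a u) (Q ++ R)) P ≡⟨ sumMap-cong (λ s → sumMap-++ (λ t → termCoeff (mulT n s t) a u) Q R) P ⟩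
      sumMap (λ s → sumMap (λ t → termCoeff (mulT n s t) a u) Q +ᶻ sumMap (λ t → termCoeff (mulT n s t) a u) R) P ≡⟨ sumMap-+ (λ s → sumMap (λ t → termCoeff (mulT n s t) a u) Q) (λ s → sumMap (λ t → termCoeff (mulT n s t) a u) R) P ⟩
      sumMap (λ s → sumMap (λ t → termCoeff (mulT n s t) a u) Q) P +ᶻ sumMap (λ s → sumMap (λ t → termCoeff (mulT n s t) a u) R) P
        ≡⟨ sym (cong₂ _+ᶻ_ (trans (coeff≡sumMap (P ⊗' Q) a u) (sumMap-⊗ (λ s → termCoeff s a u) P Q)) (trans (coeff≡sumMap (P ⊗' R) a u) (sumMap-⊗ (λ s → termCoeff s a u) P R))) ⟩
      coeff n (P ⊗' Q) a u +ᶻ coeff n (P ⊗' R) a u ≡⟨ sym (coeff-++ (P ⊗' Q) (P ⊗' R) a u) ⟩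
      coeff n ((P ⊗' Q) ⊕' (P ⊗' R)) a u ∎
    where open ≡-Reasoning

  shiftAt : ℤ → ℕ → Vec ℤ n → (ℕ → Vec ℤ n → ℤ) → ℕ → Vec ℤ n → ∀ {b a} → Dec (b ℕ.≤ a) → ℤ
  shiftAt c b v F a u (yes _) = c *ᶻ F (a ∸ b) (subᵛ u v)
  shiftAt c b v F a u (no _) = + 0

  shiftCoeff : Term n → (ℕ → Vec ℤ n → ℤ) → ℕ → Vec ℤ n → ℤ
  shiftCoeff (c , b , v) F a u = shiftAt c b v F a u (b ℕ.≤? a)

  if-* : ∀ (B : Bool) c c' → (if B then c *ᶻ c' else + 0) ≡ c *ᶻ (if B then c' else + 0)
  if-* true c c' = refl
  if-* false c c' = sym (ℤP.*-zeroʳ c)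

  termCoeff-mulT : ∀ s t a u → termCoeff (mulT n s t) a u ≡ shiftCoeff s (termCoeff t) a u
  termCoeff-mulT (c , b , v) (c' , a' , u') a u with b ℕ.≤? a
  ... | yes b≤a
    rewrite ⌊⌋-cong {P = b ℕ.+ a' ≡ a} {Q = a' ≡ a ∸ b}
              (λ e → trans (sym (ℕP.m+n∸m≡n b a')) (cong (_∸ b) e))
              (λ e → trans (cong (b ℕ.+_) e) (ℕP.m+[n∸m]≡n b≤a)) (b ℕ.+ a' ℕ.≟ a) (a' ℕ.≟ a ∸ b)
          | ⌊⌋-cong {P = zipWith _+ᶻ_ v u' ≡ u} {Q = u' ≡ subᵛ u v}
              (addᵛ≡⇒≡subᵛ v u' u) (≡subᵛ⇒addᵛ≡ v u' u) (VecP.≡-dec ℤ._≟_ (zipWith _+ᶻ_ v u') u) (VecP.≡-dec ℤ._≟_ u' (subᵛ u v))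
    = if-* _ c c'
  ... | no b≰a rewrite ⌊⌋-false {P = b ℕ.+ a' ≡ a} (λ e → b≰a (subst (b ℕ.≤_) e (ℕP.m≤m+n b a'))) (b ℕ.+ a' ℕ.≟ a) = refl

  shiftAt-+ : ∀ c b v F G a u {b' a'} (d : Dec (b' ℕ.≤ a')) → shiftAt c b v (λ x y → F x y +ᶻ G x y) a u d ≡ shiftAt c b v F a u d +ᶻ shiftAt c b v G a u d
  shiftAt-+ c b v F G a u (yes _) = ℤP.*-distribˡ-+ c _ _
  shiftAt-+ c b v F G a u (no _) = refl

  shiftCoeff-+ : ∀ s F G a u → shiftCoeff s (λ x y → F x y +ᶻ G x y) a u ≡ shiftCoeff s F a u +ᶻ shiftCoeff s G a u
  shiftCoeff-+ (c , b , v) F G a u = shiftAt-+ c b v F G a u (b ℕ.≤? a)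

  shiftAt-0 : ∀ c b v a u {b' a'} (d : Dec (b' ℕ.≤ a')) → shiftAt c b v (λ _ _ → + 0) a u d ≡ + 0
  shiftAt-0 c b v a u (yes _) = ℤP.*-zeroʳ c
  shiftAt-0 c b v a u (no _) = refl

  shiftAt-cong : ∀ c b v F G a u → (∀ x y → F x y ≡ G x y) → ∀ {b' a'} (d : Dec (b' ℕ.≤ a')) → shiftAt c b v F a u d ≡ shiftAt c b v G a u d
  shiftAt-cong c b v F G a u e (yes _) = cong (c *ᶻ_) (e _ _)
  shiftAt-cong c b v F G a u e (no _) = refl

  shiftCoeff-cong : ∀ s F G a u → (∀ x y → F x y ≡ G x y) → shiftCoeff s F a u ≡ shiftCoeff s G a u
  shiftCoeff-cong (c , b , v) F G a u e = shiftAt-cong c b v F G a u e (b ℕ.≤? a)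

  sumMap-mulT : ∀ s Q a u → sumMap (λ t → termCoeff (mulT n s t) a u) Q ≡ shiftCoeff s (coeff n Q) a u
  sumMap-mulT (c , b , v) [] a u = sym (shiftAt-0 c b v a u (b ℕ.≤? a))
  sumMap-mulT s (t ∷ Q) a u = trans (cong₂ _+ᶻ_ (termCoeff-mulT s t a u) (sumMap-mulT s Q a u)) (sym (shiftCoeff-+ s (termCoeff t) (coeff n Q) a u))

  coeff-⊗ : ∀ P Q a u → coeff n (P ⊗' Q) a u ≡ sumMap (λ s → shiftCoeff s (coeff n Q) a u) P
  coeff-⊗ P Q a u = trans (coeff≡sumMap (P ⊗' Q) a u) (trans (sumMap-⊗ (λ s → termCoeff s a u) P Q) (sumMap-cong (λ s → sumMap-mulT s Q a u) P))

  ⊗-congˡ≈ : ∀ P {Q Q'} → Q ≈ Q' → (P ⊗' Q) ≈ (P ⊗' Q')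
  ⊗-congˡ≈ P {Q} {Q'} e a u = trans (coeff-⊗ P Q a u) (trans (sumMap-cong (λ s → shiftCoeff-cong s _ _ a u e) P) (sym (coeff-⊗ P Q' a u)))

  ≈-trans : ∀ {P Q R} → P ≈ Q → Q ≈ R → P ≈ R
  ≈-trans e f a u = trans (e a u) (f a u)

  negTerm : Term n → Term n
  negTerm (c , a , u) = (- c , a , u)

  termCoeff-neg : ∀ s a u → termCoeff (negTerm s) a u ≡ - termCoeff s a u
  termCoeff-neg (c , a' , u') a u with ⌊ a' ℕ.≟ a ⌋ ∧ ⌊ VecP.≡-dec ℤ._≟_ u' u ⌋
  ... | true = refl
  ... | false = refl

  coeff-neg : ∀ P a u → coeff n (negP n P) a u ≡ - coeff n P a u
  coeff-neg [] a u = refl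
  coeff-neg (s ∷ P) a u = trans (cong₂ _+ᶻ_ (termCoeff-neg s a u) (coeff-neg P a u)) (sym (ℤP.neg-distrib-+ (termCoeff s a u) _))

  ⊕-cong≈ : ∀ {P P' Q Q'} → P ≈ P' → Q ≈ Q' → (P ⊕' Q) ≈ (P' ⊕' Q')
  ⊕-cong≈ {P} {P'} {Q} {Q'} e f a u = trans (coeff-++ P Q a u) (trans (cong₂ _+ᶻ_ (e a u) (f a u)) (sym (coeff-++ P' Q' a u)))

  ⊕-comm≈ : ∀ P Q → (P ⊕' Q) ≈ (Q ⊕' P)
  ⊕-comm≈ P Q a u = trans (coeff-++ P Q a u) (trans (ℤP.+-comm (coeff n P a u) (coeff n Q a u)) (sym (coeff-++ Q P a u)))

  neg-cong≈ : ∀ {P Q} → P ≈ Q → negP n P ≈ negP n Q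
  neg-cong≈ {P} {Q} e a u = trans (coeff-neg P a u) (trans (cong -_ (e a u)) (sym (coeff-neg Q a u)))

  neg-inverseˡ≈ : ∀ P → (negP n P ⊕' P) ≈ []
  neg-inverseˡ≈ P a u = trans (coeff-++ (negP n P) P a u) (trans (cong (_+ᶻ coeff n P a u) (coeff-neg P a u)) (ℤP.+-inverseˡ (coeff n P a u)))

  neg-inverseʳ≈ : ∀ P → (P ⊕' negP n P) ≈ []
  neg-inverseʳ≈ P = ≈-trans {P ⊕' negP n P} {negP n P ⊕' P} {[]} (⊕-comm≈ P (negP n P)) (neg-inverseˡ≈ P)

  ⊗-congʳ≈ : ∀ {P P'} Q → P ≈ P' → (P ⊗' Q) ≈ (P' ⊗' Q)
  ⊗-congʳ≈ {P} {P'} Q e = ≈-trans {P ⊗' Q} {Q ⊗' P} {P' ⊗' Q} (⊗-comm≈ P Q) (≈-trans {Q ⊗' P} {Q ⊗' P'} {P' ⊗' Q} (⊗-congˡ≈ Q e) (⊗-comm≈ Q P'))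

  ⊗-cong≈ : ∀ {P P' Q Q'} → P ≈ P' → Q ≈ Q' → (P ⊗' Q) ≈ (P' ⊗' Q')
  ⊗-cong≈ {P} {P'} {Q} {Q'} e f = ≈-trans {P ⊗' Q} {P' ⊗' Q} {P' ⊗' Q'} (⊗-congʳ≈ {P} {P'} Q e) (⊗-congˡ≈ P' {Q} {Q'} f)

  subᵛ-identityʳ : ∀ {m} (u : Vec ℤ m) → subᵛ u (replicate m (+ 0)) ≡ u
  subᵛ-identityʳ [] = refl
  subᵛ-identityʳ (x ∷ u) = cong₂ _∷_ (ℤP.+-identityʳ x) (subᵛ-identityʳ u)

  one : Poly n
  one = const n (+ 1)

  shiftAt-one : ∀ F a u (d : Dec (0 ℕ.≤ a)) → shiftAt (+ 1) 0 (0v n) F a u d ≡ F a u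
  shiftAt-one F a u (yes _) = trans (ℤP.*-identityˡ _) (cong (F a) (subᵛ-identityʳ u))
  shiftAt-one F a u (no ¬p) = ⊥-elim (¬p ℕ.z≤n)

  ⊗-identityˡ≈ : ∀ P → (one ⊗' P) ≈ P
  ⊗-identityˡ≈ P a u = trans (coeff-⊗ one P a u) (trans (ℤP.+-identityʳ _) (shiftAt-one (coeff n P) a u (0 ℕ.≤? a)))

  ⊗-distribʳ≈ : ∀ P Q R → ((Q ⊕' R) ⊗' P) ≈ ((Q ⊗' P) ⊕' (R ⊗' P))
  ⊗-distribʳ≈ P Q R = ≈-trans {(Q ⊕' R) ⊗' P} {P ⊗' (Q ⊕' R)} {(Q ⊗' P) ⊕' (R ⊗' P)} (⊗-comm≈ (Q ⊕' R) P) (≈-trans {P ⊗' (Q ⊕' R)} {(P ⊗' Q) ⊕' (P ⊗' R)} {(Q ⊗' P) ⊕' (R ⊗' P)} (⊗-distribˡ≈ P Q R) (⊕-cong≈ {P ⊗' Q} {Q ⊗' P} {P ⊗' R} {R ⊗' P} (⊗-comm≈ P Q) (⊗-comm≈ P R)))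


  -- A record rather than a synonym of _≈_, so that P and Q can be inferred from a proof.
  infix 4 _≋_
  record _≋_ (P Q : Poly n) : Set where
    constructor mk
    field get : P ≈ Q
  open _≋_ public

  ≋-refl : ∀ {P} → P ≋ P
  ≋-refl = mk (λ a u → refl)
  ≋-sym : ∀ {P Q} → P ≋ Q → Q ≋ P
  ≋-sym (mk e) = mk (λ a u → sym (e a u))
  ≋-trans : ∀ {P Q R} → P ≋ Q → Q ≋ R → P ≋ R
  ≋-trans (mk e) (mk f) = mk (λ a u → trans (e a u) (f a u))
  ≡⇒≋ : ∀ {P Q} → P ≡ Q → P ≋ Q
  ≡⇒≋ refl = ≋-refl

  ≋-isEquivalence : IsEquivalence _≋_
  ≋-isEquivalence = record { refl = ≋-refl ; sym = ≋-sym ; trans = ≋-trans }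

  isCommutativeRing : IsCommutativeRing _≋_ _⊕'_ _⊗'_ (negP n) [] one
  isCommutativeRing = record
    { isRing = record
      { +-isAbelianGroup = record
        { isGroup = record
          { isMonoid = record
            { isSemigroup = record
              { isMagma = record { isEquivalence = ≋-isEquivalence ; ∙-cong = λ {P} {P'} {Q} {Q'} e f → mk (⊕-cong≈ {P} {P'} {Q} {Q'} (get e) (get f)) }
              ; assoc = λ P Q R → ≡⇒≋ (ListP.++-assoc P Q R) }
            ; identity = (λ P → ≋-refl) , (λ P → ≡⇒≋ (ListP.++-identityʳ P)) }
          ; inverse = (λ P → mk (neg-inverseˡ≈ P)) , (λ P → mk (neg-inverseʳ≈ P))
          ; ⁻¹-cong = λ {P} {Q} e → mk (neg-cong≈ {P} {Q} (get e)) }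
        ; comm = λ P Q → mk (⊕-comm≈ P Q) }
      ; *-cong = λ {P} {P'} {Q} {Q'} e f → mk (⊗-cong≈ {P} {P'} {Q} {Q'} (get e) (get f))
      ; *-assoc = λ P Q R → mk (⊗-assoc≈ P Q R)
      ; *-identity = (λ P → mk (⊗-identityˡ≈ P)) , (λ P → mk (≈-trans {P ⊗' one} {one ⊗' P} {P} (⊗-comm≈ P one) (⊗-identityˡ≈ P)))
      ; distrib = (λ P Q R → mk (⊗-distribˡ≈ P Q R)) , (λ P Q R → mk (⊗-distribʳ≈ P Q R)) }
    ; *-comm = λ P Q → mk (⊗-comm≈ P Q) }

  commutativeRing : CommutativeRing 0ℓ 0ℓ
  commutativeRing = record { isCommutativeRing = isCommutativeRing }


module Solving (n : ℕ) where
  open Coefficients n public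
  almostCommutativeRing : AlmostCommutativeRing 0ℓ 0ℓ
  almostCommutativeRing = fromCommutativeRing commutativeRing
  module ≋R = SetoidReasoning (CommutativeRing.setoid commutativeRing)

  neg : Poly n → Poly n
  neg = negP n

  ⊕-cong : ∀ {P P' Q Q'} → P ≋ P' → Q ≋ Q' → P ⊕' Q ≋ P' ⊕' Q'
  ⊕-cong {P} {P'} {Q} {Q'} e f = mk (⊕-cong≈ {P} {P'} {Q} {Q'} (get e) (get f))
  ⊗-cong : ∀ {P P' Q Q'} → P ≋ P' → Q ≋ Q' → P ⊗' Q ≋ P' ⊗' Q'
  ⊗-cong {P} {P'} {Q} {Q'} e f = mk (⊗-cong≈ {P} {P'} {Q} {Q'} (get e) (get f))
  ⊗-congʳ : ∀ {P P'} → P ≋ P' → ∀ Q → P ⊗' Q ≋ P' ⊗' Q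
  ⊗-congʳ {P} {P'} e Q = ⊗-cong {P} {P'} {Q} {Q} e ≋-refl
  ⊗-congˡ : ∀ P {Q Q'} → Q ≋ Q' → P ⊗' Q ≋ P ⊗' Q'
  ⊗-congˡ P {Q} {Q'} e = ⊗-cong {P} {P} {Q} {Q'} ≋-refl e
  ⊕-congʳ : ∀ {P P'} → P ≋ P' → ∀ Q → P ⊕' Q ≋ P' ⊕' Q
  ⊕-congʳ {P} {P'} e Q = ⊕-cong {P} {P'} {Q} {Q} e ≋-refl
  ⊕-congˡ : ∀ P {Q Q'} → Q ≋ Q' → P ⊕' Q ≋ P ⊕' Q'
  ⊕-congˡ P {Q} {Q'} e = ⊕-cong {P} {P} {Q} {Q'} ≋-refl e
  neg-cong : ∀ {P Q} → P ≋ Q → neg P ≋ neg Q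
  neg-cong {P} {Q} e = mk (neg-cong≈ {P} {Q} (get e))

  if-+ : ∀ (B : Bool) c1 c2 → (if B then c1 +ᶻ c2 else + 0) ≡ (if B then c1 else + 0) +ᶻ (if B then c2 else + 0)
  if-+ true c1 c2 = refl
  if-+ false c1 c2 = refl

  termCoeff-+ : ∀ c1 c2 a' u' a u → termCoeff (c1 +ᶻ c2 , a' , u') a u ≡ termCoeff (c1 , a' , u') a u +ᶻ termCoeff (c2 , a' , u') a u
  termCoeff-+ c1 c2 a' u' a u = if-+ _ c1 c2

  constP : ℤ → Poly n
  constP = const n

  constP-+ : ∀ a b → constP (a +ᶻ b) ≋ constP a ⊕' constP b
  constP-+ a b = mk (λ x u → trans (ℤP.+-identityʳ _) (trans (termCoeff-+ a b 0 (0v n) x u) (cong (termCoeff (a , 0 , 0v n) x u +ᶻ_) (sym (ℤP.+-identityʳ _)))))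

  0ᵛ+0ᵛ≡0ᵛ : ∀ {m} → zipWith _+ᶻ_ (replicate m (+ 0)) (replicate m (+ 0)) ≡ replicate m (+ 0)
  0ᵛ+0ᵛ≡0ᵛ {zero} = refl
  0ᵛ+0ᵛ≡0ᵛ {suc m} = cong (+ 0 ∷_) (0ᵛ+0ᵛ≡0ᵛ {m})

  constP-* : ∀ a b → constP (a *ᶻ b) ≋ constP a ⊗' constP b
  constP-* a b = ≡⇒≋ (cong (λ v → (a *ᶻ b , 0 , v) ∷ []) (sym 0ᵛ+0ᵛ≡0ᵛ))

  constP-neg : ∀ a → constP (- a) ≋ neg (constP a)
  constP-neg a = ≋-refl

  constP-0 : constP (+ 0) ≋ []
  constP-0 = mk (λ a u → trans (ℤP.+-identityʳ _) (termCoeff-0 0 (0v n) a u))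

  constP-homomorphism : ℤ.+-*-rawRing -Raw-AlmostCommutative⟶ almostCommutativeRing
  constP-homomorphism = record { ⟦_⟧ = constP ; +-homo = constP-+ ; *-homo = constP-* ; -‿homo = constP-neg ; 0-homo = constP-0 ; 1-homo = ≋-refl }

  constP-≟ : (c d : ℤ) → Maybe (constP c ≋ constP d)
  constP-≟ c d with c ℤ.≟ d
  ... | yes refl = just ≋-refl
  ... | no _ = nothing

  import Algebra.Solver.Ring ℤ.+-*-rawRing almostCommutativeRing constP-homomorphism constP-≟ as PolySolver
  open PolySolver public using (_:+_; _:*_; :-_; _:-_; _:=_; con) renaming (solve to rsolve)

  pow : Poly n → ℕ → Poly n
  pow = powP n


  ⊗-identityˡ : ∀ P → one ⊗' P ≋ P
  ⊗-identityˡ P = mk (⊗-identityˡ≈ P)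

  ⊗-comm : ∀ P Q → P ⊗' Q ≋ Q ⊗' P
  ⊗-comm P Q = mk (⊗-comm≈ P Q)

  ⊗-zeroˡ : ∀ P → [] ⊗' P ≋ []
  ⊗-zeroˡ P = ≋-refl

  ⊗-zeroʳ : ∀ P → P ⊗' [] ≋ []
  ⊗-zeroʳ P = ≋-trans (⊗-comm P []) ≋-refl

  pow-+ : ∀ P a b → pow P (a ℕ.+ b) ≋ pow P a ⊗' pow P b
  pow-+ P zero b = ≋-sym (⊗-identityˡ (pow P b))
  pow-+ P (suc a) b = begin
      P ⊗' pow P (a ℕ.+ b) ≈⟨ ⊗-congˡ P (pow-+ P a b) ⟩
      P ⊗' (pow P a ⊗' pow P b) ≈⟨ ≋-sym (mk (⊗-assoc≈ P (pow P a) (pow P b))) ⟩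
      P ⊗' pow P a ⊗' pow P b ∎
    where open ≋R

  x-y≋0⇒x≋y : ∀ X Y → X ⊕' neg Y ≋ [] → X ≋ Y
  x-y≋0⇒x≋y X Y e = begin
      X ≈⟨ rsolve 2 (λ x y → x := (x :- y) :+ y) ≋-refl X Y ⟩
      (X ⊕' neg Y) ⊕' Y ≈⟨ ⊕-congʳ e Y ⟩
      Y ∎
    where open ≋R

  ⊗-vanishesʳ : ∀ C {P} → P ≋ [] → C ⊗' P ≋ []
  ⊗-vanishesʳ C e = ≋-trans (⊗-congˡ C e) (⊗-zeroʳ C)

  x≋y⇒x-y≋0 : ∀ {X Y} → X ≋ Y → X ⊕' neg Y ≋ []
  x≋y⇒x-y≋0 {X} {Y} e = ≋-trans (⊕-congʳ e (neg Y)) (mk (neg-inverseʳ≈ Y))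


weight-leibniz : ∀ x y c c' → (x +ᶻ y) *ᶻ (c *ᶻ c') ≡ (x *ᶻ c) *ᶻ c' +ᶻ c *ᶻ (y *ᶻ c')
weight-leibniz = solve-∀

module Derivations (n : ℕ) where
  open Solving n public

  record Weight : Set where
    field
      w : ℕ → Vec ℤ n → ℤ
      w-homo : ∀ a u a' u' → w (a ℕ.+ a') (zipWith _+ᶻ_ u u') ≡ w a u +ᶻ w a' u'
      w-0 : w 0 (0v n) ≡ + 0

  module Derivation (W : Weight) where
    open Weight W
    derTerm : Term n → Term n
    derTerm (c , a , u) = (w a u *ᶻ c , a , u)

    δ : Poly n → Poly n
    δ = derP n w

    if-weight : ∀ {a' a : ℕ} {u' u : Vec ℤ n} c (d1 : Dec (a' ≡ a)) (d2 : Dec (u' ≡ u)) →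
          (if ⌊ d1 ⌋ ∧ ⌊ d2 ⌋ then w a' u' *ᶻ c else + 0) ≡ w a u *ᶻ (if ⌊ d1 ⌋ ∧ ⌊ d2 ⌋ then c else + 0)
    if-weight c (yes refl) (yes refl) = refl
    if-weight {a = a} {u = u} c (yes _) (no _) = sym (ℤP.*-zeroʳ (w a u))
    if-weight {a = a} {u = u} c (no _) d2 = sym (ℤP.*-zeroʳ (w a u))

    termCoeff-der : ∀ s a u → termCoeff (derTerm s) a u ≡ w a u *ᶻ termCoeff s a u
    termCoeff-der (c , a' , u') a u = if-weight {a'} {a} {u'} {u} c (a' ℕ.≟ a) (VecP.≡-dec ℤ._≟_ u' u)

    δ-coeff : ∀ P a u → coeff n (δ P) a u ≡ w a u *ᶻ coeff n P a u
    δ-coeff [] a u = sym (ℤP.*-zeroʳ (w a u))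
    δ-coeff (s ∷ P) a u = trans (cong₂ _+ᶻ_ (termCoeff-der s a u) (δ-coeff P a u)) (sym (ℤP.*-distribˡ-+ (w a u) _ _))

    δ-cong : ∀ {P Q} → P ≋ Q → δ P ≋ δ Q
    δ-cong {P} {Q} (mk e) = mk (λ a u → trans (δ-coeff P a u) (trans (cong (w a u *ᶻ_) (e a u)) (sym (δ-coeff Q a u))))

    δ-⊕ : ∀ P Q → δ (P ⊕' Q) ≋ δ P ⊕' δ Q
    δ-⊕ P Q = ≡⇒≋ (ListP.map-++ _ P Q)

    δ-neg : ∀ P → δ (neg P) ≋ neg (δ P)
    δ-neg P = mk (λ a u → trans (δ-coeff (neg P) a u) (trans (cong (w a u *ᶻ_) (coeff-neg P a u)) (trans (sym (ℤP.neg-distribʳ-* (w a u) _)) (trans (cong -_ (sym (δ-coeff P a u))) (sym (coeff-neg (δ P) a u))))))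

    derTerm-mulT : ∀ s t a u → termCoeff (derTerm (mulT n s t)) a u ≡ termCoeff (mulT n (derTerm s) t) a u +ᶻ termCoeff (mulT n s (derTerm t)) a u
    derTerm-mulT (c , b , v) (c' , a' , u') a u =
      trans (cong (λ z → termCoeff (z , b ℕ.+ a' , zipWith _+ᶻ_ v u') a u) (trans (cong (_*ᶻ (c *ᶻ c')) (w-homo b v a' u')) (weight-leibniz (w b v) (w a' u') c c')))
            (termCoeff-+ (w b v *ᶻ c *ᶻ c') (c *ᶻ (w a' u' *ᶻ c')) (b ℕ.+ a') (zipWith _+ᶻ_ v u') a u)

    δ-⊗ : ∀ P Q → δ (P ⊗' Q) ≋ δ P ⊗' Q ⊕' P ⊗' δ Q
    δ-⊗ P Q = mk λ a u → begin
        coeff n (δ (P ⊗' Q)) a u ≡⟨ coeff≡sumMap (δ (P ⊗' Q)) a u ⟩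
        sumMap (λ s → termCoeff s a u) (map derTerm (P ⊗' Q)) ≡⟨ sumMap-map (λ s → termCoeff s a u) derTerm (P ⊗' Q) ⟩
        sumMap (λ s → termCoeff (derTerm s) a u) (P ⊗' Q) ≡⟨ sumMap-⊗ (λ s → termCoeff (derTerm s) a u) P Q ⟩
        sumMap (λ s → sumMap (λ t → termCoeff (derTerm (mulT n s t)) a u) Q) P
          ≡⟨ sumMap-cong (λ s → trans (sumMap-cong (λ t → derTerm-mulT s t a u) Q) (sumMap-+ _ _ Q)) P ⟩
        sumMap (λ s → sumMap (λ t → termCoeff (mulT n (derTerm s) t) a u) Q +ᶻ sumMap (λ t → termCoeff (mulT n s (derTerm t)) a u) Q) P
          ≡⟨ sumMap-+ _ _ P ⟩
        sumMap (λ s → sumMap (λ t → termCoeff (mulT n (derTerm s) t) a u) Q) P +ᶻ sumMap (λ s → sumMap (λ t → termCoeff (mulT n s (derTerm t)) a u) Q) P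
          ≡⟨ cong₂ _+ᶻ_ (sym (sumMap-map (λ s → sumMap (λ t → termCoeff (mulT n s t) a u) Q) derTerm P))
                        (sumMap-cong (λ s → sym (sumMap-map (λ t → termCoeff (mulT n s t) a u) derTerm Q)) P) ⟩
        sumMap (λ s → sumMap (λ t → termCoeff (mulT n s t) a u) Q) (δ P) +ᶻ sumMap (λ s → sumMap (λ t → termCoeff (mulT n s t) a u) (δ Q)) P
          ≡⟨ cong₂ _+ᶻ_ (sym (trans (coeff≡sumMap (δ P ⊗' Q) a u) (sumMap-⊗ (λ s → termCoeff s a u) (δ P) Q)))
                        (sym (trans (coeff≡sumMap (P ⊗' δ Q) a u) (sumMap-⊗ (λ s → termCoeff s a u) P (δ Q)))) ⟩
        coeff n (δ P ⊗' Q) a u +ᶻ coeff n (P ⊗' δ Q) a u ≡⟨ sym (coeff-++ (δ P ⊗' Q) (P ⊗' δ Q) a u) ⟩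
        coeff n (δ P ⊗' Q ⊕' P ⊗' δ Q) a u ∎
      where open ≡-Reasoning

    δ-constP : ∀ c → δ (constP c) ≋ []
    δ-constP c = mk (λ a u → trans (cong (λ z → termCoeff (z , 0 , 0v n) a u +ᶻ + 0) (trans (cong (_*ᶻ c) w-0) (ℤP.*-zeroˡ c))) (trans (ℤP.+-identityʳ _) (termCoeff-0 0 (0v n) a u)))

  module DerivationPow (W : Weight) where
    open Derivation W
    δ-pow : ∀ P k → δ (pow P k) ⊗' P ≋ constP (+ k) ⊗' pow P k ⊗' δ P
    δ-pow P zero = begin
        δ one ⊗' P ≈⟨ ⊗-congʳ (δ-constP (+ 1)) P ⟩
        [] ⊗' P ≈⟨ ≋-refl ⟩
        [] ≈⟨ ≋-sym (⊗-zeroˡ (one ⊗' δ P)) ⟩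
        [] ⊗' one ⊗' δ P ≈⟨ ⊗-congʳ (⊗-congʳ (≋-sym constP-0) one) (δ P) ⟩
        constP (+ 0) ⊗' one ⊗' δ P ∎
      where open ≋R
    δ-pow P (suc k) = begin
        δ (P ⊗' pow P k) ⊗' P ≈⟨ ⊗-congʳ (δ-⊗ P (pow P k)) P ⟩
        (δ P ⊗' pow P k ⊕' P ⊗' δ (pow P k)) ⊗' P
          ≈⟨ rsolve 4 (λ X Y Z W → (X :* Y :+ Z :* W) :* Z := X :* Y :* Z :+ Z :* (W :* Z)) ≋-refl (δ P) (pow P k) P (δ (pow P k)) ⟩
        δ P ⊗' pow P k ⊗' P ⊕' P ⊗' (δ (pow P k) ⊗' P) ≈⟨ ⊕-cong (≋-sym (⊗-identityˡ (δ P ⊗' pow P k ⊗' P))) (⊗-congˡ P (δ-pow P k)) ⟩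
        one ⊗' (δ P ⊗' pow P k ⊗' P) ⊕' P ⊗' (constP (+ k) ⊗' pow P k ⊗' δ P)
          ≈⟨ rsolve 5 (λ O X Y Z K → O :* (X :* Y :* Z) :+ Z :* (K :* Y :* X) := (O :+ K) :* (Z :* Y) :* X) ≋-refl one (δ P) (pow P k) P (constP (+ k)) ⟩
        (one ⊕' constP (+ k)) ⊗' (P ⊗' pow P k) ⊗' δ P ≈⟨ ⊗-congʳ (⊗-congʳ (≋-sym (constP-+ (+ 1) (+ k))) (P ⊗' pow P k)) (δ P) ⟩
        constP (+ suc k) ⊗' (P ⊗' pow P k) ⊗' δ P ∎
      where open ≋R


module Cancellation (n : ℕ) where
  open Derivations n public

  PositiveTDegree : Term n → Set
  PositiveTDegree s = 1 ℕ.≤ proj₁ (proj₂ s)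


  sumMap-shiftCoeff-vanishes : ∀ (Z : Poly n) a u → (∀ b → b ℕ.< a → ∀ u → coeff n Z b u ≡ + 0) → ∀ R → All PositiveTDegree R →
          sumMap (λ s → shiftCoeff s (coeff n Z) a u) R ≡ + 0
  sumMap-shiftCoeff-vanishes Z a u ih [] [] = refl
  sumMap-shiftCoeff-vanishes Z a u ih ((c' , b , v) ∷ R) (pb ∷ pR) = trans (cong₂ _+ᶻ_ (h (b ℕ.≤? a)) (sumMap-shiftCoeff-vanishes Z a u ih R pR)) refl
    where
    h : (d : Dec (b ℕ.≤ a)) → shiftAt c' b v (coeff n Z) a u d ≡ + 0
    h (yes b≤a) = trans (cong (c' *ᶻ_) (ih (a ∸ b) (ℕP.∸-monoʳ-< {a} {b} {0} pb b≤a) (subᵛ u v))) (ℤP.*-zeroʳ c')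
    h (no _) = refl

  shiftAt-constant : ∀ c F a u (d : Dec (0 ℕ.≤ a)) → shiftAt (+ suc c) 0 (0v n) F a u d ≡ + suc c *ᶻ F a u
  shiftAt-constant c F a u (yes _) = cong (λ z → + suc c *ᶻ F a z) (subᵛ-identityʳ u)
  shiftAt-constant c F a u (no ¬p) = ⊥-elim (¬p ℕ.z≤n)

  -- Strong induction on the t-degree a: the coefficient of t^a in the product is (c+1) times
  -- that of Z plus terms involving only lower t-degrees of Z.
  unitLeading-zeroDivisorFree : ∀ c R → All PositiveTDegree R → ∀ Z → ((+ suc c , 0 , 0v n) ∷ R) ⊗' Z ≋ [] → Z ≋ []
  unitLeading-zeroDivisorFree c R pR Z (mk e) = mk (λ a u → <-rec (λ a → ∀ u → coeff n Z a u ≡ + 0) step a u)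
    where
    step : ∀ a → (∀ {b} → b ℕ.< a → ∀ u → coeff n Z b u ≡ + 0) → ∀ u → coeff n Z a u ≡ + 0
    step a ih u = ℤP.*-cancelˡ-≡ (+ suc c) (coeff n Z a u) (+ 0) (trans eq (sym (ℤP.*-zeroʳ (+ suc c))))
      where
      eq : + suc c *ᶻ coeff n Z a u ≡ + 0
      eq = begin
          + suc c *ᶻ coeff n Z a u ≡⟨ sym (shiftAt-constant c (coeff n Z) a u (0 ℕ.≤? a)) ⟩
          shiftCoeff (+ suc c , 0 , 0v n) (coeff n Z) a u ≡⟨ sym (ℤP.+-identityʳ _) ⟩
          shiftCoeff (+ suc c , 0 , 0v n) (coeff n Z) a u +ᶻ + 0 ≡⟨ cong (shiftCoeff (+ suc c , 0 , 0v n) (coeff n Z) a u +ᶻ_) (sym (sumMap-shiftCoeff-vanishes Z a u (λ b b<a → ih b<a) R pR)) ⟩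
          sumMap (λ s → shiftCoeff s (coeff n Z) a u) ((+ suc c , 0 , 0v n) ∷ R) ≡⟨ sym (coeff-⊗ ((+ suc c , 0 , 0v n) ∷ R) Z a u) ⟩
          coeff n (((+ suc c , 0 , 0v n) ∷ R) ⊗' Z) a u ≡⟨ e a u ⟩
          + 0 ∎
        where open ≡-Reasoning

  unitLeading-cancelʳ : ∀ c R → All PositiveTDegree R → ∀ X Y → X ⊗' ((+ suc c , 0 , 0v n) ∷ R) ≋ Y ⊗' ((+ suc c , 0 , 0v n) ∷ R) → X ≋ Y
  unitLeading-cancelʳ c R pR X Y e = x-y≋0⇒x≋y X Y (unitLeading-zeroDivisorFree c R pR (X ⊕' neg Y) (begin
      G ⊗' (X ⊕' neg Y) ≈⟨ rsolve 3 (λ G X Y → G :* (X :- Y) := X :* G :- Y :* G) ≋-refl G X Y ⟩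
      X ⊗' G ⊕' neg (Y ⊗' G) ≈⟨ x≋y⇒x-y≋0 e ⟩
      [] ∎))
    where
    open ≋R
    G : Poly n
    G = (+ suc c , 0 , 0v n) ∷ R

  positive-mulT : ∀ s t → PositiveTDegree s → PositiveTDegree (mulT n s t)
  positive-mulT (c , b , v) (c' , a' , u') p = ℕP.≤-trans p (ℕP.m≤m+n b a')

  positive-⊗ : ∀ P Q → All PositiveTDegree P → All PositiveTDegree (P ⊗' Q)
  positive-⊗ [] Q [] = []
  positive-⊗ (s ∷ P) Q (p ∷ pP) = AllP.++⁺ (AllP.map⁺ (All.tabulate (λ {t} _ → positive-mulT s t p))) (positive-⊗ P Q pP)

  positive-neg : ∀ P → All PositiveTDegree P → All PositiveTDegree (neg P)
  positive-neg [] [] = []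
  positive-neg (s ∷ P) (p ∷ pP) = p ∷ positive-neg P pP

  positive-mulT-constant : ∀ c t → PositiveTDegree t → PositiveTDegree (mulT n (c , 0 , 0v n) t)
  positive-mulT-constant c (c' , a' , u') p = p

  positive-constP-⊗ : ∀ c Q → All PositiveTDegree Q → All PositiveTDegree (constP c ⊗' Q)
  positive-constP-⊗ c Q pQ = AllP.++⁺ (AllP.map⁺ (All.map (λ {t} p → positive-mulT-constant c t p) pQ)) []

  Fp : Poly n
  Fp = fP n

  sumX : Poly n
  sumX = x0P n ⊕' concatMap (xP n) (allFin n)

  Dp : Poly n
  Dp = DP n

  f-cancelʳ : ∀ X Y → X ⊗' Fp ≋ Y ⊗' Fp → X ≋ Y
  f-cancelʳ X Y e = unitLeading-cancelʳ 0 (neg (tP n ⊗' sumX)) (positive-neg _ (positive-⊗ (tP n) sumX (ℕP.≤-refl ∷ []))) X Y e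

  [n+1]t : Poly n
  [n+1]t = constP (+ suc n) ⊗' tP n

  D-tail : Poly n
  D-tail = map (mulT n (+ suc n , 0 , 0v n)) (neg (pow [n+1]t (suc n))) ++ []

  D≡n+1∷D-tail : Dp ≡ (+ suc n , 0 , 0v n) ∷ D-tail
  D≡n+1∷D-tail = cong₂ (λ c v → (c , 0 , v) ∷ D-tail) (ℤP.*-identityʳ (+ suc n)) 0ᵛ+0ᵛ≡0ᵛ

  D-cancelʳ : ∀ X Y → X ⊗' Dp ≋ Y ⊗' Dp → X ≋ Y
  D-cancelʳ X Y e = unitLeading-cancelʳ n D-tail pR X Y (subst (λ G → X ⊗' G ≋ Y ⊗' G) D≡n+1∷D-tail e)
    where
    pR : All PositiveTDegree D-tail
    pR = AllP.++⁺ (AllP.map⁺ (All.map (λ {t} p → positive-mulT-constant (+ suc n) t p) (positive-neg _ (positive-⊗ [n+1]t _ (positive-constP-⊗ (+ suc n) (tP n) (ℕP.≤-refl ∷ [])))))) []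

  den : ℕ → ℕ → Poly n
  den k m = pow Dp k ⊗' pow Fp m

  den-cancelʳ : ∀ k m X Y → X ⊗' den k m ≋ Y ⊗' den k m → X ≋ Y
  den-cancelʳ zero zero X Y e = begin
      X ≈⟨ ≋-sym (rsolve 1 (λ X → X :* (con (+ 1) :* con (+ 1)) := X) ≋-refl X) ⟩
      X ⊗' den 0 0 ≈⟨ e ⟩
      Y ⊗' den 0 0 ≈⟨ rsolve 1 (λ X → X :* (con (+ 1) :* con (+ 1)) := X) ≋-refl Y ⟩
      Y ∎
    where open ≋R
  den-cancelʳ zero (suc m) X Y e = den-cancelʳ zero m X Y (f-cancelʳ _ _ (begin
      X ⊗' den 0 m ⊗' Fp ≈⟨ rsolve 3 (λ X A F → X :* (con (+ 1) :* A) :* F := X :* (con (+ 1) :* (F :* A))) ≋-refl X (pow Fp m) Fp ⟩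
      X ⊗' den 0 (suc m) ≈⟨ e ⟩
      Y ⊗' den 0 (suc m) ≈⟨ ≋-sym (rsolve 3 (λ X A F → X :* (con (+ 1) :* A) :* F := X :* (con (+ 1) :* (F :* A))) ≋-refl Y (pow Fp m) Fp) ⟩
      Y ⊗' den 0 m ⊗' Fp ∎))
    where open ≋R
  den-cancelʳ (suc k) m X Y e = den-cancelʳ k m X Y (D-cancelʳ _ _ (begin
      X ⊗' den k m ⊗' Dp ≈⟨ rsolve 4 (λ X A B D → X :* (A :* B) :* D := X :* ((D :* A) :* B)) ≋-refl X (pow Dp k) (pow Fp m) Dp ⟩
      X ⊗' den (suc k) m ≈⟨ e ⟩
      Y ⊗' den (suc k) m ≈⟨ ≋-sym (rsolve 4 (λ X A B D → X :* (A :* B) :* D := X :* ((D :* A) :* B)) ≋-refl Y (pow Dp k) (pow Fp m) Dp) ⟩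
      Y ⊗' den k m ⊗' Dp ∎))
    where open ≋R


module Fractions (n : ℕ) where
  open Cancellation n public
  denom : RatFun n → Poly n
  denom r = den (dk r) (fm r)

  infix 4 _≈Q_
  record _≈Q_ (r s : RatFun n) : Set where
    constructor mkQ
    field getQ : num r ⊗' denom s ≋ num s ⊗' denom r
  open _≈Q_ public

  infixl 6 _+Q_ _-Q_
  _+Q_ : RatFun n → RatFun n → RatFun n
  _+Q_ = _+R_ n

  negQ : RatFun n → RatFun n
  negQ = negR n

  _-Q_ : RatFun n → RatFun n → RatFun n
  _-Q_ = _-R_ n

  zeroQ : RatFun n
  zeroQ = zeroR n

  scaleR : AElt n → RatFun n → RatFun n
  scaleR = scale n

  ≈Q-refl : ∀ {r} → r ≈Q r
  ≈Q-refl = mkQ ≋-refl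
  ≈Q-sym : ∀ {r s} → r ≈Q s → s ≈Q r
  ≈Q-sym (mkQ e) = mkQ (≋-sym e)
  ≈Q-trans : ∀ {r s t} → r ≈Q s → s ≈Q t → r ≈Q t
  ≈Q-trans {r} {s} {t} (mkQ e1) (mkQ e2) = mkQ (den-cancelʳ (dk s) (fm s) _ _ (begin
      num r ⊗' denom t ⊗' denom s ≈⟨ rsolve 3 (λ A B C → A :* B :* C := A :* C :* B) ≋-refl (num r) (denom t) (denom s) ⟩
      num r ⊗' denom s ⊗' denom t ≈⟨ ⊗-congʳ e1 (denom t) ⟩
      num s ⊗' denom r ⊗' denom t ≈⟨ rsolve 3 (λ A B C → A :* B :* C := A :* C :* B) ≋-refl (num s) (denom r) (denom t) ⟩
      num s ⊗' denom t ⊗' denom r ≈⟨ ⊗-congʳ e2 (denom r) ⟩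
      num t ⊗' denom s ⊗' denom r ≈⟨ rsolve 3 (λ A B C → A :* B :* C := A :* C :* B) ≋-refl (num t) (denom s) (denom r) ⟩
      num t ⊗' denom r ⊗' denom s ∎))
    where open ≋R

  ≈Q-intro : ∀ r s {N E M E'} → num r ≋ N → denom r ≋ E → num s ≋ M → denom s ≋ E' → N ⊗' E' ≋ M ⊗' E → r ≈Q s
  ≈Q-intro r s hn hd hm he h = mkQ (≋-trans (⊗-cong hn he) (≋-trans h (≋-sym (⊗-cong hm hd))))

  den-+ : ∀ k k' m m' → den (k ℕ.+ k') (m ℕ.+ m') ≋ den k m ⊗' den k' m'
  den-+ k k' m m' = begin
      pow Dp (k ℕ.+ k') ⊗' pow Fp (m ℕ.+ m') ≈⟨ ⊗-cong (pow-+ Dp k k') (pow-+ Fp m m') ⟩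
      pow Dp k ⊗' pow Dp k' ⊗' (pow Fp m ⊗' pow Fp m') ≈⟨ rsolve 4 (λ A B C D → A :* B :* (C :* D) := A :* C :* (B :* D)) ≋-refl (pow Dp k) (pow Dp k') (pow Fp m) (pow Fp m') ⟩
      den k m ⊗' den k' m' ∎
    where open ≋R

  denom-+ : ∀ r s → denom (r +Q s) ≋ denom r ⊗' denom s
  denom-+ r s = den-+ (dk r) (dk s) (fm r) (fm s)

  +Q-cong : ∀ {r r' s s'} → r ≈Q r' → s ≈Q s' → r +Q s ≈Q r' +Q s'
  +Q-cong {r} {r'} {s} {s'} (mkQ e1) (mkQ e2) = ≈Q-intro (r +Q s) (r' +Q s') ≋-refl (denom-+ r s) ≋-refl (denom-+ r' s') (begin
      (num r ⊗' denom s ⊕' num s ⊗' denom r) ⊗' (denom r' ⊗' denom s')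
        ≈⟨ rsolve 6 (λ a b c d e f → (a :* b :+ c :* d) :* (e :* f) := (a :* e) :* (b :* f) :+ (c :* f) :* (d :* e)) ≋-refl (num r) (denom s) (num s) (denom r) (denom r') (denom s') ⟩
      (num r ⊗' denom r') ⊗' (denom s ⊗' denom s') ⊕' (num s ⊗' denom s') ⊗' (denom r ⊗' denom r')
        ≈⟨ ⊕-cong (⊗-congʳ e1 (denom s ⊗' denom s')) (⊗-congʳ e2 (denom r ⊗' denom r')) ⟩
      (num r' ⊗' denom r) ⊗' (denom s ⊗' denom s') ⊕' (num s' ⊗' denom s) ⊗' (denom r ⊗' denom r')
        ≈⟨ rsolve 6 (λ a b c d e f → (a :* e) :* (b :* f) :+ (c :* b) :* (e :* d) := (a :* f :+ c :* d) :* (e :* b)) ≋-refl (num r') (denom s) (num s') (denom r') (denom r) (denom s') ⟩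
      (num r' ⊗' denom s' ⊕' num s' ⊗' denom r') ⊗' (denom r ⊗' denom s) ∎)
    where open ≋R

  +Q-assoc : ∀ r s t → (r +Q s) +Q t ≈Q r +Q (s +Q t)
  +Q-assoc r s t = ≈Q-intro ((r +Q s) +Q t) (r +Q (s +Q t))
       (⊕-congˡ (num (r +Q s) ⊗' denom t) (⊗-congˡ (num t) (denom-+ r s)))
       (≋-trans (denom-+ (r +Q s) t) (⊗-congʳ (denom-+ r s) (denom t)))
       (⊕-congʳ (⊗-congˡ (num r) (denom-+ s t)) (num (s +Q t) ⊗' denom r))
       (≋-trans (denom-+ r (s +Q t)) (⊗-congˡ (denom r) (denom-+ s t)))
       (rsolve 6 (λ a b c d e f →
          ((a :* b :+ c :* d) :* f :+ e :* (d :* b)) :* (d :* (b :* f))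
          := (a :* (b :* f) :+ (c :* f :+ e :* b) :* d) :* ((d :* b) :* f))
          ≋-refl (num r) (denom s) (num s) (denom r) (num t) (denom t))

  +Q-identityˡ : ∀ r → zeroQ +Q r ≈Q r
  +Q-identityˡ r = mkQ (rsolve 2 (λ a b → (a :* (con (+ 1) :* con (+ 1))) :* b := a :* b) ≋-refl (num r) (denom r))

  numA : AElt n → Poly n
  numA α = embedA n (anum α)

  denA : AElt n → Poly n
  denA α = pow Dp (aden α)

  denom-scale : ∀ α r → denom (scaleR α r) ≋ denA α ⊗' denom r
  denom-scale α r = ≋-trans (⊗-congʳ (pow-+ Dp (aden α) (dk r)) (pow Fp (fm r)))
                 (rsolve 3 (λ a b c → a :* b :* c := a :* (b :* c)) ≋-refl (denA α) (pow Dp (dk r)) (pow Fp (fm r)))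

  scale-cong : ∀ α {r s} → r ≈Q s → scaleR α r ≈Q scaleR α s
  scale-cong α {r} {s} (mkQ e) = ≈Q-intro (scaleR α r) (scaleR α s) ≋-refl (denom-scale α r) ≋-refl (denom-scale α s) (begin
      numA α ⊗' num r ⊗' (denA α ⊗' denom s) ≈⟨ rsolve 4 (λ a b c d → a :* b :* (c :* d) := (b :* d) :* (a :* c)) ≋-refl (numA α) (num r) (denA α) (denom s) ⟩
      (num r ⊗' denom s) ⊗' (numA α ⊗' denA α) ≈⟨ ⊗-congʳ e (numA α ⊗' denA α) ⟩
      (num s ⊗' denom r) ⊗' (numA α ⊗' denA α) ≈⟨ rsolve 4 (λ a b c d → (b :* d) :* (a :* c) := a :* b :* (c :* d)) ≋-refl (numA α) (num s) (denA α) (denom r) ⟩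
      numA α ⊗' num s ⊗' (denA α ⊗' denom r) ∎)
    where open ≋R

  scale-distrib-+ : ∀ α r s → scaleR α (r +Q s) ≈Q scaleR α r +Q scaleR α s
  scale-distrib-+ α r s = ≈Q-intro (scaleR α (r +Q s)) (scaleR α r +Q scaleR α s) ≋-refl (≋-trans (denom-scale α (r +Q s)) (⊗-congˡ (denA α) (denom-+ r s)))
      (⊕-cong (⊗-congˡ (numA α ⊗' num r) (denom-scale α s)) (⊗-congˡ (numA α ⊗' num s) (denom-scale α r)))
      (≋-trans (denom-+ (scaleR α r) (scaleR α s)) (⊗-cong (denom-scale α r) (denom-scale α s)))
      (rsolve 6 (λ e p a b c d → e :* (a :* d :+ c :* b) :* ((p :* b) :* (p :* d)) := (e :* a :* (p :* d) :+ e :* c :* (p :* b)) :* (p :* (b :* d)))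
        ≋-refl (numA α) (denA α) (num r) (denom r) (num s) (denom s))

  scale-zero : ∀ α → scaleR α zeroQ ≈Q zeroQ
  scale-zero α = mkQ (⊗-congʳ (⊗-zeroʳ (numA α)) (denom zeroQ))

  mulCoeffs : List (ℤ × ℕ) → List (ℤ × ℕ) → List (ℤ × ℕ)
  mulCoeffs p q = concatMap (λ x → map (λ y → (proj₁ x *ᶻ proj₁ y , proj₂ x ℕ.+ proj₂ y)) q) p

  mulA : AElt n → AElt n → AElt n
  mulA α β = mulCoeffs (anum α) (anum β) /Dᴬ^ (aden α ℕ.+ aden β)

  embed : List (ℤ × ℕ) → Poly n
  embed = embedA n

  embed-++ : ∀ p q → embed (p ++ q) ≡ embed p ++ embed q
  embed-++ p q = ListP.map-++ _ p q

  embed-mulTerm : ∀ c a q → embed (map (λ y → (c *ᶻ proj₁ y , a ℕ.+ proj₂ y)) q) ≡ map (mulT n (c , a , 0v n)) (embed q)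
  embed-mulTerm c a [] = refl
  embed-mulTerm c a ((c' , a') ∷ q) = cong₂ _∷_ (cong (λ v → (c *ᶻ c' , a ℕ.+ a' , v)) (sym 0ᵛ+0ᵛ≡0ᵛ)) (embed-mulTerm c a q)

  embed-mulCoeffs : ∀ p q → embed (mulCoeffs p q) ≡ embed p ⊗' embed q
  embed-mulCoeffs [] q = refl
  embed-mulCoeffs ((c , a) ∷ p) q = trans (embed-++ (map (λ y → (c *ᶻ proj₁ y , a ℕ.+ proj₂ y)) q) (mulCoeffs p q)) (cong₂ _++_ (embed-mulTerm c a q) (embed-mulCoeffs p q))

  scale-scale : ∀ α β r → scaleR α (scaleR β r) ≈Q scaleR (mulA α β) r
  scale-scale α β r = ≈Q-intro (scaleR α (scaleR β r)) (scaleR (mulA α β) r) ≋-refl (≋-trans (denom-scale α (scaleR β r)) (⊗-congˡ (denA α) (denom-scale β r)))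
      (⊗-congʳ (≡⇒≋ (embed-mulCoeffs (anum α) (anum β))) (num r))
      (≋-trans (denom-scale (mulA α β) r) (⊗-congʳ (pow-+ Dp (aden α) (aden β)) (denom r)))
      (rsolve 6 (λ a b c d e f → a :* (b :* c) :* ((d :* e) :* f) := a :* b :* c :* (d :* (e :* f)))
        ≋-refl (numA α) (numA β) (num r) (denA α) (denA β) (denom r))


module Spans (n : ℕ) where
  open Fractions n public

  scalePair : AElt n × RatFun n → RatFun n
  scalePair p = scaleR (proj₁ p) (proj₂ p)

  combination : List (AElt n × RatFun n) → RatFun n
  combination l = sumR n (map scalePair l)

  combination-++ : ∀ l1 l2 → combination (l1 ++ l2) ≈Q combination l1 +Q combination l2
  combination-++ [] l2 = ≈Q-sym (+Q-identityˡ (combination l2))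
  combination-++ (x ∷ l1) l2 = ≈Q-trans (+Q-cong (≈Q-refl {scalePair x}) (combination-++ l1 l2)) (≈Q-sym (+Q-assoc (scalePair x) (combination l1) (combination l2)))

  scaleCoeffs : AElt n → List (AElt n × RatFun n) → List (AElt n × RatFun n)
  scaleCoeffs α = map (λ p → (mulA α (proj₁ p) , proj₂ p))

  scale-combination : ∀ α l → scaleR α (combination l) ≈Q combination (scaleCoeffs α l)
  scale-combination α [] = scale-zero α
  scale-combination α (x ∷ l) = ≈Q-trans (scale-distrib-+ α (scalePair x) (combination l)) (+Q-cong (scale-scale α (proj₁ x) (proj₂ x)) (scale-combination α l))


  mkSpan : ∀ {G r} l → All (λ p → G (proj₂ p)) l → r ≈Q combination l → Span n G r
  mkSpan l al e = l , al , get (getQ e)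

  Span-≈ : ∀ {G r r'} → Span n G r → r ≈Q r' → Span n G r'
  Span-≈ {G} {r} {r'} (l , al , e) e' = mkSpan {G} {r'} l al (≈Q-trans {r'} {r} {combination l} (≈Q-sym e') (mkQ {r} {combination l} (mk e)))

  Span-+ : ∀ {G r s} → Span n G r → Span n G s → Span n G (r +Q s)
  Span-+ {G} {r} {s} (l1 , a1 , e1) (l2 , a2 , e2) = mkSpan {G} {r +Q s} (l1 ++ l2) (AllP.++⁺ a1 a2) (≈Q-trans (+Q-cong {r} {combination l1} {s} {combination l2} (mkQ {r} {combination l1} (mk e1)) (mkQ {s} {combination l2} (mk e2))) (≈Q-sym (combination-++ l1 l2)))

  Span-scale : ∀ {G r} α → Span n G r → Span n G (scaleR α r)
  Span-scale {G} {r} α (l , al , e) = mkSpan {G} {scaleR α r} (scaleCoeffs α l) (AllP.map⁺ (All.map (λ x → x) al)) (≈Q-trans (scale-cong α {r} {combination l} (mkQ {r} {combination l} (mk e))) (scale-combination α l))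

  oneA : AElt n
  oneA = constA n (+ 1)

  Span-gen : ∀ {G : RatFun n → Set} {g} → G g → Span n G g
  Span-gen {G} {g} x = mkSpan ((oneA , g) ∷ []) (x ∷ []) (≈Q-intro g (scaleR oneA g +Q zeroQ) ≋-refl ≋-refl
      (≡⇒≋ (ListP.++-identityʳ (num (scaleR oneA g) ⊗' denom zeroQ))) (≋-trans (denom-+ (scaleR oneA g) zeroQ) (⊗-congʳ (denom-scale oneA g) (denom zeroQ)))
      (rsolve 2 (λ a b → a :* ((con (+ 1) :* b) :* (con (+ 1) :* con (+ 1))) := (con (+ 1) :* a :* (con (+ 1) :* con (+ 1))) :* b) ≋-refl (num g) (denom g)))

  Span-zero : ∀ {G} → Span n G zeroQ
  Span-zero = mkSpan [] [] ≈Q-refl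

  Span-sum-gen : ∀ {G : RatFun n → Set} {X : Set} (g : X → RatFun n) → (∀ i → G (g i)) → ∀ L → Span n G (sumR n (map g L))
  Span-sum-gen g h [] = Span-zero
  Span-sum-gen {G} g h (i ∷ L) = Span-+ {G} {g i} {sumR n (map g L)} (Span-gen {G} (h i)) (Span-sum-gen g h L)

  Span-null : ∀ {G r} → num r ≋ [] → Span n G r
  Span-null {G} {r} e = mkSpan {G} {r} [] [] (mkQ {r} {zeroQ} (≋-trans (⊗-congʳ e (denom zeroQ)) ≋-refl))

  negQ≈scale-1 : ∀ r → negQ r ≈Q scaleR (constA n (- + 1)) r
  negQ≈scale-1 r = mkQ (⊗-congʳ (rsolve 1 (λ a → :- a := con (- + 1) :* a) ≋-refl (num r)) (denom r))

  Span-neg : ∀ {G r} → Span n G r → Span n G (negQ r)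
  Span-neg {G} {r} x = Span-≈ {G} (Span-scale {G} {r} (constA n (- + 1)) x) (≈Q-sym (negQ≈scale-1 r))

  Span-sub : ∀ {G r s} → Span n G r → Span n G s → Span n G (r -Q s)
  Span-sub {G} {r} {s} x y = Span-+ {G} {r} {negQ s} x (Span-neg {G} {s} y)


module Representations (n : ℕ) where
  open Spans n public

  Rep : RatFun n → Poly n → ℕ → ℕ → Set
  Rep r N k m = num r ⊗' den k m ≋ N ⊗' denom r

  Rep-rebase : ∀ x A k m B k' m' → Rep x A k m → A ⊗' den k' m' ≋ B ⊗' den k m → Rep x B k' m'
  Rep-rebase x A k m B k' m' h e = den-cancelʳ k m (num x ⊗' den k' m') (B ⊗' denom x) (begin
      num x ⊗' den k' m' ⊗' den k m ≈⟨ rsolve 3 (λ a b c → a :* b :* c := a :* c :* b) ≋-refl (num x) (den k' m') (den k m) ⟩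
      num x ⊗' den k m ⊗' den k' m' ≈⟨ ⊗-congʳ h (den k' m') ⟩
      A ⊗' denom x ⊗' den k' m' ≈⟨ rsolve 3 (λ a b c → a :* b :* c := a :* c :* b) ≋-refl A (denom x) (den k' m') ⟩
      A ⊗' den k' m' ⊗' denom x ≈⟨ ⊗-congʳ e (denom x) ⟩
      B ⊗' den k m ⊗' denom x ≈⟨ rsolve 3 (λ a b c → a :* b :* c := a :* c :* b) ≋-refl B (den k m) (denom x) ⟩
      B ⊗' denom x ⊗' den k m ∎)
    where open ≋R

  Rep-unique : ∀ x y A k m → Rep x A k m → Rep y A k m → x ≈Q y
  Rep-unique x y A k m hx hy = mkQ (den-cancelʳ k m (num x ⊗' denom y) (num y ⊗' denom x) (begin
      num x ⊗' denom y ⊗' den k m ≈⟨ rsolve 3 (λ a b c → a :* b :* c := a :* c :* b) ≋-refl (num x) (denom y) (den k m) ⟩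
      num x ⊗' den k m ⊗' denom y ≈⟨ ⊗-congʳ hx (denom y) ⟩
      A ⊗' denom x ⊗' denom y ≈⟨ rsolve 3 (λ a b c → a :* b :* c := a :* c :* b) ≋-refl A (denom x) (denom y) ⟩
      A ⊗' denom y ⊗' denom x ≈⟨ ⊗-congʳ (≋-sym hy) (denom x) ⟩
      num y ⊗' den k m ⊗' denom x ≈⟨ rsolve 3 (λ a b c → a :* b :* c := a :* c :* b) ≋-refl (num y) (den k m) (denom x) ⟩
      num y ⊗' denom x ⊗' den k m ∎))
    where open ≋R

  Rep-≈ : ∀ x y A B k m k' m' → Rep x A k m → Rep y B k' m' → A ⊗' den k' m' ≋ B ⊗' den k m → x ≈Q y
  Rep-≈ x y A B k m k' m' hx hy e = Rep-unique x y B k' m' (Rep-rebase x A k m B k' m' hx e) hy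

  Rep-+ : ∀ r s A k m B k' m' → Rep r A k m → Rep s B k' m' → Rep (r +Q s) (A ⊗' den k' m' ⊕' B ⊗' den k m) (k ℕ.+ k') (m ℕ.+ m')
  Rep-+ r s A k m B k' m' hr hs = begin
      (num r ⊗' denom s ⊕' num s ⊗' denom r) ⊗' den (k ℕ.+ k') (m ℕ.+ m') ≈⟨ ⊗-congˡ (num r ⊗' denom s ⊕' num s ⊗' denom r) (den-+ k k' m m') ⟩
      (num r ⊗' denom s ⊕' num s ⊗' denom r) ⊗' (den k m ⊗' den k' m')
        ≈⟨ rsolve 6 (λ a b c d e f → (a :* b :+ c :* d) :* (e :* f) := (a :* e) :* (b :* f) :+ (c :* f) :* (d :* e)) ≋-refl (num r) (denom s) (num s) (denom r) (den k m) (den k' m') ⟩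
      (num r ⊗' den k m) ⊗' (denom s ⊗' den k' m') ⊕' (num s ⊗' den k' m') ⊗' (denom r ⊗' den k m)
        ≈⟨ ⊕-cong (⊗-congʳ hr (denom s ⊗' den k' m')) (⊗-congʳ hs (denom r ⊗' den k m)) ⟩
      (A ⊗' denom r) ⊗' (denom s ⊗' den k' m') ⊕' (B ⊗' denom s) ⊗' (denom r ⊗' den k m)
        ≈⟨ rsolve 6 (λ a b c d e f → (a :* d) :* (b :* f) :+ (c :* b) :* (d :* e) := (a :* f :+ c :* e) :* (d :* b)) ≋-refl A (denom s) B (denom r) (den k m) (den k' m') ⟩
      (A ⊗' den k' m' ⊕' B ⊗' den k m) ⊗' (denom r ⊗' denom s) ≈⟨ ⊗-congˡ (A ⊗' den k' m' ⊕' B ⊗' den k m) (≋-sym (denom-+ r s)) ⟩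
      (A ⊗' den k' m' ⊕' B ⊗' den k m) ⊗' denom (r +Q s) ∎
    where open ≋R

  Rep-scale : ∀ α r A k m → Rep r A k m → Rep (scaleR α r) (numA α ⊗' A) (aden α ℕ.+ k) m
  Rep-scale α r A k m h = begin
      numA α ⊗' num r ⊗' den (aden α ℕ.+ k) m ≈⟨ ⊗-congˡ (numA α ⊗' num r) (≋-trans (⊗-congʳ (pow-+ Dp (aden α) k) (pow Fp m)) (rsolve 3 (λ a b c → a :* b :* c := a :* (b :* c)) ≋-refl (denA α) (pow Dp k) (pow Fp m))) ⟩
      numA α ⊗' num r ⊗' (denA α ⊗' den k m) ≈⟨ rsolve 4 (λ a b c d → a :* b :* (c :* d) := a :* c :* (b :* d)) ≋-refl (numA α) (num r) (denA α) (den k m) ⟩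
      numA α ⊗' denA α ⊗' (num r ⊗' den k m) ≈⟨ ⊗-congˡ (numA α ⊗' denA α) h ⟩
      numA α ⊗' denA α ⊗' (A ⊗' denom r) ≈⟨ rsolve 4 (λ a b c d → a :* c :* (b :* d) := a :* b :* (c :* d)) ≋-refl (numA α) A (denA α) (denom r) ⟩
      numA α ⊗' A ⊗' (denA α ⊗' denom r) ≈⟨ ⊗-congˡ (numA α ⊗' A) (≋-sym (denom-scale α r)) ⟩
      numA α ⊗' A ⊗' denom (scaleR α r) ∎
    where open ≋R

  Rep-≋ : ∀ x A k m B → Rep x A k m → A ≋ B → Rep x B k m
  Rep-≋ x A k m B h e = ≋-trans h (⊗-congʳ e (denom x))

  Rep-neg : ∀ x A k m → Rep x A k m → Rep (negQ x) (neg A) k m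
  Rep-neg x A k m h = begin
      neg (num x) ⊗' den k m ≈⟨ rsolve 2 (λ a b → (:- a) :* b := :- (a :* b)) ≋-refl (num x) (den k m) ⟩
      neg (num x ⊗' den k m) ≈⟨ neg-cong h ⟩
      neg (A ⊗' denom x) ≈⟨ rsolve 2 (λ a b → :- (a :* b) := (:- a) :* b) ≋-refl A (denom x) ⟩
      neg A ⊗' denom x ∎
    where open ≋R

  Rep-+same : ∀ r s A B k m → Rep r A k m → Rep s B k m → Rep (r +Q s) (A ⊕' B) k m
  Rep-+same r s A B k m hr hs = Rep-rebase (r +Q s) (A ⊗' den k m ⊕' B ⊗' den k m) (k ℕ.+ k) (m ℕ.+ m) (A ⊕' B) k m
      (Rep-+ r s A k m B k m hr hs)
      (≋-trans (rsolve 3 (λ a b e → (a :* e :+ b :* e) :* e := (a :+ b) :* (e :* e)) ≋-refl A B (den k m)) (⊗-congˡ (A ⊕' B) (≋-sym (den-+ k k m m))))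

  Rep-zero : ∀ k m → Rep zeroQ [] k m
  Rep-zero k m = ≋-refl

  Rep-sum : ∀ {X : Set} (f : X → RatFun n) (g : X → Poly n) k m → (∀ x → Rep (f x) (g x) k m) → ∀ L →
            Rep (sumR n (map f L)) (foldr _⊕'_ [] (map g L)) k m
  Rep-sum f g k m h [] = Rep-zero k m
  Rep-sum f g k m h (x ∷ L) = Rep-+same (f x) (sumR n (map f L)) (g x) (foldr _⊕'_ [] (map g L)) k m (h x) (Rep-sum f g k m h L)

  module FractionDerivation (W : Weight) where
    open Derivation W public
    open DerivationPow W public

    derQ : RatFun n → RatFun n
    derQ = derR n (Weight.w W)

    dFD : Poly n
    dFD = Dp ⊗' Fp

    δ-den : ∀ k m → δ (den k m) ⊗' dFD ≋ constP (+ k) ⊗' den k m ⊗' δ Dp ⊗' Fp ⊕' constP (+ m) ⊗' den k m ⊗' δ Fp ⊗' Dp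
    δ-den k m = begin
        δ (pow Dp k ⊗' pow Fp m) ⊗' dFD ≈⟨ ⊗-congʳ (δ-⊗ (pow Dp k) (pow Fp m)) dFD ⟩
        (δ (pow Dp k) ⊗' pow Fp m ⊕' pow Dp k ⊗' δ (pow Fp m)) ⊗' (Dp ⊗' Fp)
          ≈⟨ rsolve 6 (λ a b c d e f → (a :* b :+ c :* d) :* (e :* f) := (a :* e) :* b :* f :+ c :* e :* (d :* f)) ≋-refl (δ (pow Dp k)) (pow Fp m) (pow Dp k) (δ (pow Fp m)) Dp Fp ⟩
        (δ (pow Dp k) ⊗' Dp) ⊗' pow Fp m ⊗' Fp ⊕' pow Dp k ⊗' Dp ⊗' (δ (pow Fp m) ⊗' Fp)
          ≈⟨ ⊕-cong (⊗-congʳ (⊗-congʳ (δ-pow Dp k) (pow Fp m)) Fp) (⊗-congˡ (pow Dp k ⊗' Dp) (δ-pow Fp m)) ⟩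
        constP (+ k) ⊗' pow Dp k ⊗' δ Dp ⊗' pow Fp m ⊗' Fp ⊕' pow Dp k ⊗' Dp ⊗' (constP (+ m) ⊗' pow Fp m ⊗' δ Fp)
          ≈⟨ rsolve 8 (λ K a dD b F M D dF → K :* a :* dD :* b :* F :+ a :* D :* (M :* b :* dF) := K :* (a :* b) :* dD :* F :+ M :* (a :* b) :* dF :* D)
               ≋-refl (constP (+ k)) (pow Dp k) (δ Dp) (pow Fp m) Fp (constP (+ m)) Dp (δ Fp) ⟩
        constP (+ k) ⊗' den k m ⊗' δ Dp ⊗' Fp ⊕' constP (+ m) ⊗' den k m ⊗' δ Fp ⊗' Dp ∎
      where open ≋R

    quotientRuleNum : Poly n → Poly n → Poly n
    quotientRuleNum N E = δ N ⊗' E ⊕' neg (N ⊗' δ E)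

    derQ-num : ∀ r → num (derQ r) ⊗' denom r ≋ quotientRuleNum (num r) (denom r) ⊗' dFD
    derQ-num r = begin
        (δ (num r) ⊗' (Dp ⊗' Fp) ⊕' (neg (constP (+ k) ⊗' (num r ⊗' (δ Dp ⊗' Fp))) ⊕' neg (constP (+ m) ⊗' (num r ⊗' (δ Fp ⊗' Dp))))) ⊗' denom r
          ≈⟨ rsolve 9 (λ dn D F K nr dD M dF d → (dn :* (D :* F) :+ (:- (K :* (nr :* (dD :* F))) :+ :- (M :* (nr :* (dF :* D))))) :* d
                 := dn :* d :* (D :* F) :+ :- (nr :* (K :* d :* dD :* F :+ M :* d :* dF :* D)))
               ≋-refl (δ (num r)) Dp Fp (constP (+ k)) (num r) (δ Dp) (constP (+ m)) (δ Fp) (denom r) ⟩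
        δ (num r) ⊗' denom r ⊗' dFD ⊕' neg (num r ⊗' (constP (+ k) ⊗' den k m ⊗' δ Dp ⊗' Fp ⊕' constP (+ m) ⊗' den k m ⊗' δ Fp ⊗' Dp))
          ≈⟨ ⊕-congˡ (δ (num r) ⊗' denom r ⊗' dFD) (neg-cong (⊗-congˡ (num r) (≋-sym (δ-den k m)))) ⟩
        δ (num r) ⊗' denom r ⊗' dFD ⊕' neg (num r ⊗' (δ (denom r) ⊗' dFD))
          ≈⟨ rsolve 5 (λ a b c e x → a :* b :* c :+ :- (e :* (x :* c)) := (a :* b :+ :- (e :* x)) :* c) ≋-refl (δ (num r)) (denom r) dFD (num r) DD ⟩
        quotientRuleNum (num r) (denom r) ⊗' dFD ∎
      where
      open ≋R
      k m : ℕ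
      DD : Poly n
      k = dk r
      m = fm r
      DD = δ (denom r)

    Rep-derQ : ∀ r → Rep (derQ r) (quotientRuleNum (num r) (denom r)) (dk r ℕ.+ dk r) (fm r ℕ.+ fm r)
    Rep-derQ r = begin
        num (derQ r) ⊗' den (k ℕ.+ k) (m ℕ.+ m) ≈⟨ ⊗-congˡ (num (derQ r)) (den-+ k k m m) ⟩
        num (derQ r) ⊗' (denom r ⊗' denom r) ≈⟨ rsolve 2 (λ a b → a :* (b :* b) := a :* b :* b) ≋-refl (num (derQ r)) (denom r) ⟩
        num (derQ r) ⊗' denom r ⊗' denom r ≈⟨ ⊗-congʳ (derQ-num r) (denom r) ⟩
        quotientRuleNum (num r) (denom r) ⊗' dFD ⊗' denom r
          ≈⟨ rsolve 5 (λ q D F a b → q :* (D :* F) :* (a :* b) := q :* ((D :* a) :* (F :* b))) ≋-refl (quotientRuleNum (num r) (denom r)) Dp Fp (pow Dp k) (pow Fp m) ⟩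
        quotientRuleNum (num r) (denom r) ⊗' denom (derQ r) ∎
      where
      open ≋R
      k m : ℕ
      k = dk r
      m = fm r

    Rep-derQ-of : ∀ r N k' m' → Rep r N k' m' → Rep (derQ r) (quotientRuleNum N (den k' m')) (k' ℕ.+ k') (m' ℕ.+ m')
    Rep-derQ-of r N k' m' H = Rep-rebase (derQ r) (quotientRuleNum (num r) (denom r)) (k ℕ.+ k) (m ℕ.+ m) (quotientRuleNum N E) (k' ℕ.+ k') (m' ℕ.+ m') (Rep-derQ r) (begin
        quotientRuleNum (num r) (denom r) ⊗' den (k' ℕ.+ k') (m' ℕ.+ m') ≈⟨ ⊗-congˡ (quotientRuleNum (num r) (denom r)) (den-+ k' k' m' m') ⟩
        quotientRuleNum (num r) (denom r) ⊗' (E ⊗' E)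
          ≈⟨ rsolve 8 (λ dn nr d dd dN N e de →
               (dn :* d :+ :- (nr :* dd)) :* (e :* e)
               := (dN :* e :+ :- (N :* de)) :* (d :* d) :+ (((dn :* e :+ nr :* de) :+ :- (dN :* d :+ N :* dd)) :* (d :* e) :+ :- ((nr :* e :+ :- (N :* d)) :* (dd :* e :+ de :* d))))
               ≋-refl (δ (num r)) (num r) (denom r) (δ (denom r)) (δ N) N E (δ E) ⟩
        quotientRuleNum N E ⊗' (denom r ⊗' denom r) ⊕' ((A' ⊕' neg B') ⊗' (denom r ⊗' E) ⊕' neg ((A ⊕' neg B) ⊗' (δ (denom r) ⊗' E ⊕' δ E ⊗' denom r)))
          ≈⟨ ⊕-congˡ (quotientRuleNum N E ⊗' (denom r ⊗' denom r)) (⊕-cong (⊗-congʳ (x≋y⇒x-y≋0 {A'} {B'} dH) (denom r ⊗' E)) (neg-cong (⊗-congʳ (x≋y⇒x-y≋0 {A} {B} H) (δ (denom r) ⊗' E ⊕' δ E ⊗' denom r)))) ⟩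
        quotientRuleNum N E ⊗' (denom r ⊗' denom r) ⊕' [] ≈⟨ ≡⇒≋ (ListP.++-identityʳ _) ⟩
        quotientRuleNum N E ⊗' (denom r ⊗' denom r) ≈⟨ ⊗-congˡ (quotientRuleNum N E) (≋-sym (den-+ k k m m)) ⟩
        quotientRuleNum N E ⊗' den (k ℕ.+ k) (m ℕ.+ m) ∎)
      where
      open ≋R
      k m : ℕ
      E A B A' B' : Poly n
      k = dk r
      m = fm r
      E = den k' m'
      A = num r ⊗' E
      B = N ⊗' denom r
      A' = δ (num r) ⊗' E ⊕' num r ⊗' δ E
      B' = δ N ⊗' denom r ⊕' N ⊗' δ (denom r)
      dH : A' ≋ B'
      dH = ≋-trans (≋-sym (δ-⊗ (num r) E)) (≋-trans (δ-cong H) (δ-⊗ N (denom r)))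

    derQ-cong : ∀ {r s} → r ≈Q s → derQ r ≈Q derQ s
    derQ-cong {r} {s} (mkQ e) = Rep-unique (derQ r) (derQ s) (quotientRuleNum (num r) (denom r)) (dk r ℕ.+ dk r) (fm r ℕ.+ fm r)
       (Rep-derQ r) (Rep-derQ-of s (num r) (dk r) (fm r) (≋-sym e))

    derQ-+ : ∀ r s → derQ (r +Q s) ≈Q derQ r +Q derQ s
    derQ-+ r s = Rep-≈ (derQ (r +Q s)) (derQ r +Q derQ s) (quotientRuleNum N E) B (K ℕ.+ K) (M ℕ.+ M) (kr ℕ.+ kr ℕ.+ (ks ℕ.+ ks)) (mr ℕ.+ mr ℕ.+ (ms ℕ.+ ms))
        (Rep-derQ-of (r +Q s) N K M (Rep-+ r s (num r) kr mr (num s) ks ms ≋-refl ≋-refl))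
        (Rep-+ (derQ r) (derQ s) Qr (kr ℕ.+ kr) (mr ℕ.+ mr) Qs (ks ℕ.+ ks) (ms ℕ.+ ms) (Rep-derQ r) (Rep-derQ s))
        (begin
          quotientRuleNum N E ⊗' den (kr ℕ.+ kr ℕ.+ (ks ℕ.+ ks)) (mr ℕ.+ mr ℕ.+ (ms ℕ.+ ms))
            ≈⟨ ⊗-cong (⊕-cong (⊗-cong (≋-trans (δ-⊕ (num r ⊗' denom s) (num s ⊗' denom r)) (⊕-cong (δ-⊗ (num r) (denom s)) (δ-⊗ (num s) (denom r)))) hE)
                            (neg-cong (⊗-congˡ N (≋-trans (δ-cong hE) (δ-⊗ (denom r) (denom s))))))
                   (≋-trans (den-+ (kr ℕ.+ kr) (ks ℕ.+ ks) (mr ℕ.+ mr) (ms ℕ.+ ms)) (⊗-cong (den-+ kr kr mr mr) (den-+ ks ks ms ms))) ⟩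
          ((δ (num r) ⊗' denom s ⊕' num r ⊗' δ (denom s) ⊕' (δ (num s) ⊗' denom r ⊕' num s ⊗' δ (denom r))) ⊗' (denom r ⊗' denom s) ⊕' neg (N ⊗' (δ (denom r) ⊗' denom s ⊕' denom r ⊗' δ (denom s))))
             ⊗' ((denom r ⊗' denom r) ⊗' (denom s ⊗' denom s))
            ≈⟨ rsolve 8 (λ dnr ds nr dds dns dr ns ddr →
                 ((dnr :* ds :+ nr :* dds :+ (dns :* dr :+ ns :* ddr)) :* (dr :* ds) :+ :- ((nr :* ds :+ ns :* dr) :* (ddr :* ds :+ dr :* dds))) :* ((dr :* dr) :* (ds :* ds))
                 := ((dnr :* dr :+ :- (nr :* ddr)) :* (ds :* ds) :+ (dns :* ds :+ :- (ns :* dds)) :* (dr :* dr)) :* ((dr :* ds) :* (dr :* ds)))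
                 ≋-refl (δ (num r)) (denom s) (num r) (δ (denom s)) (δ (num s)) (denom r) (num s) (δ (denom r)) ⟩
          (Qr ⊗' (denom s ⊗' denom s) ⊕' Qs ⊗' (denom r ⊗' denom r)) ⊗' ((denom r ⊗' denom s) ⊗' (denom r ⊗' denom s))
            ≈⟨ ⊗-cong (⊕-cong (⊗-congˡ Qr (≋-sym (den-+ ks ks ms ms))) (⊗-congˡ Qs (≋-sym (den-+ kr kr mr mr)))) (≋-sym (≋-trans (den-+ K K M M) (⊗-cong hE hE))) ⟩
          B ⊗' den (K ℕ.+ K) (M ℕ.+ M) ∎)
      where
      open ≋R
      kr ks mr ms K M : ℕ
      N E Qr Qs B : Poly n
      kr = dk r
      ks = dk s
      mr = fm r
      ms = fm s
      K = kr ℕ.+ ks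
      M = mr ℕ.+ ms
      N = num r ⊗' denom s ⊕' num s ⊗' denom r
      E = den K M
      hE : E ≋ denom r ⊗' denom s
      hE = den-+ kr ks mr ms
      Qr = quotientRuleNum (num r) (denom r)
      Qs = quotientRuleNum (num s) (denom s)
      B = Qr ⊗' den (ks ℕ.+ ks) (ms ℕ.+ ms) ⊕' Qs ⊗' den (kr ℕ.+ kr) (mr ℕ.+ mr)

    derQ-zero : derQ zeroQ ≈Q zeroQ
    derQ-zero = mkQ (≋-trans (⊗-congʳ {num (derQ zeroQ)} {[]} num0 (denom zeroQ)) ≋-refl)
      where
      num0 : num (derQ zeroQ) ≋ []
      num0 = ⊕-cong {[]} {[]} (≋-refl {[]}) (⊕-cong (neg-cong (⊗-zeroʳ (constP (+ 0)))) (neg-cong (⊗-zeroʳ (constP (+ 0)))))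


x*[y*z]≡y*[x*z] : ∀ x y c → x *ᶻ (y *ᶻ c) ≡ y *ᶻ (x *ᶻ c)
x*[y*z]≡y*[x*z] = solve-∀

module FractionSubtraction (n : ℕ) where
  open Representations n public

  Rep-sub : ∀ r s → Rep (r -Q s) (num r ⊗' denom s ⊕' neg (num s ⊗' denom r)) (dk r ℕ.+ dk s) (fm r ℕ.+ fm s)
  Rep-sub r s = Rep-≋ (r -Q s) (num r ⊗' denom s ⊕' neg (num s) ⊗' denom r) (dk r ℕ.+ dk s) (fm r ℕ.+ fm s) (num r ⊗' denom s ⊕' neg (num s ⊗' denom r))
     (Rep-+ r (negQ s) (num r) (dk r) (fm r) (neg (num s)) (dk s) (fm s) ≋-refl (Rep-neg s (num s) (dk s) (fm s) ≋-refl))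
     (⊕-congˡ (num r ⊗' denom s) (rsolve 2 (λ a b → (:- a) :* b := :- (a :* b)) ≋-refl (num s) (denom r)))

  -Q-interchange : ∀ a b a' b' → (a -Q b) -Q (a' -Q b') ≈Q (a -Q a') -Q (b -Q b')
  -Q-interchange a b a' b' = Rep-≈ X Y (Sab ⊗' den (ka' ℕ.+ kb') (ma' ℕ.+ mb') ⊕' neg Sa'b' ⊗' den (ka ℕ.+ kb) (ma ℕ.+ mb))
                          (Saa' ⊗' den (kb ℕ.+ kb') (mb ℕ.+ mb') ⊕' neg Sbb' ⊗' den (ka ℕ.+ ka') (ma ℕ.+ ma'))
                          (ka ℕ.+ kb ℕ.+ (ka' ℕ.+ kb')) (ma ℕ.+ mb ℕ.+ (ma' ℕ.+ mb')) (ka ℕ.+ ka' ℕ.+ (kb ℕ.+ kb')) (ma ℕ.+ ma' ℕ.+ (mb ℕ.+ mb'))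
      (Rep-+ (a -Q b) (negQ (a' -Q b')) Sab (ka ℕ.+ kb) (ma ℕ.+ mb) (neg Sa'b') (ka' ℕ.+ kb') (ma' ℕ.+ mb') (Rep-sub a b) (Rep-neg (a' -Q b') Sa'b' (ka' ℕ.+ kb') (ma' ℕ.+ mb') (Rep-sub a' b')))
      (Rep-+ (a -Q a') (negQ (b -Q b')) Saa' (ka ℕ.+ ka') (ma ℕ.+ ma') (neg Sbb') (kb ℕ.+ kb') (mb ℕ.+ mb') (Rep-sub a a') (Rep-neg (b -Q b') Sbb' (kb ℕ.+ kb') (mb ℕ.+ mb') (Rep-sub b b')))
      (begin
        ((num a ⊗' denom b ⊕' neg (num b ⊗' denom a)) ⊗' den (ka' ℕ.+ kb') (ma' ℕ.+ mb') ⊕' neg (num a' ⊗' denom b' ⊕' neg (num b' ⊗' denom a')) ⊗' den (ka ℕ.+ kb) (ma ℕ.+ mb))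
          ⊗' den (ka ℕ.+ ka' ℕ.+ (kb ℕ.+ kb')) (ma ℕ.+ ma' ℕ.+ (mb ℕ.+ mb'))
          ≈⟨ ⊗-cong (⊕-cong (⊗-congˡ Sab (den-+ ka' kb' ma' mb')) (⊗-congˡ (neg Sa'b') (den-+ ka kb ma mb))) (≋-trans (den-+ (ka ℕ.+ ka') (kb ℕ.+ kb') (ma ℕ.+ ma') (mb ℕ.+ mb')) (⊗-cong (den-+ ka ka' ma ma') (den-+ kb kb' mb mb'))) ⟩
        ((num a ⊗' denom b ⊕' neg (num b ⊗' denom a)) ⊗' (denom a' ⊗' denom b') ⊕' neg (num a' ⊗' denom b' ⊕' neg (num b' ⊗' denom a')) ⊗' (denom a ⊗' denom b))
          ⊗' ((denom a ⊗' denom a') ⊗' (denom b ⊗' denom b'))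
          ≈⟨ rsolve 8 (λ na da nb db na' da' nb' db' →
               ((na :* db :+ :- (nb :* da)) :* (da' :* db') :+ :- (na' :* db' :+ :- (nb' :* da')) :* (da :* db)) :* ((da :* da') :* (db :* db'))
               := ((na :* da' :+ :- (na' :* da)) :* (db :* db') :+ :- (nb :* db' :+ :- (nb' :* db)) :* (da :* da')) :* ((da :* db) :* (da' :* db')))
               ≋-refl (num a) (denom a) (num b) (denom b) (num a') (denom a') (num b') (denom b') ⟩
        ((num a ⊗' denom a' ⊕' neg (num a' ⊗' denom a)) ⊗' (denom b ⊗' denom b') ⊕' neg (num b ⊗' denom b' ⊕' neg (num b' ⊗' denom b)) ⊗' (denom a ⊗' denom a'))
          ⊗' ((denom a ⊗' denom b) ⊗' (denom a' ⊗' denom b'))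
          ≈⟨ ≋-sym (⊗-cong (⊕-cong (⊗-congˡ Saa' (den-+ kb kb' mb mb')) (⊗-congˡ (neg Sbb') (den-+ ka ka' ma ma'))) (≋-trans (den-+ (ka ℕ.+ kb) (ka' ℕ.+ kb') (ma ℕ.+ mb) (ma' ℕ.+ mb')) (⊗-cong (den-+ ka kb ma mb) (den-+ ka' kb' ma' mb')))) ⟩
        ((num a ⊗' denom a' ⊕' neg (num a' ⊗' denom a)) ⊗' den (kb ℕ.+ kb') (mb ℕ.+ mb') ⊕' neg (num b ⊗' denom b' ⊕' neg (num b' ⊗' denom b)) ⊗' den (ka ℕ.+ ka') (ma ℕ.+ ma'))
          ⊗' den (ka ℕ.+ kb ℕ.+ (ka' ℕ.+ kb')) (ma ℕ.+ mb ℕ.+ (ma' ℕ.+ mb')) ∎)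
    where
    open ≋R
    X Y : RatFun n
    ka kb ka' kb' ma mb ma' mb' : ℕ
    Sab Sa'b' Saa' Sbb' : Poly n
    X = (a -Q b) -Q (a' -Q b')
    Y = (a -Q a') -Q (b -Q b')
    ka = dk a
    kb = dk b
    ka' = dk a'
    kb' = dk b'
    ma = fm a
    mb = fm b
    ma' = fm a'
    mb' = fm b'
    Sab = num a ⊗' denom b ⊕' neg (num b ⊗' denom a)
    Sa'b' = num a' ⊗' denom b' ⊕' neg (num b' ⊗' denom a')
    Saa' = num a ⊗' denom a' ⊕' neg (num a' ⊗' denom a)
    Sbb' = num b ⊗' denom b' ⊕' neg (num b' ⊗' denom b)

  negQ-cong : ∀ {r s} → r ≈Q s → negQ r ≈Q negQ s
  negQ-cong {r} {s} (mkQ e) = mkQ (begin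
      neg (num r) ⊗' denom s ≈⟨ rsolve 2 (λ a b → (:- a) :* b := :- (a :* b)) ≋-refl (num r) (denom s) ⟩
      neg (num r ⊗' denom s) ≈⟨ neg-cong e ⟩
      neg (num s ⊗' denom r) ≈⟨ rsolve 2 (λ a b → :- (a :* b) := (:- a) :* b) ≋-refl (num s) (denom r) ⟩
      neg (num s) ⊗' denom r ∎)
    where open ≋R

  -Q-cong : ∀ {r r' s s'} → r ≈Q r' → s ≈Q s' → r -Q s ≈Q r' -Q s'
  -Q-cong {r} {r'} {s} {s'} e f = +Q-cong {r} {r'} {negQ s} {negQ s'} e (negQ-cong f)

  negQ-sub : ∀ r s → negQ (r -Q s) ≈Q s -Q r
  negQ-sub r s = Rep-≈ (negQ (r -Q s)) (s -Q r) (neg Srs) Ssr (kr ℕ.+ ks) (mr ℕ.+ ms) (ks ℕ.+ kr) (ms ℕ.+ mr)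
      (Rep-neg (r -Q s) Srs (kr ℕ.+ ks) (mr ℕ.+ ms) (Rep-sub r s)) (Rep-sub s r)
      (begin
        neg Srs ⊗' den (ks ℕ.+ kr) (ms ℕ.+ mr) ≈⟨ ⊗-congˡ (neg Srs) (den-+ ks kr ms mr) ⟩
        neg Srs ⊗' (denom s ⊗' denom r) ≈⟨ rsolve 4 (λ nr dr ns ds → :- (nr :* ds :+ :- (ns :* dr)) :* (ds :* dr) := (ns :* dr :+ :- (nr :* ds)) :* (dr :* ds)) ≋-refl (num r) (denom r) (num s) (denom s) ⟩
        Ssr ⊗' (denom r ⊗' denom s) ≈⟨ ⊗-congˡ Ssr (≋-sym (den-+ kr ks mr ms)) ⟩
        Ssr ⊗' den (kr ℕ.+ ks) (mr ℕ.+ ms) ∎)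
    where
    open ≋R
    kr ks mr ms : ℕ
    Srs Ssr : Poly n
    kr = dk r
    ks = dk s
    mr = fm r
    ms = fm s
    Srs = num r ⊗' denom s ⊕' neg (num s ⊗' denom r)
    Ssr = num s ⊗' denom r ⊕' neg (num r ⊗' denom s)

  sub-trans : ∀ r s t → (r -Q s) +Q (s -Q t) ≈Q r -Q t
  sub-trans r s t = Rep-≈ ((r -Q s) +Q (s -Q t)) (r -Q t) (Srs ⊗' den (ks ℕ.+ kt) (ms ℕ.+ mt) ⊕' Sst ⊗' den (kr ℕ.+ ks) (mr ℕ.+ ms)) Srt
        (kr ℕ.+ ks ℕ.+ (ks ℕ.+ kt)) (mr ℕ.+ ms ℕ.+ (ms ℕ.+ mt)) (kr ℕ.+ kt) (mr ℕ.+ mt)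
      (Rep-+ (r -Q s) (s -Q t) Srs (kr ℕ.+ ks) (mr ℕ.+ ms) Sst (ks ℕ.+ kt) (ms ℕ.+ mt) (Rep-sub r s) (Rep-sub s t)) (Rep-sub r t)
      (begin
        (Srs ⊗' den (ks ℕ.+ kt) (ms ℕ.+ mt) ⊕' Sst ⊗' den (kr ℕ.+ ks) (mr ℕ.+ ms)) ⊗' den (kr ℕ.+ kt) (mr ℕ.+ mt)
          ≈⟨ ⊗-cong (⊕-cong (⊗-congˡ Srs (den-+ ks kt ms mt)) (⊗-congˡ Sst (den-+ kr ks mr ms))) (den-+ kr kt mr mt) ⟩
        (Srs ⊗' (denom s ⊗' denom t) ⊕' Sst ⊗' (denom r ⊗' denom s)) ⊗' (denom r ⊗' denom t)
          ≈⟨ rsolve 6 (λ nr dr ns ds nt dt → ((nr :* ds :+ :- (ns :* dr)) :* (ds :* dt) :+ (ns :* dt :+ :- (nt :* ds)) :* (dr :* ds)) :* (dr :* dt)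
                 := (nr :* dt :+ :- (nt :* dr)) :* ((dr :* ds) :* (ds :* dt))) ≋-refl (num r) (denom r) (num s) (denom s) (num t) (denom t) ⟩
        Srt ⊗' ((denom r ⊗' denom s) ⊗' (denom s ⊗' denom t)) ≈⟨ ⊗-congˡ Srt (≋-sym (≋-trans (den-+ (kr ℕ.+ ks) (ks ℕ.+ kt) (mr ℕ.+ ms) (ms ℕ.+ mt)) (⊗-cong (den-+ kr ks mr ms) (den-+ ks kt ms mt)))) ⟩
        Srt ⊗' den (kr ℕ.+ ks ℕ.+ (ks ℕ.+ kt)) (mr ℕ.+ ms ℕ.+ (ms ℕ.+ mt)) ∎)
    where
    open ≋R
    kr ks kt mr ms mt : ℕ
    Srs Sst Srt : Poly n
    kr = dk r
    ks = dk s
    kt = dk t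
    mr = fm r
    ms = fm s
    mt = fm t
    Srs = num r ⊗' denom s ⊕' neg (num s ⊗' denom r)
    Sst = num s ⊗' denom t ⊕' neg (num t ⊗' denom s)
    Srt = num r ⊗' denom t ⊕' neg (num t ⊗' denom r)

  scale-neg : ∀ α r → scaleR α (negQ r) ≈Q negQ (scaleR α r)
  scale-neg α r = mkQ (⊗-congʳ (rsolve 2 (λ a b → a :* (:- b) := :- (a :* b)) ≋-refl (numA α) (num r)) (denom (scaleR α r)))

  scale-sub : ∀ α r s → scaleR α r -Q scaleR α s ≈Q scaleR α (r -Q s)
  scale-sub α r s = ≈Q-sym (≈Q-trans (scale-distrib-+ α r (negQ s)) (+Q-cong (≈Q-refl {scaleR α r}) (scale-neg α s)))


module Theta (n : ℕ) where
  open FractionSubtraction n public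

  module CommutingDerivations (W1 W2 : Weight) where
    module D1 = FractionDerivation W1
    module D2 = FractionDerivation W2
    w1 w2 : ℕ → Vec ℤ n → ℤ
    w1 = Weight.w W1
    w2 = Weight.w W2

    δ-comm : ∀ P → D1.δ (D2.δ P) ≡ D2.δ (D1.δ P)
    δ-comm [] = refl
    δ-comm ((c , a , u) ∷ P) = cong₂ _∷_ (cong (λ z → (z , a , u)) (x*[y*z]≡y*[x*z] (w1 a u) (w2 a u) c)) (δ-comm P)

    derQ-comm : ∀ r → D1.derQ (D2.derQ r) ≈Q D2.derQ (D1.derQ r)
    derQ-comm r = Rep-unique (D1.derQ (D2.derQ r)) (D2.derQ (D1.derQ r)) (D1.quotientRuleNum Q2 E) (k2 ℕ.+ k2) (m2 ℕ.+ m2)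
        (D1.Rep-derQ-of (D2.derQ r) Q2 k2 m2 (D2.Rep-derQ r))
        (Rep-rebase (D2.derQ (D1.derQ r)) (D2.quotientRuleNum Q1 E) (k2 ℕ.+ k2) (m2 ℕ.+ m2) (D1.quotientRuleNum Q2 E) (k2 ℕ.+ k2) (m2 ℕ.+ m2) (D2.Rep-derQ-of (D1.derQ r) Q1 k2 m2 (D1.Rep-derQ r))
          (⊗-congʳ (≋-sym mixed-quotientRuleNum) (den (k2 ℕ.+ k2) (m2 ℕ.+ m2))))
      where
      open ≋R
      k m k2 m2 : ℕ
      d nr E Q1 Q2 : Poly n
      k = dk r
      m = fm r
      k2 = k ℕ.+ k
      m2 = m ℕ.+ m
      d = denom r
      nr = num r
      E = den k2 m2
      Q1 = D1.quotientRuleNum nr d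
      Q2 = D2.quotientRuleNum nr d
      hE : E ≋ d ⊗' d
      hE = den-+ k k m m
      expand-quotientRuleNum : ∀ (δa δb : Poly n → Poly n) → (∀ {X Y} → X ≋ Y → δa X ≋ δa Y) → (∀ X Y → δa (X ⊕' Y) ≋ δa X ⊕' δa Y) → (∀ X → δa (neg X) ≋ neg (δa X)) → (∀ X Y → δa (X ⊗' Y) ≋ δa X ⊗' Y ⊕' X ⊗' δa Y) →
           δa (δb nr ⊗' d ⊕' neg (nr ⊗' δb d)) ⊗' E ⊕' neg ((δb nr ⊗' d ⊕' neg (nr ⊗' δb d)) ⊗' δa E)
           ≋ (δa (δb nr) ⊗' d ⊕' δb nr ⊗' δa d ⊕' neg (δa nr ⊗' δb d ⊕' nr ⊗' δa (δb d))) ⊗' (d ⊗' d) ⊕' neg ((δb nr ⊗' d ⊕' neg (nr ⊗' δb d)) ⊗' (δa d ⊗' d ⊕' d ⊗' δa d))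
      expand-quotientRuleNum δa δb cg dp dn dm = ⊕-cong (⊗-cong (≋-trans (dp _ _) (⊕-cong (dm _ _) (≋-trans (dn _) (neg-cong (dm _ _))))) hE) (neg-cong (⊗-congˡ (δb nr ⊗' d ⊕' neg (nr ⊗' δb d)) (≋-trans (cg hE) (dm d d))))
      mixed-quotientRuleNum : D1.quotientRuleNum Q2 E ≋ D2.quotientRuleNum Q1 E
      mixed-quotientRuleNum = begin
          D1.quotientRuleNum Q2 E ≈⟨ expand-quotientRuleNum D1.δ D2.δ D1.δ-cong D1.δ-⊕ D1.δ-neg D1.δ-⊗ ⟩
          (D1.δ (D2.δ nr) ⊗' d ⊕' D2.δ nr ⊗' D1.δ d ⊕' neg (D1.δ nr ⊗' D2.δ d ⊕' nr ⊗' D1.δ (D2.δ d))) ⊗' (d ⊗' d) ⊕' neg ((D2.δ nr ⊗' d ⊕' neg (nr ⊗' D2.δ d)) ⊗' (D1.δ d ⊗' d ⊕' d ⊗' D1.δ d))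
            ≈⟨ rsolve 8 (λ x12 dd y2 y1 z1 nn z2 x12d →
                (x12 :* dd :+ y2 :* z1 :+ :- (y1 :* z2 :+ nn :* x12d)) :* (dd :* dd) :+ :- ((y2 :* dd :+ :- (nn :* z2)) :* (z1 :* dd :+ dd :* z1))
                := (x12 :* dd :+ y1 :* z2 :+ :- (y2 :* z1 :+ nn :* x12d)) :* (dd :* dd) :+ :- ((y1 :* dd :+ :- (nn :* z1)) :* (z2 :* dd :+ dd :* z2)))
                ≋-refl (D1.δ (D2.δ nr)) d (D2.δ nr) (D1.δ nr) (D1.δ d) nr (D2.δ d) (D1.δ (D2.δ d)) ⟩
          (D1.δ (D2.δ nr) ⊗' d ⊕' D1.δ nr ⊗' D2.δ d ⊕' neg (D2.δ nr ⊗' D1.δ d ⊕' nr ⊗' D1.δ (D2.δ d))) ⊗' (d ⊗' d) ⊕' neg ((D1.δ nr ⊗' d ⊕' neg (nr ⊗' D1.δ d)) ⊗' (D2.δ d ⊗' d ⊕' d ⊗' D2.δ d))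
            ≈⟨ ⊕-congʳ (⊗-congʳ (⊕-cong (⊕-congʳ (⊗-congʳ (≡⇒≋ (δ-comm nr)) d) (D1.δ nr ⊗' D2.δ d)) (neg-cong (⊕-congˡ (D2.δ nr ⊗' D1.δ d) (⊗-congˡ nr (≡⇒≋ (δ-comm d)))))) (d ⊗' d)) (neg ((D1.δ nr ⊗' d ⊕' neg (nr ⊗' D1.δ d)) ⊗' (D2.δ d ⊗' d ⊕' d ⊗' D2.δ d))) ⟩
          (D2.δ (D1.δ nr) ⊗' d ⊕' D1.δ nr ⊗' D2.δ d ⊕' neg (D2.δ nr ⊗' D1.δ d ⊕' nr ⊗' D2.δ (D1.δ d))) ⊗' (d ⊗' d) ⊕' neg ((D1.δ nr ⊗' d ⊕' neg (nr ⊗' D1.δ d)) ⊗' (D2.δ d ⊗' d ⊕' d ⊗' D2.δ d))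
            ≈⟨ ≋-sym (expand-quotientRuleNum D2.δ D1.δ D2.δ-cong D2.δ-⊕ D2.δ-neg D2.δ-⊗) ⟩
          D2.quotientRuleNum Q1 E ∎

  θ-weight : Weight
  θ-weight = record { w = λ a u → + a ; w-homo = λ a u a' u' → refl ; w-0 = refl }

  x∂-weight : Fin n → Weight
  x∂-weight i = record { w = λ a u → lookup u i ; w-homo = λ a u a' u' → VecP.lookup-zipWith _+ᶻ_ i u u' ; w-0 = VecP.lookup-replicate i (+ 0) }

  module Dθ = FractionDerivation θ-weight
  module Dx (i : Fin n) = FractionDerivation (x∂-weight i)

  den-shift : ∀ a k m → den (a ℕ.+ k) m ≋ pow Dp a ⊗' den k m
  den-shift a k m = ≋-trans (⊗-congʳ (pow-+ Dp a k) (pow Fp m)) (rsolve 3 (λ x y z → x :* y :* z := x :* (y :* z)) ≋-refl (pow Dp a) (pow Dp k) (pow Fp m))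

  [1+n] : ℤ
  [1+n] = + suc n

  [n+1]t≡ : [n+1]t ≡ ([1+n] , 1 , 0v n) ∷ []
  [n+1]t≡ = cong₂ (λ c v → (c , 1 , v) ∷ []) (ℤP.*-identityʳ [1+n]) 0ᵛ+0ᵛ≡0ᵛ

  pow-[n+1]t : ∀ j → pow [n+1]t j ≋ (+ (suc n ℕ.^ j) , j , 0v n) ∷ []
  pow-[n+1]t zero = ≋-refl
  pow-[n+1]t (suc j) = ≋-trans (⊗-cong (≡⇒≋ [n+1]t≡) (pow-[n+1]t j)) (≡⇒≋ (cong₂ (λ c v → (c , suc j , v) ∷ []) (sym (ℤP.pos-* (suc n) (suc n ℕ.^ j))) 0ᵛ+0ᵛ≡0ᵛ))

  inv[n+1] : AElt n
  inv[n+1] = inv-n+1 n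

  invNum : Poly n
  invNum = numA inv[n+1]

  D≋[n+1]*invNum : Dp ≋ constP [1+n] ⊗' invNum
  D≋[n+1]*invNum = ⊗-congˡ (constP [1+n]) (⊕-congˡ one (neg-cong (pow-[n+1]t (suc n))))

  θCoeffs : List (ℤ × ℕ) → List (ℤ × ℕ)
  θCoeffs = map (λ x → (+ proj₂ x *ᶻ proj₁ x , proj₂ x))

  negCoeffs : List (ℤ × ℕ) → List (ℤ × ℕ)
  negCoeffs = map (λ x → (- proj₁ x , proj₂ x))

  embed-θCoeffs : ∀ p → embed (θCoeffs p) ≡ Dθ.δ (embed p)
  embed-θCoeffs [] = refl
  embed-θCoeffs (x ∷ p) = cong (_ ∷_) (embed-θCoeffs p)

  embed-negCoeffs : ∀ p → embed (negCoeffs p) ≡ neg (embed p)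
  embed-negCoeffs [] = refl
  embed-negCoeffs (x ∷ p) = cong (_ ∷_) (embed-negCoeffs p)

  D-coeffs : List (ℤ × ℕ)
  D-coeffs = mulCoeffs (([1+n] , 0) ∷ []) (anum inv[n+1])

  embed-D-coeffs : embed D-coeffs ≋ Dp
  embed-D-coeffs = ≋-trans (≡⇒≋ (embed-mulCoeffs (([1+n] , 0) ∷ []) (anum inv[n+1]))) (≋-sym D≋[n+1]*invNum)

  θA : AElt n → AElt n
  θA α = (mulCoeffs (θCoeffs (anum α)) D-coeffs ++ negCoeffs (mulCoeffs ((+ aden α , 0) ∷ []) (mulCoeffs (anum α) (θCoeffs D-coeffs)))) /Dᴬ^ suc (aden α)

  numA-θA : ∀ α → numA (θA α) ≋ Dθ.δ (numA α) ⊗' Dp ⊕' neg (constP (+ aden α) ⊗' (numA α ⊗' Dθ.δ Dp))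
  numA-θA α = begin
      embed (mulCoeffs (θCoeffs p) D-coeffs ++ negCoeffs (mulCoeffs ((+ k , 0) ∷ []) (mulCoeffs p (θCoeffs D-coeffs))))
        ≈⟨ ≡⇒≋ (embed-++ (mulCoeffs (θCoeffs p) D-coeffs) _) ⟩
      embed (mulCoeffs (θCoeffs p) D-coeffs) ⊕' embed (negCoeffs (mulCoeffs ((+ k , 0) ∷ []) (mulCoeffs p (θCoeffs D-coeffs))))
        ≈⟨ ⊕-cong (≡⇒≋ (trans (embed-mulCoeffs (θCoeffs p) D-coeffs) (cong (_⊗' embed D-coeffs) (embed-θCoeffs p))))
               (≡⇒≋ (trans (embed-negCoeffs _) (cong neg (trans (embed-mulCoeffs ((+ k , 0) ∷ []) (mulCoeffs p (θCoeffs D-coeffs))) (cong (constP (+ k) ⊗'_) (trans (embed-mulCoeffs p (θCoeffs D-coeffs)) (cong (embed p ⊗'_) (embed-θCoeffs D-coeffs)))))))) ⟩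
      Dθ.δ (embed p) ⊗' embed D-coeffs ⊕' neg (constP (+ k) ⊗' (embed p ⊗' Dθ.δ (embed D-coeffs)))
        ≈⟨ ⊕-cong (⊗-congˡ (Dθ.δ (embed p)) embed-D-coeffs) (neg-cong (⊗-congˡ (constP (+ k)) (⊗-congˡ (embed p) (Dθ.δ-cong embed-D-coeffs)))) ⟩
      Dθ.δ (embed p) ⊗' Dp ⊕' neg (constP (+ k) ⊗' (embed p ⊗' Dθ.δ Dp)) ∎
    where
    open ≋R
    p : List (ℤ × ℕ)
    k : ℕ
    p = anum α
    k = aden α

  open Dθ public using () renaming (derQ to dθ; δ to δθ; quotientRuleNum to Qθ)

  θ-scale-numerators : ∀ a p N E K → δθ p ⊗' Dp ≋ K ⊗' p ⊗' δθ Dp →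
      ((δθ a ⊗' N ⊕' a ⊗' δθ N) ⊗' (p ⊗' E) ⊕' neg ((a ⊗' N) ⊗' (δθ p ⊗' E ⊕' p ⊗' δθ E))) ⊗' ((Dp ⊗' (p ⊗' E)) ⊗' (p ⊗' (E ⊗' E)))
      ≋ (((δθ a ⊗' Dp ⊕' neg (K ⊗' (a ⊗' δθ Dp))) ⊗' N) ⊗' (p ⊗' (E ⊗' E)) ⊕' (a ⊗' (δθ N ⊗' E ⊕' neg (N ⊗' δθ E))) ⊗' (Dp ⊗' (p ⊗' E))) ⊗' ((p ⊗' E) ⊗' (p ⊗' E))
  θ-scale-numerators a p N E K hp = begin
      ((δθ a ⊗' N ⊕' a ⊗' δθ N) ⊗' (p ⊗' E) ⊕' neg ((a ⊗' N) ⊗' (δθ p ⊗' E ⊕' p ⊗' δθ E))) ⊗' ((Dp ⊗' (p ⊗' E)) ⊗' (p ⊗' (E ⊗' E)))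
        ≈⟨ rsolve 9 (λ da x a dx p d dp dd D →
             ((da :* x :+ a :* dx) :* (p :* d) :+ :- ((a :* x) :* (dp :* d :+ p :* dd))) :* ((D :* (p :* d)) :* (p :* (d :* d)))
             := ((da :* x :+ a :* dx) :* (p :* d) :+ :- ((a :* x) :* (p :* dd))) :* ((D :* (p :* d)) :* (p :* (d :* d))) :+ :- ((a :* x :* d :* (p :* d) :* (p :* (d :* d))) :* (dp :* D)))
             ≋-refl (δθ a) N a (δθ N) p E (δθ p) (δθ E) Dp ⟩
      T ⊕' neg (R ⊗' (δθ p ⊗' Dp))
        ≈⟨ ⊕-congˡ T (neg-cong (⊗-congˡ R hp)) ⟩
      T ⊕' neg (R ⊗' (K ⊗' p ⊗' δθ Dp))
        ≈⟨ rsolve 10 (λ da x a dx p d dd D K dD →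
             ((da :* x :+ a :* dx) :* (p :* d) :+ :- ((a :* x) :* (p :* dd))) :* ((D :* (p :* d)) :* (p :* (d :* d))) :+ :- ((a :* x :* d :* (p :* d) :* (p :* (d :* d))) :* (K :* p :* dD))
             := (((da :* D :+ :- (K :* (a :* dD))) :* x) :* (p :* (d :* d)) :+ (a :* (dx :* d :+ :- (x :* dd))) :* (D :* (p :* d))) :* ((p :* d) :* (p :* d)))
             ≋-refl (δθ a) N a (δθ N) p E (δθ E) Dp K (δθ Dp) ⟩
      (((δθ a ⊗' Dp ⊕' neg (K ⊗' (a ⊗' δθ Dp))) ⊗' N) ⊗' (p ⊗' (E ⊗' E)) ⊕' (a ⊗' (δθ N ⊗' E ⊕' neg (N ⊗' δθ E))) ⊗' (Dp ⊗' (p ⊗' E))) ⊗' ((p ⊗' E) ⊗' (p ⊗' E)) ∎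
    where
    open ≋R
    T R : Poly n
    T = ((δθ a ⊗' N ⊕' a ⊗' δθ N) ⊗' (p ⊗' E) ⊕' neg ((a ⊗' N) ⊗' (p ⊗' δθ E))) ⊗' ((Dp ⊗' (p ⊗' E)) ⊗' (p ⊗' (E ⊗' E)))
    R = a ⊗' N ⊗' E ⊗' (p ⊗' E) ⊗' (p ⊗' (E ⊗' E))

  θ-scale : ∀ α r → dθ (scaleR α r) ≈Q scaleR (θA α) r +Q scaleR α (dθ r)
  θ-scale α r = Rep-≈ (dθ (scaleR α r)) (scaleR (θA α) r +Q scaleR α (dθ r)) (Qθ (a ⊗' nr) E) B (K ℕ.+ K) (mr ℕ.+ mr)
        (suc ka ℕ.+ kr ℕ.+ (ka ℕ.+ (kr ℕ.+ kr))) (mr ℕ.+ (mr ℕ.+ mr))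
        (Dθ.Rep-derQ-of (scaleR α r) (a ⊗' nr) K mr (Rep-scale α r nr kr mr ≋-refl))
        (Rep-+ (scaleR (θA α) r) (scaleR α (dθ r)) (numA (θA α) ⊗' nr) (suc ka ℕ.+ kr) mr (a ⊗' Qr) (ka ℕ.+ (kr ℕ.+ kr)) (mr ℕ.+ mr)
           (Rep-scale (θA α) r nr kr mr ≋-refl) (Rep-scale α (dθ r) Qr (kr ℕ.+ kr) (mr ℕ.+ mr) (Dθ.Rep-derQ r)))
        (begin
          Qθ (a ⊗' nr) E ⊗' den (suc ka ℕ.+ kr ℕ.+ (ka ℕ.+ (kr ℕ.+ kr))) (mr ℕ.+ (mr ℕ.+ mr))
            ≈⟨ ⊗-cong (⊕-cong (⊗-cong (Dθ.δ-⊗ a nr) hE) (neg-cong (⊗-congˡ (a ⊗' nr) (≋-trans (Dθ.δ-cong hE) (Dθ.δ-⊗ p d)))))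
                   (≋-trans (den-+ (suc ka ℕ.+ kr) (ka ℕ.+ (kr ℕ.+ kr)) mr (mr ℕ.+ mr))
                      (⊗-cong (≋-trans (den-shift (suc ka) kr mr) (rsolve 3 (λ x y z → x :* y :* z := x :* (y :* z)) ≋-refl Dp p d))
                           (≋-trans (den-shift ka (kr ℕ.+ kr) (mr ℕ.+ mr)) (⊗-congˡ p (den-+ kr kr mr mr))))) ⟩
          ((δθ a ⊗' nr ⊕' a ⊗' δθ nr) ⊗' (p ⊗' d) ⊕' neg ((a ⊗' nr) ⊗' (δθ p ⊗' d ⊕' p ⊗' δθ d))) ⊗' ((Dp ⊗' (p ⊗' d)) ⊗' (p ⊗' (d ⊗' d)))
            ≈⟨ θ-scale-numerators a p nr d (constP (+ ka)) (Dθ.δ-pow Dp ka) ⟩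
          (((δθ a ⊗' Dp ⊕' neg (constP (+ ka) ⊗' (a ⊗' δθ Dp))) ⊗' nr) ⊗' (p ⊗' (d ⊗' d)) ⊕' (a ⊗' Qr) ⊗' (Dp ⊗' (p ⊗' d))) ⊗' ((p ⊗' d) ⊗' (p ⊗' d))
            ≈⟨ ≋-sym (⊗-cong (⊕-cong (⊗-cong (⊗-congʳ (numA-θA α) nr) (≋-trans (den-shift ka (kr ℕ.+ kr) (mr ℕ.+ mr)) (⊗-congˡ p (den-+ kr kr mr mr))))
                                 (⊗-congˡ (a ⊗' Qr) (≋-trans (den-shift (suc ka) kr mr) (rsolve 3 (λ x y z → x :* y :* z := x :* (y :* z)) ≋-refl Dp p d))))
                          (≋-trans (den-+ K K mr mr) (⊗-cong hE hE))) ⟩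
          B ⊗' den (K ℕ.+ K) (mr ℕ.+ mr) ∎)
    where
    open ≋R
    ka kr mr K : ℕ
    ka = aden α
    kr = dk r
    mr = fm r
    K = ka ℕ.+ kr
    a p nr d E Qr B : Poly n
    a = numA α
    p = denA α
    nr = num r
    d = denom r
    E = den K mr
    Qr = Qθ nr d
    B = numA (θA α) ⊗' nr ⊗' den (ka ℕ.+ (kr ℕ.+ kr)) (mr ℕ.+ mr) ⊕' a ⊗' Qr ⊗' den (suc ka ℕ.+ kr) mr
    hE : E ≋ p ⊗' d
    hE = den-shift ka kr mr

  θ-neg : ∀ r → dθ (negQ r) ≈Q negQ (dθ r)
  θ-neg r = Rep-unique (dθ (negQ r)) (negQ (dθ r)) (neg (Qθ (num r) (denom r))) (dk r ℕ.+ dk r) (fm r ℕ.+ fm r)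
      (Rep-≋ (dθ (negQ r)) (Qθ (neg (num r)) (denom r)) (dk r ℕ.+ dk r) (fm r ℕ.+ fm r) (neg (Qθ (num r) (denom r)))
         (Dθ.Rep-derQ-of (negQ r) (neg (num r)) (dk r) (fm r) (Rep-neg r (num r) (dk r) (fm r) ≋-refl))
         (≋-trans (⊕-congʳ (⊗-congʳ (Dθ.δ-neg (num r)) (denom r)) (neg (neg (num r) ⊗' δθ (denom r))))
           (rsolve 4 (λ dn d n dd → (:- dn) :* d :+ :- ((:- n) :* dd) := :- (dn :* d :+ :- (n :* dd))) ≋-refl (δθ (num r)) (denom r) (num r) (δθ (denom r)))))
      (Rep-neg (dθ r) (Qθ (num r) (denom r)) (dk r ℕ.+ dk r) (fm r ℕ.+ fm r) (Dθ.Rep-derQ r))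

  θ-sub : ∀ r s → dθ r -Q dθ s ≈Q dθ (r -Q s)
  θ-sub r s = ≈Q-sym (≈Q-trans (Dθ.derQ-+ r (negQ s)) (+Q-cong (≈Q-refl {dθ r}) (θ-neg s)))


module ThetaSpan (n : ℕ) where
  open Theta n public

  Span-θ-combination : ∀ {G H : RatFun n → Set} → (∀ g → G g → Span n H (dθ g)) → (∀ g → G g → H g) → ∀ l → All (λ p → G (proj₂ p)) l → Span n H (dθ (combination l))
  Span-θ-combination {G} {H} hd hg [] [] = Span-≈ {H} (Span-zero {H}) (≈Q-sym Dθ.derQ-zero)
  Span-θ-combination {G} {H} hd hg ((α , g) ∷ l) (x ∷ al) =
    Span-≈ {H} (Span-+ {H} {scaleR (θA α) g +Q scaleR α (dθ g)} {dθ (combination l)} (Span-+ {H} {scaleR (θA α) g} {scaleR α (dθ g)} (Span-scale {H} {g} (θA α) (Span-gen {H} (hg g x))) (Span-scale {H} {dθ g} α (hd g x))) (Span-θ-combination hd hg l al))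
      (≈Q-sym (≈Q-trans (Dθ.derQ-+ (scaleR α g) (combination l)) (+Q-cong (θ-scale α g) (≈Q-refl {dθ (combination l)}))))

  Span-θ : ∀ {G H : RatFun n → Set} → (∀ g → G g → Span n H (dθ g)) → (∀ g → G g → H g) → ∀ r → Span n G r → Span n H (dθ r)
  Span-θ {G} {H} hd hg r (l , al , e) = Span-≈ {H} (Span-θ-combination hd hg l al) (≈Q-sym (Dθ.derQ-cong {r} {combination l} (mkQ (mk e))))

  module ThetaClosure (θ-generator : ∀ g → OfGen n g → Span n (OfGen n) (dθ g)) where
    Of-θ : ∀ η → Of n η → Of n (dθ η)
    Of-θ = Span-θ θ-generator (λ g x → x)

    dOfGen-θ : ∀ g → dOfGen n g → Span n (dOfGen n) (dθ g)
    dOfGen-θ g (i , η , oη , refl) = Span-≈ {dOfGen n} (Span-gen {dOfGen n} (i , dθ η , Of-θ η oη , refl)) (≈Q-sym (CommutingDerivations.derQ-comm θ-weight (x∂-weight i) η))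

    dOf-θ : ∀ r → dOf n r → dOf n (dθ r)
    dOf-θ = Span-θ dOfGen-θ (λ g x → x)


module ThetaGenerator (n : ℕ) where
  open ThetaSpan n public

  zeroCoeffs≋[] : ∀ L → All (λ s → proj₁ s ≡ + 0) L → L ≋ []
  zeroCoeffs≋[] L al = mk (λ a u → go L al a u)
    where
    go : ∀ L → All (λ s → proj₁ s ≡ + 0) L → ∀ a u → coeff n L a u ≡ + 0
    go [] [] a u = refl
    go ((c , a' , u') ∷ L) (refl ∷ al) a u = trans (cong₂ _+ᶻ_ (termCoeff-0 a' u' a u) (go L al a u)) refl

  sumX-tDegree0 : All (λ s → proj₁ (proj₂ s) ≡ 0) sumX
  sumX-tDegree0 = AllP.++⁺ (refl ∷ []) (go (allFin n))
    where
    go : ∀ (L : List (Fin n)) → All (λ s → proj₁ (proj₂ s) ≡ 0) (concatMap (xP n) L)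
    go [] = []
    go (i ∷ L) = refl ∷ go L

  θ-sumX : δθ sumX ≋ []
  θ-sumX = zeroCoeffs≋[] (δθ sumX) (AllP.map⁺ (All.map (λ { {c , a , u} refl → ℤP.*-zeroˡ c }) sumX-tDegree0))

  θ-f : δθ Fp ≋ neg (tP n ⊗' sumX)
  θ-f = begin
      δθ (one ⊕' neg (tP n ⊗' sumX)) ≈⟨ Dθ.δ-⊕ one (neg (tP n ⊗' sumX)) ⟩
      δθ one ⊕' δθ (neg (tP n ⊗' sumX)) ≈⟨ ⊕-cong (Dθ.δ-constP (+ 1)) (≋-trans (Dθ.δ-neg (tP n ⊗' sumX)) (neg-cong (Dθ.δ-⊗ (tP n) sumX))) ⟩
      [] ⊕' neg (δθ (tP n) ⊗' sumX ⊕' tP n ⊗' δθ sumX) ≈⟨ neg-cong (⊕-congˡ (tP n ⊗' sumX) (≋-trans (⊗-congˡ (tP n) θ-sumX) (⊗-zeroʳ (tP n)))) ⟩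
      neg (tP n ⊗' sumX ⊕' []) ≈⟨ neg-cong (≡⇒≋ (ListP.++-identityʳ _)) ⟩
      neg (tP n ⊗' sumX) ∎
    where open ≋R

  -- −k θ(D_f)/D_f, the contribution of θ acting on D_f^{−k}
  θD-coeff : ℕ → AElt n
  θD-coeff k = negCoeffs (mulCoeffs ((+ k , 0) ∷ []) (θCoeffs D-coeffs)) /Dᴬ^ 1

  numA-θD-coeff : ∀ k → numA (θD-coeff k) ≋ neg (constP (+ k) ⊗' δθ Dp)
  numA-θD-coeff k = ≋-trans (≡⇒≋ (trans (embed-negCoeffs _) (cong neg (trans (embed-mulCoeffs ((+ k , 0) ∷ []) (θCoeffs D-coeffs)) (cong (constP (+ k) ⊗'_) (embed-θCoeffs D-coeffs))))))
                 (neg-cong (⊗-congˡ (constP (+ k)) (Dθ.δ-cong embed-D-coeffs)))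

  constP-factorial : ∀ m → constP (+ (suc m !)) ≋ constP (+ suc m) ⊗' constP (+ (m !))
  constP-factorial m = ≋-trans (≡⇒≋ (cong constP (ℤP.pos-* (suc m) (m !)))) (constP-* (+ suc m) (+ (m !)))

  timesTX : Poly n → Poly n
  timesTX P = P ⊗' (tP n ⊗' sumX)

  θ-generator-numerators : ∀ c P E K M → δθ E ⊗' (Dp ⊗' Fp) ≋ K ⊗' E ⊗' δθ Dp ⊗' Fp ⊕' M ⊗' E ⊗' δθ Fp ⊗' Dp →
      (c ⊗' δθ P ⊗' E ⊕' neg ((c ⊗' P) ⊗' δθ E)) ⊗' (E ⊗' ((Dp ⊗' E) ⊗' (E ⊗' Fp)))
      ≋ (c ⊗' δθ P ⊗' ((Dp ⊗' E) ⊗' (E ⊗' Fp)) ⊕' ((neg (K ⊗' δθ Dp) ⊗' (c ⊗' P)) ⊗' (E ⊗' Fp) ⊕' ((M ⊗' c) ⊗' (P ⊗' neg (δθ Fp))) ⊗' (Dp ⊗' E)) ⊗' E) ⊗' (E ⊗' E)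
  θ-generator-numerators c P E K M hE = begin
      (c ⊗' δθ P ⊗' E ⊕' neg ((c ⊗' P) ⊗' δθ E)) ⊗' (E ⊗' ((Dp ⊗' E) ⊗' (E ⊗' Fp)))
        ≈⟨ rsolve 7 (λ c dP e P de D F →
             (c :* dP :* e :+ :- ((c :* P) :* de)) :* (e :* ((D :* e) :* (e :* F)))
             := (c :* dP :* e) :* (e :* ((D :* e) :* (e :* F))) :+ :- ((c :* P :* e :* (e :* e)) :* (de :* (D :* F))))
             ≋-refl c (δθ P) E P (δθ E) Dp Fp ⟩
      (c ⊗' δθ P ⊗' E) ⊗' (E ⊗' ((Dp ⊗' E) ⊗' (E ⊗' Fp))) ⊕' neg ((c ⊗' P ⊗' E ⊗' (E ⊗' E)) ⊗' (δθ E ⊗' (Dp ⊗' Fp)))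
        ≈⟨ ⊕-congˡ ((c ⊗' δθ P ⊗' E) ⊗' (E ⊗' ((Dp ⊗' E) ⊗' (E ⊗' Fp)))) (neg-cong (⊗-congˡ (c ⊗' P ⊗' E ⊗' (E ⊗' E)) hE)) ⟩
      (c ⊗' δθ P ⊗' E) ⊗' (E ⊗' ((Dp ⊗' E) ⊗' (E ⊗' Fp))) ⊕' neg ((c ⊗' P ⊗' E ⊗' (E ⊗' E)) ⊗' (K ⊗' E ⊗' δθ Dp ⊗' Fp ⊕' M ⊗' E ⊗' δθ Fp ⊗' Dp))
        ≈⟨ rsolve 10 (λ c dP e P D F K dD M dF →
             (c :* dP :* e) :* (e :* ((D :* e) :* (e :* F))) :+ :- ((c :* P :* e :* (e :* e)) :* (K :* e :* dD :* F :+ M :* e :* dF :* D))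
             := (c :* dP :* ((D :* e) :* (e :* F)) :+ ((:- (K :* dD) :* (c :* P)) :* (e :* F) :+ ((M :* c) :* (P :* (:- dF))) :* (D :* e)) :* e) :* (e :* e))
             ≋-refl c (δθ P) E P Dp Fp K (δθ Dp) M (δθ Fp) ⟩
      (c ⊗' δθ P ⊗' ((Dp ⊗' E) ⊗' (E ⊗' Fp)) ⊕' ((neg (K ⊗' δθ Dp) ⊗' (c ⊗' P)) ⊗' (E ⊗' Fp) ⊕' ((M ⊗' c) ⊗' (P ⊗' neg (δθ Fp))) ⊗' (Dp ⊗' E)) ⊗' E) ⊗' (E ⊗' E) ∎
    where open ≋R

  θ-generator-identity : ∀ m P k → let c = constP (+ (m !)) ; r = (c ⊗' P) /D^ k f^ suc m in
     dθ r ≈Q ((c ⊗' δθ P) /D^ k f^ suc m) +Q (scaleR (θD-coeff k) r +Q ((constP (+ (suc m !)) ⊗' timesTX P) /D^ k f^ suc (suc m)))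
  θ-generator-identity m P k = Rep-≈ (dθ r) y (Qθ (c ⊗' P) E) B (k ℕ.+ k) (M ℕ.+ M) (k ℕ.+ (1 ℕ.+ k ℕ.+ k)) (M ℕ.+ (M ℕ.+ suc M))
      (Dθ.Rep-derQ r)
      (Rep-+ g1 (scaleR (θD-coeff k) r +Q g3) (c ⊗' δθ P) k M B2 (1 ℕ.+ k ℕ.+ k) (M ℕ.+ suc M) ≋-refl
         (Rep-+ (scaleR (θD-coeff k) r) g3 (numA (θD-coeff k) ⊗' (c ⊗' P)) (1 ℕ.+ k) M (constP (+ (suc m !)) ⊗' timesTX P) k (suc M) (Rep-scale (θD-coeff k) r (c ⊗' P) k M ≋-refl) ≋-refl))
      (begin
        Qθ (c ⊗' P) E ⊗' den (k ℕ.+ (1 ℕ.+ k ℕ.+ k)) (M ℕ.+ (M ℕ.+ suc M))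
          ≈⟨ ⊗-cong (⊕-congʳ (⊗-congʳ (≋-trans (Dθ.δ-⊗ c P) (⊕-congʳ (⊗-congʳ (Dθ.δ-constP (+ (m !))) P) (c ⊗' δθ P))) E) (neg ((c ⊗' P) ⊗' δθ E)))
                 (≋-trans (den-+ k (1 ℕ.+ k ℕ.+ k) M (M ℕ.+ suc M)) (⊗-congˡ E (≋-trans (den-+ (1 ℕ.+ k) k M (suc M)) (⊗-cong hDE hEF)))) ⟩
        (c ⊗' δθ P ⊗' E ⊕' neg ((c ⊗' P) ⊗' δθ E)) ⊗' (E ⊗' ((Dp ⊗' E) ⊗' (E ⊗' Fp)))
          ≈⟨ θ-generator-numerators c P E (constP (+ k)) (constP (+ M)) (Dθ.δ-den k M) ⟩
        (c ⊗' δθ P ⊗' ((Dp ⊗' E) ⊗' (E ⊗' Fp)) ⊕' ((neg (constP (+ k) ⊗' δθ Dp) ⊗' (c ⊗' P)) ⊗' (E ⊗' Fp) ⊕' ((constP (+ M) ⊗' c) ⊗' (P ⊗' neg (δθ Fp))) ⊗' (Dp ⊗' E)) ⊗' E) ⊗' (E ⊗' E)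
          ≈⟨ ≋-sym (⊗-cong (⊕-cong (⊗-congˡ (c ⊗' δθ P) (≋-trans (den-+ (1 ℕ.+ k) k M (suc M)) (⊗-cong hDE hEF)))
                             (⊗-congʳ (⊕-cong (⊗-cong (⊗-congʳ (numA-θD-coeff k) (c ⊗' P)) hEF) (⊗-cong (⊗-cong (constP-factorial m) (⊗-congˡ P tSumX≋-θf)) hDE)) E))
                        (den-+ k k M M)) ⟩
        B ⊗' den (k ℕ.+ k) (M ℕ.+ M) ∎)
    where
    open ≋R
    M : ℕ
    M = suc m
    c E B2 B : Poly n
    c = constP (+ (m !))
    E = den k M
    B2 = numA (θD-coeff k) ⊗' (c ⊗' P) ⊗' den k (suc M) ⊕' constP (+ (suc m !)) ⊗' timesTX P ⊗' den (1 ℕ.+ k) M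
    B = c ⊗' δθ P ⊗' den (1 ℕ.+ k ℕ.+ k) (M ℕ.+ suc M) ⊕' B2 ⊗' den k M
    r g1 g3 y : RatFun n
    r = (c ⊗' P) /D^ k f^ M
    g1 = (c ⊗' δθ P) /D^ k f^ M
    g3 = (constP (+ (suc m !)) ⊗' timesTX P) /D^ k f^ suc M
    y = g1 +Q (scaleR (θD-coeff k) r +Q g3)
    hDE : den (1 ℕ.+ k) M ≋ Dp ⊗' E
    hDE = rsolve 3 (λ D a b → D :* a :* b := D :* (a :* b)) ≋-refl Dp (pow Dp k) (pow Fp M)
    hEF : den k (suc M) ≋ E ⊗' Fp
    hEF = rsolve 3 (λ a F b → a :* (F :* b) := a :* b :* F) ≋-refl (pow Dp k) Fp (pow Fp M)
    tSumX≋-θf : tP n ⊗' sumX ≋ neg (δθ Fp)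
    tSumX≋-θf = ≋-trans (≋-sym (rsolve 1 (λ x → :- (:- x) := x) ≋-refl (tP n ⊗' sumX))) (neg-cong (≋-sym θ-f))


module RationalArithmetic where
  open +-*-Solver using (solve; _:=_; _:+_; _:-_; _:*_; :-_; con)

  toℚᵘ-/1 : ∀ i → ℚ.toℚᵘ (i / 1) ℚᵘ.≃ ℚᵘ.mkℚᵘ i 0
  toℚᵘ-/1 i = ℚP.toℚᵘ-fromℚᵘ (ℚᵘ.mkℚᵘ i 0)

  [i+j]*1≡[i*1+j*1]*1 : ∀ i j → (i +ᶻ j) *ᶻ + 1 ≡ (i *ᶻ + 1 +ᶻ j *ᶻ + 1) *ᶻ + 1
  [i+j]*1≡[i*1+j*1]*1 = solve-∀

  /1-homo-+ : ∀ i j → (i +ᶻ j) / 1 ≡ i / 1 +q j / 1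
  /1-homo-+ i j = ℚP.toℚᵘ-injective (ℚᵘP.≃-trans (toℚᵘ-/1 (i +ᶻ j)) (ℚᵘP.≃-trans (ℚᵘ.*≡* ([i+j]*1≡[i*1+j*1]*1 i j))
             (ℚᵘP.≃-sym (ℚᵘP.≃-trans (ℚP.toℚᵘ-homo-+ (i / 1) (j / 1)) (ℚᵘP.+-cong (toℚᵘ-/1 i) (toℚᵘ-/1 j))))))

  0≤/1 : ∀ m → 0ℚ ≤q (+ m) / 1
  0≤/1 m = ℚP.nonNegative⁻¹ ((+ m) / 1) {{ℚP.normalize-nonNeg m 1}}

  0≤-+ : ∀ {x y} → 0ℚ ≤q x → 0ℚ ≤q y → 0ℚ ≤q x +q y
  0≤-+ hx hy = ℚP.+-mono-≤ hx hy

  sumFin : ∀ m → (Fin m → ℚ) → ℚ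
  sumFin m f = foldr _+q_ 0ℚ (List.tabulate f)

  sumQ≡sumFin : ∀ n l → sumQ n l ≡ sumFin (suc n) l
  sumQ≡sumFin n l = cong (foldr _+q_ 0ℚ) (ListP.map-tabulate (λ x → x) l)

  sumFin-+ : ∀ m f g → sumFin m (λ j → f j +q g j) ≡ sumFin m f +q sumFin m g
  sumFin-+ zero f g = refl
  sumFin-+ (suc m) f g = trans (cong ((f Fin.zero +q g Fin.zero) +q_) (sumFin-+ m (f ∘ Fin.suc) (g ∘ Fin.suc)))
      (solve 4 (λ a b c d → (a :+ b) :+ (c :+ d) := (a :+ c) :+ (b :+ d)) refl (f Fin.zero) (g Fin.zero) (sumFin m (f ∘ Fin.suc)) (sumFin m (g ∘ Fin.suc)))

  indicator : ∀ {m} → Fin m → Fin m → ℚ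
  indicator s j = if ⌊ s Fin.≟ j ⌋ then 1ℚ else 0ℚ

  sumFin-0 : ∀ m → sumFin m (λ _ → 0ℚ) ≡ 0ℚ
  sumFin-0 zero = refl
  sumFin-0 (suc m) = trans (cong (0ℚ +q_) (sumFin-0 m)) refl

  sumFin-cong : ∀ m {f g : Fin m → ℚ} → (∀ j → f j ≡ g j) → sumFin m f ≡ sumFin m g
  sumFin-cong zero e = refl
  sumFin-cong (suc m) e = cong₂ _+q_ (e Fin.zero) (sumFin-cong m (λ j → e (Fin.suc j)))

  indicator-suc : ∀ {m} (s j : Fin m) → indicator (Fin.suc s) (Fin.suc j) ≡ indicator s j
  indicator-suc s j = cong (λ b → if b then 1ℚ else 0ℚ) (⌊⌋-map′ (s Fin.≟ j))

  sumFin-indicator : ∀ m (s : Fin m) → sumFin m (indicator s) ≡ 1ℚ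
  sumFin-indicator (suc m) Fin.zero = trans (cong (1ℚ +q_) (trans (sumFin-cong m (λ j → refl)) (sumFin-0 m))) refl
  sumFin-indicator (suc m) (Fin.suc s) = trans (cong (0ℚ +q_) (trans (sumFin-cong m (λ j → indicator-suc s j)) (sumFin-indicator m s))) refl

  0≤indicator : ∀ {m} (s j : Fin m) → 0ℚ ≤q indicator s j
  0≤indicator s j with ⌊ s Fin.≟ j ⌋
  ... | true = 0≤/1 1
  ... | false = ℚP.≤-refl

  /1-homo-neg : ∀ j → (- j) / 1 ≡ ℚ.- (j / 1)
  /1-homo-neg j = begin
      (- j) / 1 ≡⟨ solve 2 (λ x y → y := (x :+ y) :- x) refl (j / 1) ((- j) / 1) ⟩
      (j / 1 +q (- j) / 1) -q j / 1 ≡⟨ cong (_-q j / 1) (sym (/1-homo-+ j (- j))) ⟩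
      ((j +ᶻ - j) / 1) -q j / 1 ≡⟨ cong (λ z → (z / 1) -q j / 1) (ℤP.+-inverseʳ j) ⟩
      0ℚ -q j / 1 ≡⟨ solve 1 (λ x → con 0ℚ :- x := :- x) refl (j / 1) ⟩
      ℚ.- (j / 1) ∎
    where open ≡-Reasoning

  /1-homo-- : ∀ i j → (i -ᶻ j) / 1 ≡ i / 1 -q j / 1
  /1-homo-- i j = trans (/1-homo-+ i (- j)) (cong (i / 1 +q_) (/1-homo-neg j))

open RationalArithmetic

module Dilates (n : ℕ) where
  open +-*-Solver using (solve; _:=_; _:+_; _:-_; _:*_; :-_; con)
  InD : ℕ → Vec ℤ n → Set
  InD = InDilate n

  InDilate-step : ∀ d (w u : Vec ℤ n) (s : Fin (suc n)) → InD d w →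
              (∀ i → (lookup u i) / 1 ≡ (lookup w i) / 1 +q (indicator s (Fin.suc i) -q indicator s Fin.zero)) → InD (suc d) u
  InDilate-step d w u s (l , nn , sm , cd) hu = l' , (λ j → 0≤-+ (nn j) (0≤indicator s j)) , sm' , cd'
    where
    l' : Fin (suc n) → ℚ
    l' j = l j +q indicator s j
    sm' : sumQ n l' ≡ (+ suc d) / 1
    sm' = begin
        sumQ n l' ≡⟨ sumQ≡sumFin n l' ⟩
        sumFin (suc n) l' ≡⟨ sumFin-+ (suc n) l (indicator s) ⟩
        sumFin (suc n) l +q sumFin (suc n) (indicator s) ≡⟨ cong₂ _+q_ (trans (sym (sumQ≡sumFin n l)) sm) (sumFin-indicator (suc n) s) ⟩
        (+ d) / 1 +q (+ 1) / 1 ≡⟨ sym (/1-homo-+ (+ d) (+ 1)) ⟩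
        (+ (d ℕ.+ 1)) / 1 ≡⟨ cong (λ z → (+ z) / 1) (ℕP.+-comm d 1) ⟩
        (+ suc d) / 1 ∎
      where open ≡-Reasoning
    cd' : ∀ i → (lookup u i) / 1 ≡ l' (Fin.suc i) -q l' Fin.zero
    cd' i = trans (hu i) (trans (cong (_+q (indicator s (Fin.suc i) -q indicator s Fin.zero)) (cd i))
              (solve 4 (λ a b x y → (a :- b) :+ (x :- y) := (a :+ x) :- (b :+ y)) refl (l (Fin.suc i)) (l Fin.zero) (indicator s (Fin.suc i)) (indicator s Fin.zero)))

  sumFin-lookup : ∀ m (V : Vec ℕ m) → sumFin m (λ j → (+ lookup V j) / 1) ≡ (+ Vec.sum V) / 1
  sumFin-lookup zero Vec.[] = refl
  sumFin-lookup (suc m) (x Vec.∷ V) = trans (cong ((+ x) / 1 +q_) (sumFin-lookup m V)) (sym (/1-homo-+ (+ x) (+ Vec.sum V)))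

  sumFin-const : ∀ m c → sumFin m (λ _ → c) ≡ (+ m) / 1 *q c
  sumFin-const zero c = sym (ℚP.*-zeroˡ c)
  sumFin-const (suc m) c = begin
      c +q sumFin m (λ _ → c) ≡⟨ cong (c +q_) (sumFin-const m c) ⟩
      c +q (+ m) / 1 *q c ≡⟨ solve 2 (λ c x → c :+ x :* c := (con 1ℚ :+ x) :* c) refl c ((+ m) / 1) ⟩
      (1ℚ +q (+ m) / 1) *q c ≡⟨ cong (_*q c) (sym (/1-homo-+ (+ 1) (+ m))) ⟩
      (+ suc m) / 1 *q c ∎
    where open ≡-Reasoning

  exponentVec : Vec ℕ (suc n) → Vec ℤ n
  exponentVec V = Vec.tabulate (λ i → + lookup V (Fin.suc i) -ᶻ + lookup V Fin.zero)

  InDilate-ω : ∀ V → InD (Vec.sum V) (exponentVec V)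
  InDilate-ω V = (λ j → (+ lookup V j) / 1) , (λ j → 0≤/1 (lookup V j)) , trans (sumQ≡sumFin n (λ j → (+ lookup V j) / 1)) (sumFin-lookup (suc n) V) ,
            (λ i → trans (cong (_/ 1) (VecP.lookup∘tabulate _ i)) (/1-homo-- (+ lookup V (Fin.suc i)) (+ lookup V Fin.zero)))

  [n+1]ℚ : ℚ
  [n+1]ℚ = (+ suc n) / 1
  instance
    [n+1]ℚ-positive : ℚ.Positive [n+1]ℚ
    [n+1]ℚ-positive = ℚP.normalize-pos (suc n) 1
    [n+1]ℚ-nonZero : ℚ.NonZero [n+1]ℚ
    [n+1]ℚ-nonZero = ℚP.pos⇒nonZero [n+1]ℚ
  1/[n+1] : ℚ
  1/[n+1] = ℚ.1/ [n+1]ℚ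
  0≤1/[n+1] : 0ℚ ≤q 1/[n+1]
  0≤1/[n+1] = ℚP.nonNegative⁻¹ 1/[n+1] {{ℚP.pos⇒nonNeg 1/[n+1] {{ℚP.1/pos⇒pos [n+1]ℚ}}}}

  InDilate-ω-suc : ∀ V → InD (suc (Vec.sum V)) (exponentVec V)
  InDilate-ω-suc V = l' , (λ j → 0≤-+ (0≤/1 (lookup V j)) 0≤1/[n+1]) , sm' , cd'
    where
    l' : Fin (suc n) → ℚ
    l' j = (+ lookup V j) / 1 +q 1/[n+1]
    sm' : sumQ n l' ≡ (+ suc (Vec.sum V)) / 1
    sm' = begin
        sumQ n l' ≡⟨ sumQ≡sumFin n l' ⟩
        sumFin (suc n) l' ≡⟨ sumFin-+ (suc n) (λ j → (+ lookup V j) / 1) (λ _ → 1/[n+1]) ⟩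
        sumFin (suc n) (λ j → (+ lookup V j) / 1) +q sumFin (suc n) (λ _ → 1/[n+1]) ≡⟨ cong₂ _+q_ (sumFin-lookup (suc n) V) (trans (sumFin-const (suc n) 1/[n+1]) (ℚP.*-inverseʳ [n+1]ℚ)) ⟩
        (+ Vec.sum V) / 1 +q (+ 1) / 1 ≡⟨ sym (/1-homo-+ (+ Vec.sum V) (+ 1)) ⟩
        (+ (Vec.sum V ℕ.+ 1)) / 1 ≡⟨ cong (λ z → (+ z) / 1) (ℕP.+-comm (Vec.sum V) 1) ⟩
        (+ suc (Vec.sum V)) / 1 ∎
      where open ≡-Reasoning
    cd' : ∀ i → (lookup (exponentVec V) i) / 1 ≡ l' (Fin.suc i) -q l' Fin.zero
    cd' i = trans (cong (_/ 1) (VecP.lookup∘tabulate _ i)) (trans (/1-homo-- (+ lookup V (Fin.suc i)) (+ lookup V Fin.zero))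
              (solve 3 (λ a b c → a :- b := (a :+ c) :- (b :+ c)) refl ((+ lookup V (Fin.suc i)) / 1) ((+ lookup V Fin.zero) / 1) 1/[n+1]))


[u-v]+v≡u : ∀ u v → (u -ᶻ v) +ᶻ v ≡ u
[u-v]+v≡u = solve-∀

module ThetaPreservesO (n : ℕ) where
  open ThetaGenerator n public
  open Dilates n public

  θ-support : ∀ P a u → coeff n (δθ P) a u ≢ + 0 → coeff n P a u ≢ + 0
  θ-support P a u h e = h (trans (Dθ.δ-coeff P a u) (trans (cong (+ a *ᶻ_) e) (ℤP.*-zeroʳ (+ a))))

  θ-admissible : ∀ P → Admissible n P → Admissible n (δθ P)
  θ-admissible P h a u nz = h a u (θ-support P a u nz)

  θ-suppIn : ∀ m P → SuppIn n m P → SuppIn n m (δθ P)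
  θ-suppIn m P h a u nz = h a u (θ-support P a u nz)

  sumMap-nonzero : ∀ {g : Term n → ℤ} {C : Set} T → All (λ s → g s ≢ + 0 → C) T → sumMap g T ≢ + 0 → C
  sumMap-nonzero [] [] h = ⊥-elim (h refl)
  sumMap-nonzero {g} (s ∷ T) (p ∷ al) h with g s ℤ.≟ + 0
  ... | no ne = p ne
  ... | yes e = sumMap-nonzero T al (λ e' → h (trans (cong (_+ᶻ sumMap g T) e) (trans (ℤP.+-identityˡ _) e')))

  -- Fd = id covers admissibility (the degree bound is the t-order), Fd = const m covers SuppIn m.
  module TimesTX (P : Poly n) (Fd : ℕ → ℕ) (Hp : ∀ b w → coeff n P b w ≢ + 0 → InD (Fd b) w) where
    RaisedDilate : ℕ → Vec ℤ n → Set
    RaisedDilate a u = Σ (1 ℕ.≤ a) (λ _ → InD (suc (Fd (a ∸ 1))) u)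

    shifted-term : ∀ v (s' : Fin (suc n)) → (∀ i → (lookup (zipWith _+ᶻ_ (0v n) v) i) / 1 ≡ indicator s' (Fin.suc i) -q indicator s' Fin.zero) →
           ∀ a u (d : Dec (1 ℕ.≤ a)) → shiftAt (+ 1) 1 (zipWith _+ᶻ_ (0v n) v) (coeff n P) a u d ≢ + 0 → RaisedDilate a u
    shifted-term v s' hv a u (yes le) nz = le , InDilate-step (Fd (a ∸ 1)) w u s' (Hp (a ∸ 1) w (λ e → nz (trans (ℤP.*-identityˡ _) e))) hu
      where
      v' w : Vec ℤ n
      v' = zipWith _+ᶻ_ (0v n) v
      w = subᵛ u v'
      hu : ∀ i → (lookup u i) / 1 ≡ (lookup w i) / 1 +q (indicator s' (Fin.suc i) -q indicator s' Fin.zero)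
      hu i = trans (cong (_/ 1) (trans (sym ([u-v]+v≡u (lookup u i) (lookup v' i))) (cong (_+ᶻ lookup v' i) (sym (VecP.lookup-zipWith _-ᶻ_ i u v')))))
                   (trans (/1-homo-+ (lookup w i) (lookup v' i)) (cong ((lookup w i) / 1 +q_) (hv i)))
    shifted-term v s' hv a u (no _) nz = ⊥-elim (nz refl)

    x0-exponent : ∀ i → (lookup (zipWith _+ᶻ_ (0v n) (replicate n (- (+ 1)))) i) / 1 ≡ indicator {suc n} Fin.zero (Fin.suc i) -q indicator {suc n} Fin.zero Fin.zero
    x0-exponent i = trans (cong (_/ 1) (trans (VecP.lookup-zipWith _+ᶻ_ i (0v n) (replicate n (- (+ 1)))) (cong₂ _+ᶻ_ (VecP.lookup-replicate i (+ 0)) (VecP.lookup-replicate i (- (+ 1)))))) refl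

    if-/1 : ∀ (B : Bool) → ((+ 0) +ᶻ (if B then + 1 else + 0)) / 1 ≡ (if B then 1ℚ else 0ℚ) -q 0ℚ
    if-/1 true = refl
    if-/1 false = refl

    xi-exponent : ∀ t i → (lookup (zipWith _+ᶻ_ (0v n) (tabulate (λ j → if ⌊ t Fin.≟ j ⌋ then + 1 else + 0))) i) / 1 ≡ indicator (Fin.suc t) (Fin.suc i) -q indicator (Fin.suc t) Fin.zero
    xi-exponent t i = trans (cong (_/ 1) (trans (VecP.lookup-zipWith _+ᶻ_ i (0v n) _) (cong₂ _+ᶻ_ (VecP.lookup-replicate i (+ 0)) (VecP.lookup∘tabulate _ i))))
                  (trans (if-/1 ⌊ t Fin.≟ i ⌋) (cong (_-q 0ℚ) (sym (indicator-suc t i))))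

    tTerm : Term n
    tTerm = (+ 1 , 1 , 0v n)

    all-terms : ∀ a u → All (λ s → shiftCoeff s (coeff n P) a u ≢ + 0 → RaisedDilate a u) (tP n ⊗' sumX)
    all-terms a u = AllP.++⁺ (AllP.map⁺ {xs = sumX} {f = mulT n tTerm} (AllP.++⁺ {xs = x0P n} (shifted-term (replicate n (- (+ 1))) Fin.zero x0-exponent a u (1 ℕ.≤? a) ∷ []) (go (allFin n)))) []
      where
      go : ∀ (L : List (Fin n)) → All (λ s0 → shiftCoeff (mulT n tTerm s0) (coeff n P) a u ≢ + 0 → RaisedDilate a u) (concatMap (xP n) L)
      go [] = []
      go (t ∷ L) = shifted-term _ (Fin.suc t) (xi-exponent t) a u (1 ℕ.≤? a) ∷ go L

    nonzero-coeff-InDilate : ∀ a u → coeff n (P ⊗' (tP n ⊗' sumX)) a u ≢ + 0 → RaisedDilate a u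
    nonzero-coeff-InDilate a u nz = sumMap-nonzero (tP n ⊗' sumX) (all-terms a u) (λ e → nz (trans (⊗-comm≈ P (tP n ⊗' sumX) a u) (trans (coeff-⊗ (tP n ⊗' sumX) P a u) e)))

  timesTX-admissible : ∀ P → Admissible n P → Admissible n (timesTX P)
  timesTX-admissible P h a u nz with TimesTX.nonzero-coeff-InDilate P (λ b → b) h a u nz
  ... | le , ind' = subst (λ z → InD z u) (ℕP.m+[n∸m]≡n le) ind'

  timesTX-suppIn : ∀ m P → SuppIn n m P → SuppIn n (suc m) (timesTX P)
  timesTX-suppIn m P h a u nz = proj₂ (TimesTX.nonzero-coeff-InDilate P (λ _ → m) h a u nz)

  θ-generator : ∀ g → OfGen n g → Span n (OfGen n) (dθ g)
  θ-generator g (suc m , P , k , s≤s z≤n , adm , supp , refl) =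
    Span-≈ {OfGen n} (Span-+ {OfGen n} {g1} {scaleR (θD-coeff k) g +Q g3} (Span-gen {OfGen n} g1∈)
                        (Span-+ {OfGen n} {scaleR (θD-coeff k) g} {g3} (Span-scale {OfGen n} {g} (θD-coeff k) (Span-gen {OfGen n} (suc m , P , k , s≤s z≤n , adm , supp , refl))) (Span-gen {OfGen n} g3∈)))
         (≈Q-sym (θ-generator-identity m P k))
    where
    c : Poly n
    c = constP (+ (m !))
    g1 g3 : RatFun n
    g1 = (c ⊗' δθ P) /D^ k f^ suc m
    g3 = (constP (+ (suc m !)) ⊗' timesTX P) /D^ k f^ suc (suc m)
    g1∈ : OfGen n g1
    g1∈ = suc m , δθ P , k , s≤s z≤n , θ-admissible P adm , θ-suppIn (suc m) P supp , refl
    g3∈ : OfGen n g3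
    g3∈ = suc (suc m) , timesTX P , k , s≤s z≤n , timesTX-admissible P adm , timesTX-suppIn (suc m) P supp , refl


module OmegaDerivatives (n : ℕ) where
  open ThetaPreservesO n public

  monomial : ℤ → ℕ → Vec ℤ n → Poly n
  monomial c a u = (c , a , u) ∷ []

  x0Poly sumXi tPoly : Poly n
  x0Poly = x0P n
  sumXi = concatMap (xP n) (allFin n)
  tPoly = tP n

  δx : Fin n → Poly n → Poly n
  δx i = Dx.δ i

  dx : Fin n → RatFun n → RatFun n
  dx i = Dx.derQ i

  x∂-xFree : ∀ (i : Fin n) P → All (λ s → proj₂ (proj₂ s) ≡ 0v n) P → δx i P ≋ []
  x∂-xFree i P al = zeroCoeffs≋[] (δx i P) (go P al)
    where
    go : ∀ P → All (λ s → proj₂ (proj₂ s) ≡ 0v n) P → All (λ s → proj₁ s ≡ + 0) (δx i P)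
    go [] [] = []
    go ((c , a , u) ∷ P) (refl ∷ al) = trans (cong (_*ᶻ c) (VecP.lookup-replicate i (+ 0))) (ℤP.*-zeroˡ c) ∷ go P al

  x∂-t : ∀ i → δx i tPoly ≋ []
  x∂-t i = x∂-xFree i tPoly (refl ∷ [])

  sumFinℤ : ∀ m → (Fin m → ℤ) → ℤ
  sumFinℤ m h = foldr _+ᶻ_ (+ 0) (List.tabulate h)

  sumFinℤ-0 : ∀ m → sumFinℤ m (λ _ → + 0) ≡ + 0
  sumFinℤ-0 zero = refl
  sumFinℤ-0 (suc m) = trans (ℤP.+-identityˡ _) (sumFinℤ-0 m)

  sumFinℤ-cong : ∀ m {f g : Fin m → ℤ} → (∀ j → f j ≡ g j) → sumFinℤ m f ≡ sumFinℤ m g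
  sumFinℤ-cong zero e = refl
  sumFinℤ-cong (suc m) e = cong₂ _+ᶻ_ (e Fin.zero) (sumFinℤ-cong m (λ j → e (Fin.suc j)))

  sumFinℤ-select : ∀ m (i : Fin m) (g : Fin m → ℤ) → sumFinℤ m (λ t → if ⌊ t Fin.≟ i ⌋ then g t else + 0) ≡ g i
  sumFinℤ-select (suc m) Fin.zero g = trans (cong (g Fin.zero +ᶻ_) (trans (sumFinℤ-cong m (λ j → refl)) (sumFinℤ-0 m))) (ℤP.+-identityʳ _)
  sumFinℤ-select (suc m) (Fin.suc i) g = trans (ℤP.+-identityˡ _) (trans (sumFinℤ-cong m (λ j → cong (λ b → if b then g (Fin.suc j) else + 0) (⌊⌋-map′ (j Fin.≟ i)))) (sumFinℤ-select m i (λ j → g (Fin.suc j))))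

  coeff-concatMap : ∀ {A : Set} (g : A → Poly n) L a u → coeff n (concatMap g L) a u ≡ foldr _+ᶻ_ (+ 0) (map (λ t → coeff n (g t) a u) L)
  coeff-concatMap g [] a u = refl
  coeff-concatMap g (t ∷ L) a u = trans (coeff-++ (g t) (concatMap g L) a u) (cong (coeff n (g t) a u +ᶻ_) (coeff-concatMap g L a u))

  unitVec : Fin n → Vec ℤ n
  unitVec t = tabulate (λ j → if ⌊ t Fin.≟ j ⌋ then + 1 else + 0)

  lookup*coeff-xP : ∀ (i t : Fin n) a u → lookup u i *ᶻ coeff n (xP n t) a u ≡ (if ⌊ t Fin.≟ i ⌋ then coeff n (xP n t) a u else + 0)
  lookup*coeff-xP i t a u = go (0 ℕ.≟ a) (VecP.≡-dec ℤ._≟_ (unitVec t) u)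
    where
    go : (d1 : Dec (0 ≡ a)) → (d2 : Dec (unitVec t ≡ u)) → lookup u i *ᶻ ((if ⌊ d1 ⌋ ∧ ⌊ d2 ⌋ then + 1 else + 0) +ᶻ + 0) ≡ (if ⌊ t Fin.≟ i ⌋ then (if ⌊ d1 ⌋ ∧ ⌊ d2 ⌋ then + 1 else + 0) +ᶻ + 0 else + 0)
    go (yes refl) (yes refl) = trans (ℤP.*-identityʳ _) (VecP.lookup∘tabulate _ i)
    go (yes _) (no _) = trans (ℤP.*-zeroʳ (lookup u i)) (sym (if-same ⌊ t Fin.≟ i ⌋ (+ 0)))
    go (no _) d2 = trans (ℤP.*-zeroʳ (lookup u i)) (sym (if-same ⌊ t Fin.≟ i ⌋ (+ 0)))

  *-distrib-foldr : ∀ {A : Set} c (f : A → ℤ) L → c *ᶻ foldr _+ᶻ_ (+ 0) (map f L) ≡ foldr _+ᶻ_ (+ 0) (map (λ t → c *ᶻ f t) L)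
  *-distrib-foldr c f [] = ℤP.*-zeroʳ c
  *-distrib-foldr c f (t ∷ L) = trans (ℤP.*-distribˡ-+ c (f t) _) (cong (c *ᶻ f t +ᶻ_) (*-distrib-foldr c f L))

  foldr-map-cong : ∀ {A : Set} {f g : A → ℤ} → (∀ t → f t ≡ g t) → ∀ L → foldr _+ᶻ_ (+ 0) (map f L) ≡ foldr _+ᶻ_ (+ 0) (map g L)
  foldr-map-cong e [] = refl
  foldr-map-cong e (t ∷ L) = cong₂ _+ᶻ_ (e t) (foldr-map-cong e L)

  x∂-sumXi : ∀ i → δx i sumXi ≋ xP n i
  x∂-sumXi i = mk λ a u → begin
      coeff n (δx i sumXi) a u ≡⟨ Dx.δ-coeff i sumXi a u ⟩
      lookup u i *ᶻ coeff n sumXi a u ≡⟨ cong (lookup u i *ᶻ_) (coeff-concatMap (xP n) (allFin n) a u) ⟩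
      lookup u i *ᶻ foldr _+ᶻ_ (+ 0) (map (λ t → coeff n (xP n t) a u) (allFin n)) ≡⟨ *-distrib-foldr (lookup u i) _ (allFin n) ⟩
      foldr _+ᶻ_ (+ 0) (map (λ t → lookup u i *ᶻ coeff n (xP n t) a u) (allFin n)) ≡⟨ foldr-map-cong (λ t → lookup*coeff-xP i t a u) (allFin n) ⟩
      foldr _+ᶻ_ (+ 0) (map (λ t → if ⌊ t Fin.≟ i ⌋ then coeff n (xP n t) a u else + 0) (List.tabulate (λ x → x))) ≡⟨ cong (foldr _+ᶻ_ (+ 0)) (ListP.map-tabulate {n = n} (λ x → x) (λ t → if ⌊ t Fin.≟ i ⌋ then coeff n (xP n t) a u else + 0)) ⟩
      sumFinℤ n (λ t → if ⌊ t Fin.≟ i ⌋ then coeff n (xP n t) a u else + 0) ≡⟨ sumFinℤ-select n i (λ t → coeff n (xP n t) a u) ⟩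
      coeff n (xP n i) a u ∎
    where open ≡-Reasoning

  x∂-x0 : ∀ i → δx i x0Poly ≡ neg x0Poly
  x∂-x0 i = cong (λ z → (z , 0 , replicate n (- (+ 1))) ∷ []) (trans (cong (_*ᶻ + 1) (VecP.lookup-replicate i (- (+ 1)))) refl)

  x∂-sumX : ∀ i → δx i sumX ≋ xP n i ⊕' neg x0Poly
  x∂-sumX i = begin
      δx i (x0Poly ⊕' sumXi) ≈⟨ Dx.δ-⊕ i x0Poly sumXi ⟩
      δx i x0Poly ⊕' δx i sumXi ≈⟨ ⊕-cong (≡⇒≋ (x∂-x0 i)) (x∂-sumXi i) ⟩
      neg x0Poly ⊕' xP n i ≈⟨ mk (⊕-comm≈ (neg x0Poly) (xP n i)) ⟩
      xP n i ⊕' neg x0Poly ∎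
    where open ≋R

  x∂-f : ∀ i → δx i Fp ≋ neg (tPoly ⊗' (xP n i ⊕' neg x0Poly))
  x∂-f i = begin
      δx i (one ⊕' neg (tPoly ⊗' sumX)) ≈⟨ Dx.δ-⊕ i one (neg (tPoly ⊗' sumX)) ⟩
      δx i one ⊕' δx i (neg (tPoly ⊗' sumX)) ≈⟨ ⊕-cong (Dx.δ-constP i (+ 1)) (≋-trans (Dx.δ-neg i (tPoly ⊗' sumX)) (neg-cong (Dx.δ-⊗ i tPoly sumX))) ⟩
      [] ⊕' neg (δx i tPoly ⊗' sumX ⊕' tPoly ⊗' δx i sumX) ≈⟨ neg-cong (⊕-cong (⊗-congʳ (x∂-t i) sumX) (⊗-congˡ tPoly (x∂-sumX i))) ⟩
      neg ([] ⊗' sumX ⊕' tPoly ⊗' (xP n i ⊕' neg x0Poly)) ≈⟨ ≋-refl ⟩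
      neg (tPoly ⊗' (xP n i ⊕' neg x0Poly)) ∎
    where open ≋R

  constP*monomial : ∀ b c a u → constP b ⊗' monomial c a u ≡ monomial (b *ᶻ c) a u
  constP*monomial b c a u = cong (λ v → (b *ᶻ c , a , v) ∷ []) (VecP.zipWith-identityˡ ℤP.+-identityˡ u)

  module OmegaNumerators (V : Vec ℕ (suc n)) where
    d : ℕ
    d = Vec.sum V

    uv : Vec ℤ n
    uv = exponentVec V

    ωNum Kd Ksd : Poly n
    ωNum = monomial (+ (d !)) d uv
    Kd = constP (+ d)
    Ksd = constP (+ suc d)

    ωV : RatFun n
    ωV = ω n V

    θω-num : num (dθ ωV) ≋ Kd ⊗' ωNum ⊗' Dp ⊗' Fp ⊕' Ksd ⊗' ωNum ⊗' tPoly ⊗' sumX ⊗' Dp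
    θω-num = begin
        δθ ωNum ⊗' (Dp ⊗' Fp) ⊕' (neg (constP (+ 0) ⊗' (ωNum ⊗' (δθ Dp ⊗' Fp))) ⊕' neg (Ksd ⊗' (ωNum ⊗' (δθ Fp ⊗' Dp))))
          ≈⟨ ⊕-cong (⊗-congʳ (≡⇒≋ (sym (constP*monomial (+ d) (+ (d !)) d uv))) (Dp ⊗' Fp))
                 (⊕-cong (neg-cong (⊗-congʳ constP-0 (ωNum ⊗' (δθ Dp ⊗' Fp)))) (neg-cong (⊗-congˡ Ksd (⊗-congˡ ωNum (⊗-congʳ θ-f Dp))))) ⟩
        Kd ⊗' ωNum ⊗' (Dp ⊗' Fp) ⊕' ([] ⊕' neg (Ksd ⊗' (ωNum ⊗' (neg (tPoly ⊗' sumX) ⊗' Dp))))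
          ≈⟨ rsolve 7 (λ a b D F c t s → a :* b :* (D :* F) :+ :- (c :* (b :* (:- (t :* s) :* D))) := a :* b :* D :* F :+ c :* b :* t :* s :* D) ≋-refl Kd ωNum Dp Fp Ksd tPoly sumX ⟩
        Kd ⊗' ωNum ⊗' Dp ⊗' Fp ⊕' Ksd ⊗' ωNum ⊗' tPoly ⊗' sumX ⊗' Dp ∎
      where open ≋R

    Ku : Fin n → Poly n
    Ku i = constP (lookup uv i)

    x∂ω-num : ∀ i → num (dx i ωV) ≋ Ku i ⊗' ωNum ⊗' Dp ⊗' Fp ⊕' Ksd ⊗' ωNum ⊗' tPoly ⊗' (xP n i ⊕' neg x0Poly) ⊗' Dp
    x∂ω-num i = begin
        δx i ωNum ⊗' (Dp ⊗' Fp) ⊕' (neg (constP (+ 0) ⊗' (ωNum ⊗' (δx i Dp ⊗' Fp))) ⊕' neg (Ksd ⊗' (ωNum ⊗' (δx i Fp ⊗' Dp))))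
          ≈⟨ ⊕-cong (⊗-congʳ (≡⇒≋ (sym (constP*monomial (lookup uv i) (+ (d !)) d uv))) (Dp ⊗' Fp))
                 (⊕-cong (neg-cong (⊗-congʳ constP-0 (ωNum ⊗' (δx i Dp ⊗' Fp)))) (neg-cong (⊗-congˡ Ksd (⊗-congˡ ωNum (⊗-congʳ (x∂-f i) Dp))))) ⟩
        Ku i ⊗' ωNum ⊗' (Dp ⊗' Fp) ⊕' ([] ⊕' neg (Ksd ⊗' (ωNum ⊗' (neg (tPoly ⊗' (xP n i ⊕' neg x0Poly)) ⊗' Dp))))
          ≈⟨ rsolve 7 (λ a b D F c t s → a :* b :* (D :* F) :+ :- (c :* (b :* (:- (t :* s) :* D))) := a :* b :* D :* F :+ c :* b :* t :* s :* D) ≋-refl (Ku i) ωNum Dp Fp Ksd tPoly (xP n i ⊕' neg x0Poly) ⟩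
        Ku i ⊗' ωNum ⊗' Dp ⊗' Fp ⊕' Ksd ⊗' ωNum ⊗' tPoly ⊗' (xP n i ⊕' neg x0Poly) ⊗' Dp ∎
      where open ≋R

    exponentSum : List (Fin n) → ℤ
    exponentSum L = foldr _+ᶻ_ (+ 0) (map (lookup uv) L)

    x∂ω-numForm : Fin n → Poly n
    x∂ω-numForm i = Ku i ⊗' ωNum ⊗' Dp ⊗' Fp ⊕' Ksd ⊗' ωNum ⊗' tPoly ⊗' (xP n i ⊕' neg x0Poly) ⊗' Dp

    sum-x∂ω-num : ∀ L → foldr _⊕'_ [] (map x∂ω-numForm L) ≋ constP (exponentSum L) ⊗' ωNum ⊗' Dp ⊗' Fp ⊕' Ksd ⊗' ωNum ⊗' tPoly ⊗' (concatMap (xP n) L ⊕' neg (constP (+ List.length L) ⊗' x0Poly)) ⊗' Dp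
    sum-x∂ω-num [] = ≋-sym (≋-trans (rsolve 6 (λ m D F c t x → con (+ 0) :* m :* D :* F :+ c :* m :* t :* (:- (con (+ 0) :* x)) :* D := con (+ 0)) ≋-refl ωNum Dp Fp Ksd tPoly x0Poly) constP-0)
    sum-x∂ω-num (i ∷ L) = begin
        x∂ω-numForm i ⊕' foldr _⊕'_ [] (map x∂ω-numForm L) ≈⟨ ⊕-congˡ (x∂ω-numForm i) (sum-x∂ω-num L) ⟩
        x∂ω-numForm i ⊕' (constP (exponentSum L) ⊗' ωNum ⊗' Dp ⊗' Fp ⊕' Ksd ⊗' ωNum ⊗' tPoly ⊗' (concatMap (xP n) L ⊕' neg (constP (+ List.length L) ⊗' x0Poly)) ⊗' Dp)
          ≈⟨ rsolve 11 (λ u m D F c t xi x0 s cm l →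
               u :* m :* D :* F :+ c :* m :* t :* (xi :+ :- x0) :* D :+ (s :* m :* D :* F :+ c :* m :* t :* (cm :+ :- (l :* x0)) :* D)
               := (u :+ s) :* m :* D :* F :+ c :* m :* t :* ((xi :+ cm) :+ :- ((con (+ 1) :+ l) :* x0)) :* D)
               ≋-refl (Ku i) ωNum Dp Fp Ksd tPoly (xP n i) x0Poly (constP (exponentSum L)) (concatMap (xP n) L) (constP (+ List.length L)) ⟩
        (Ku i ⊕' constP (exponentSum L)) ⊗' ωNum ⊗' Dp ⊗' Fp ⊕' Ksd ⊗' ωNum ⊗' tPoly ⊗' ((xP n i ⊕' concatMap (xP n) L) ⊕' neg ((one ⊕' constP (+ List.length L)) ⊗' x0Poly)) ⊗' Dp
          ≈⟨ ⊕-cong (⊗-congʳ (⊗-congʳ (⊗-congʳ (≋-sym (constP-+ (lookup uv i) (exponentSum L))) ωNum) Dp) Fp)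
                 (⊗-congʳ (⊗-congˡ (Ksd ⊗' ωNum ⊗' tPoly) (⊕-congˡ (xP n i ⊕' concatMap (xP n) L) (neg-cong (⊗-congʳ (≋-sym (constP-+ (+ 1) (+ List.length L))) x0Poly)))) Dp) ⟩
        constP (exponentSum (i ∷ L)) ⊗' ωNum ⊗' Dp ⊗' Fp ⊕' Ksd ⊗' ωNum ⊗' tPoly ⊗' (concatMap (xP n) (i ∷ L) ⊕' neg (constP (+ List.length (i ∷ L)) ⊗' x0Poly)) ⊗' Dp ∎
      where open ≋R

  [a-c]+[z-m*c]≡[a+z]-[1+m]*c : ∀ f0 z c m' → (f0 -ᶻ c) +ᶻ (z -ᶻ m' *ᶻ c) ≡ (f0 +ᶻ z) -ᶻ (+ 1 +ᶻ m') *ᶻ c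
  [a-c]+[z-m*c]≡[a+z]-[1+m]*c = solve-∀
  [a+s]-[s-m*a]≡[1+m]*a : ∀ a s m → (a +ᶻ s) -ᶻ (s -ᶻ m *ᶻ a) ≡ (+ 1 +ᶻ m) *ᶻ a
  [a+s]-[s-m*a]≡[1+m]*a = solve-∀

  sumFinℤ-sub : ∀ m (f : Fin m → ℤ) c → sumFinℤ m (λ i → f i -ᶻ c) ≡ sumFinℤ m f -ᶻ + m *ᶻ c
  sumFinℤ-sub zero f c = sym (trans (cong (+ 0 -ᶻ_) (ℤP.*-zeroˡ c)) refl)
  sumFinℤ-sub (suc m) f c = trans (cong ((f Fin.zero -ᶻ c) +ᶻ_) (sumFinℤ-sub m (λ i → f (Fin.suc i)) c)) ([a-c]+[z-m*c]≡[a+z]-[1+m]*c (f Fin.zero) (sumFinℤ m (λ i → f (Fin.suc i))) c (+ m))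

  sumFinℤ-lookup : ∀ m (W : Vec ℕ m) → sumFinℤ m (λ i → + lookup W i) ≡ + Vec.sum W
  sumFinℤ-lookup zero [] = refl
  sumFinℤ-lookup (suc m) (x ∷ W) = cong (+ x +ᶻ_) (sumFinℤ-lookup m W)

  |U|-Σu≡[n+1]U₀ : ∀ V0 (V' : Vec ℕ n) → + Vec.sum (V0 ∷ V') -ᶻ OmegaNumerators.exponentSum (V0 ∷ V') (allFin n) ≡ + suc n *ᶻ + V0
  |U|-Σu≡[n+1]U₀ V0 V' = begin
      + Vec.sum (V0 ∷ V') -ᶻ OmegaNumerators.exponentSum (V0 ∷ V') (allFin n)
        ≡⟨ cong (λ z → + Vec.sum (V0 ∷ V') -ᶻ foldr _+ᶻ_ (+ 0) z) (ListP.map-tabulate {n = n} (λ x → x) (lookup (exponentVec (V0 ∷ V')))) ⟩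
      + Vec.sum (V0 ∷ V') -ᶻ sumFinℤ n (lookup (exponentVec (V0 ∷ V'))) ≡⟨ cong (λ z → + Vec.sum (V0 ∷ V') -ᶻ z) (sumFinℤ-cong n (λ i → VecP.lookup∘tabulate _ i)) ⟩
      + Vec.sum (V0 ∷ V') -ᶻ sumFinℤ n (λ i → + lookup V' i -ᶻ + V0) ≡⟨ cong (λ z → + Vec.sum (V0 ∷ V') -ᶻ z) (trans (sumFinℤ-sub n (λ i → + lookup V' i) (+ V0)) (cong (_-ᶻ + n *ᶻ + V0) (sumFinℤ-lookup n V'))) ⟩
      + Vec.sum (V0 ∷ V') -ᶻ (+ Vec.sum V' -ᶻ + n *ᶻ + V0) ≡⟨ [a+s]-[s-m*a]≡[1+m]*a (+ V0) (+ Vec.sum V') (+ n) ⟩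
      + suc n *ᶻ + V0 ∎
    where open ≡-Reasoning

  incrementAt : Fin (suc n) → Vec ℕ (suc n) → Vec ℕ (suc n)
  incrementAt j V = Vec.updateAt V j suc

  sum-incrementAt : ∀ {m} (V : Vec ℕ m) j → Vec.sum (Vec.updateAt V j suc) ≡ suc (Vec.sum V)
  sum-incrementAt (x ∷ V) Fin.zero = refl
  sum-incrementAt (x ∷ V) (Fin.suc j) = trans (cong (x ℕ.+_) (sum-incrementAt V j)) (ℕP.+-suc x (Vec.sum V))

  xExponent : Fin (suc n) → Vec ℤ n
  xExponent Fin.zero = replicate n (- (+ 1))
  xExponent (Fin.suc t) = unitVec t

  xMonomial : Fin (suc n) → Poly n
  xMonomial j = monomial (+ 1) 0 (xExponent j)

  a-[1+b]≡[a-b]-1 : ∀ a b → a -ᶻ (+ 1 +ᶻ b) ≡ (a -ᶻ b) +ᶻ - (+ 1)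
  a-[1+b]≡[a-b]-1 = solve-∀
  [1+a]-b≡[a-b]+1 : ∀ a b → (+ 1 +ᶻ a) -ᶻ b ≡ (a -ᶻ b) +ᶻ + 1
  [1+a]-b≡[a-b]+1 = solve-∀
  a≡a+0 : ∀ a → a ≡ a +ᶻ + 0
  a≡a+0 = solve-∀

  exponentVec-incrementAt : ∀ V0 (V' : Vec ℕ n) j i → lookup (exponentVec (incrementAt j (V0 ∷ V'))) i ≡ lookup (exponentVec (V0 ∷ V')) i +ᶻ lookup (xExponent j) i
  exponentVec-incrementAt V0 V' Fin.zero i = trans (VecP.lookup∘tabulate _ i) (trans (a-[1+b]≡[a-b]-1 (+ lookup V' i) (+ V0))
      (cong₂ _+ᶻ_ (sym (VecP.lookup∘tabulate _ i)) (sym (VecP.lookup-replicate i (- (+ 1))))))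
  exponentVec-incrementAt V0 V' (Fin.suc t) i = trans (VecP.lookup∘tabulate _ i) (trans (go (t Fin.≟ i))
      (cong₂ _+ᶻ_ (sym (VecP.lookup∘tabulate _ i)) (sym (VecP.lookup∘tabulate _ i))))
    where
    go : (dd : Dec (t ≡ i)) → + lookup (Vec.updateAt V' t suc) i -ᶻ + V0 ≡ (+ lookup V' i -ᶻ + V0) +ᶻ (if ⌊ dd ⌋ then + 1 else + 0)
    go (yes refl) = trans (cong (λ z → + z -ᶻ + V0) (VecP.lookup∘updateAt t V')) ([1+a]-b≡[a-b]+1 (+ lookup V' t) (+ V0))
    go (no ne) = trans (cong (λ z → + z -ᶻ + V0) (VecP.lookup∘updateAt′ i t (λ e → ne (sym e)) V')) (a≡a+0 _)

  monomial-≡ : ∀ {c c' a a' u u'} → c ≡ c' → a ≡ a' → u ≡ u' → monomial c a u ≡ monomial c' a' u'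
  monomial-≡ refl refl refl = refl

  x≡[x*1]*1 : ∀ x → x ≡ (x *ᶻ + 1) *ᶻ + 1
  x≡[x*1]*1 = solve-∀
  x+y≡[[0+x]+0]+y : ∀ x y → x +ᶻ y ≡ ((+ 0 +ᶻ x) +ᶻ + 0) +ᶻ y
  x+y≡[[0+x]+0]+y = solve-∀

  Rep-ω-incrementAt : ∀ V0 (V' : Vec ℕ n) j → let V = V0 ∷ V' ; d = Vec.sum V in
     Rep (ω n (incrementAt j V)) (constP (+ suc d) ⊗' OmegaNumerators.ωNum V ⊗' tPoly ⊗' xMonomial j) 0 (suc (suc d))
  Rep-ω-incrementAt V0 V' j = ≡⇒≋ (cong₂ _⊗'_ eqN (cong (λ z → den 0 (suc z)) (sym (sum-incrementAt VV j))))
    where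
    VV W : Vec ℕ (suc n)
    VV = V0 ∷ V'
    W = incrementAt j VV
    d : ℕ
    d = Vec.sum VV
    eqN : num (ω n W) ≡ constP (+ suc d) ⊗' OmegaNumerators.ωNum VV ⊗' tPoly ⊗' xMonomial j
    eqN = monomial-≡ (trans (cong (λ z → + (z !)) (sum-incrementAt VV j)) (trans (ℤP.pos-* (suc d) (d !)) (x≡[x*1]*1 _)))
                 (trans (sum-incrementAt VV j) (sym (trans (ℕP.+-identityʳ (d ℕ.+ 1)) (ℕP.+-comm d 1))))
                 (Vec-ext _ _ (λ i → trans (exponentVec-incrementAt V0 V' j i) (trans (x+y≡[[0+x]+0]+y (lookup (exponentVec VV) i) (lookup (xExponent j) i))
                    (sym (trans (VecP.lookup-zipWith _+ᶻ_ i (zipWith _+ᶻ_ (zipWith _+ᶻ_ (0v n) (exponentVec VV)) (0v n)) (xExponent j)) (cong (_+ᶻ lookup (xExponent j) i)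
                      (trans (VecP.lookup-zipWith _+ᶻ_ i (zipWith _+ᶻ_ (0v n) (exponentVec VV)) (0v n)) (cong₂ _+ᶻ_ (trans (VecP.lookup-zipWith _+ᶻ_ i (0v n) (exponentVec VV)) (cong (_+ᶻ lookup (exponentVec VV) i) (VecP.lookup-replicate i (+ 0)))) (VecP.lookup-replicate i (+ 0))))))))))


module OmegaStep (n : ℕ) where
  open OmegaDerivatives n public

  Ksn : Poly n
  Ksn = constP [1+n]

  -- The two sides differ by multiples of the three hypotheses, which encode |U| − Σᵢ uᵢ = (n+1)U₀,
  -- 1 + n = n+1 and (n+1) · (1/(n+1)) = 1, the inverse being invNum/D_f.
  step-identity-x0 : ∀ eI Kd KΣ KV0 m D F Ksd t x0' Σx' Kn →
     Kd ⊕' neg KΣ ≋ Ksn ⊗' KV0 → one ⊕' Kn ≋ Ksn → Ksn ⊗' eI ≋ D →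
     eI ⊗' (Kd ⊗' m ⊗' D ⊗' F ⊕' Ksd ⊗' m ⊗' t ⊗' (x0' ⊕' Σx') ⊗' D) ⊕' neg (KV0 ⊗' m ⊗' (D ⊗' D ⊗' F)) ⊕' neg (Ksd ⊗' m ⊗' t ⊗' x0' ⊗' (D ⊗' D))
     ≋ eI ⊗' (KΣ ⊗' m ⊗' D ⊗' F ⊕' Ksd ⊗' m ⊗' t ⊗' (Σx' ⊕' neg (Kn ⊗' x0')) ⊗' D)
  step-identity-x0 eI Kd KΣ KV0 m D F Ksd t x0' Σx' Kn r1 r2 r3 = x-y≋0⇒x≋y _ _ (begin
      _ ≈⟨ rsolve 13 (λ eI Kd KΣ KV0 m D F Ksd t x0 Σx Kn Ksn →
             (eI :* (Kd :* m :* D :* F :+ Ksd :* m :* t :* (x0 :+ Σx) :* D) :+ :- (KV0 :* m :* (D :* D :* F)) :+ :- (Ksd :* m :* t :* x0 :* (D :* D)))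
               :- eI :* (KΣ :* m :* D :* F :+ Ksd :* m :* t :* (Σx :+ :- (Kn :* x0)) :* D)
             := eI :* m :* D :* F :* ((Kd :+ :- KΣ) :- Ksn :* KV0) :+ eI :* Ksd :* m :* t :* x0 :* D :* ((con (+ 1) :+ Kn) :- Ksn)
                :+ KV0 :* m :* D :* F :* (Ksn :* eI :- D) :+ Ksd :* m :* t :* x0 :* D :* (Ksn :* eI :- D))
             ≋-refl eI Kd KΣ KV0 m D F Ksd t x0' Σx' Kn Ksn ⟩
      eI ⊗' m ⊗' D ⊗' F ⊗' ((Kd ⊕' neg KΣ) ⊕' neg (Ksn ⊗' KV0)) ⊕' eI ⊗' Ksd ⊗' m ⊗' t ⊗' x0' ⊗' D ⊗' ((one ⊕' Kn) ⊕' neg Ksn)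
        ⊕' KV0 ⊗' m ⊗' D ⊗' F ⊗' (Ksn ⊗' eI ⊕' neg D) ⊕' Ksd ⊗' m ⊗' t ⊗' x0' ⊗' D ⊗' (Ksn ⊗' eI ⊕' neg D)
        ≈⟨ ⊕-cong (⊕-cong (⊕-cong (⊗-vanishesʳ (eI ⊗' m ⊗' D ⊗' F) (x≋y⇒x-y≋0 r1)) (⊗-vanishesʳ (eI ⊗' Ksd ⊗' m ⊗' t ⊗' x0' ⊗' D) (x≋y⇒x-y≋0 r2))) (⊗-vanishesʳ (KV0 ⊗' m ⊗' D ⊗' F) (x≋y⇒x-y≋0 r3))) (⊗-vanishesʳ (Ksd ⊗' m ⊗' t ⊗' x0' ⊗' D) (x≋y⇒x-y≋0 r3)) ⟩
      [] ∎)
    where open ≋R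

  step-identity-xi : ∀ eI Kd KΣ KV0 m D F Ksd t x0' Σx' Kn KVi xi Ku →
     Kd ⊕' neg KΣ ≋ Ksn ⊗' KV0 → one ⊕' Kn ≋ Ksn → Ksn ⊗' eI ≋ D → Ku ≋ KVi ⊕' neg KV0 →
     eI ⊗' (Kd ⊗' m ⊗' D ⊗' F ⊕' Ksd ⊗' m ⊗' t ⊗' (x0' ⊕' Σx') ⊗' D) ⊕' neg (KVi ⊗' m ⊗' (D ⊗' D ⊗' F)) ⊕' neg (Ksd ⊗' m ⊗' t ⊗' xi ⊗' (D ⊗' D))
     ≋ eI ⊗' (KΣ ⊗' m ⊗' D ⊗' F ⊕' Ksd ⊗' m ⊗' t ⊗' (Σx' ⊕' neg (Kn ⊗' x0')) ⊗' D) ⊕' neg ((Ku ⊗' m ⊗' D ⊗' F ⊕' Ksd ⊗' m ⊗' t ⊗' (xi ⊕' neg x0') ⊗' D) ⊗' D)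
  step-identity-xi eI Kd KΣ KV0 m D F Ksd t x0' Σx' Kn KVi xi Ku r1 r2 r3 r4 = x-y≋0⇒x≋y _ _ (begin
      _ ≈⟨ rsolve 16 (λ eI Kd KΣ KV0 m D F Ksd t x0 Σx Kn Ksn KVi xi Ku →
             (eI :* (Kd :* m :* D :* F :+ Ksd :* m :* t :* (x0 :+ Σx) :* D) :+ :- (KVi :* m :* (D :* D :* F)) :+ :- (Ksd :* m :* t :* xi :* (D :* D)))
               :- (eI :* (KΣ :* m :* D :* F :+ Ksd :* m :* t :* (Σx :+ :- (Kn :* x0)) :* D) :+ :- ((Ku :* m :* D :* F :+ Ksd :* m :* t :* (xi :+ :- x0) :* D) :* D))
             := eI :* m :* D :* F :* ((Kd :+ :- KΣ) :- Ksn :* KV0) :+ eI :* Ksd :* m :* t :* x0 :* D :* ((con (+ 1) :+ Kn) :- Ksn)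
                :+ KV0 :* m :* D :* F :* (Ksn :* eI :- D) :+ Ksd :* m :* t :* x0 :* D :* (Ksn :* eI :- D)
                :+ m :* D :* D :* F :* (Ku :- (KVi :- KV0)))
             ≋-refl eI Kd KΣ KV0 m D F Ksd t x0' Σx' Kn Ksn KVi xi Ku ⟩
      eI ⊗' m ⊗' D ⊗' F ⊗' ((Kd ⊕' neg KΣ) ⊕' neg (Ksn ⊗' KV0)) ⊕' eI ⊗' Ksd ⊗' m ⊗' t ⊗' x0' ⊗' D ⊗' ((one ⊕' Kn) ⊕' neg Ksn)
        ⊕' KV0 ⊗' m ⊗' D ⊗' F ⊗' (Ksn ⊗' eI ⊕' neg D) ⊕' Ksd ⊗' m ⊗' t ⊗' x0' ⊗' D ⊗' (Ksn ⊗' eI ⊕' neg D)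
        ⊕' m ⊗' D ⊗' D ⊗' F ⊗' (Ku ⊕' neg (KVi ⊕' neg KV0))
        ≈⟨ ⊕-cong (⊕-cong (⊕-cong (⊕-cong (⊗-vanishesʳ (eI ⊗' m ⊗' D ⊗' F) (x≋y⇒x-y≋0 r1)) (⊗-vanishesʳ (eI ⊗' Ksd ⊗' m ⊗' t ⊗' x0' ⊗' D) (x≋y⇒x-y≋0 r2))) (⊗-vanishesʳ (KV0 ⊗' m ⊗' D ⊗' F) (x≋y⇒x-y≋0 r3))) (⊗-vanishesʳ (Ksd ⊗' m ⊗' t ⊗' x0' ⊗' D) (x≋y⇒x-y≋0 r3))) (⊗-vanishesʳ (m ⊗' D ⊗' D ⊗' F) (x≋y⇒x-y≋0 r4)) ⟩
      [] ∎)
    where open ≋R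

  foldr-⊕-cong : ∀ {X : Set} (f g : X → Poly n) → (∀ x → f x ≋ g x) → ∀ L → foldr _⊕'_ [] (map f L) ≋ foldr _⊕'_ [] (map g L)
  foldr-⊕-cong f g e [] = ≋-refl
  foldr-⊕-cong f g e (x ∷ L) = ⊕-cong (e x) (foldr-⊕-cong f g e L)

  module StepAt (V0 : ℕ) (V' : Vec ℕ n) where
    VV : Vec ℕ (suc n)
    VV = V0 ∷ V'

    open OmegaNumerators VV public

    ωs : RatFun n
    ωs = ω n VV

    Y : RatFun n
    Y = sumR n (map (λ i → dx i ωs) (allFin n))
    ΣN KΣ Kn KV0 ΣNe Nθe : Poly n
    ΣN = foldr _⊕'_ [] (map (λ i → num (dx i ωs)) (allFin n))
    KΣ = constP (exponentSum (allFin n))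
    Kn = constP (+ n)
    KV0 = constP (+ V0)
    ΣNe = KΣ ⊗' ωNum ⊗' Dp ⊗' Fp ⊕' Ksd ⊗' ωNum ⊗' tPoly ⊗' (sumXi ⊕' neg (Kn ⊗' x0Poly)) ⊗' Dp
    Nθe = Kd ⊗' ωNum ⊗' Dp ⊗' Fp ⊕' Ksd ⊗' ωNum ⊗' tPoly ⊗' sumX ⊗' Dp

    r1 : Kd ⊕' neg KΣ ≋ Ksn ⊗' KV0
    r1 = ≋-trans (≋-sym (constP-+ (+ d) (- exponentSum (allFin n)))) (≋-trans (≡⇒≋ (cong constP (|U|-Σu≡[n+1]U₀ V0 V'))) (constP-* [1+n] (+ V0)))
    r2 : one ⊕' Kn ≋ Ksn
    r2 = ≋-sym (constP-+ (+ 1) (+ n))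
    r3 : Ksn ⊗' invNum ≋ Dp
    r3 = ≋-sym D≋[n+1]*invNum
    r4 : ∀ i → Ku i ≋ constP (+ lookup V' i) ⊕' neg KV0
    r4 i = ≋-trans (≡⇒≋ (cong constP (VecP.lookup∘tabulate _ i))) (constP-+ (+ lookup V' i) (- (+ V0)))

    ΣN≋ΣNe : ΣN ≋ ΣNe
    ΣN≋ΣNe = ≋-trans (foldr-⊕-cong (λ i → num (dx i ωs)) x∂ω-numForm x∂ω-num (allFin n))
           (≋-trans (sum-x∂ω-num (allFin n)) (⊕-congˡ (KΣ ⊗' ωNum ⊗' Dp ⊗' Fp) (⊗-congʳ (⊗-congˡ (Ksd ⊗' ωNum ⊗' tPoly) (⊕-congˡ sumXi (neg-cong (⊗-congʳ (≡⇒≋ (cong (λ z → constP (+ z)) (ListP.length-tabulate {n = n} (λ x → x)))) x0Poly)))) Dp)))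

    Rep-Y : Rep (scaleR inv[n+1] Y) (invNum ⊗' ΣNe) 2 (suc (suc d))
    Rep-Y = Rep-scale inv[n+1] Y ΣNe 1 (suc (suc d)) (Rep-≋ Y ΣN 1 (suc (suc d)) ΣNe (Rep-sum (λ i → dx i ωs) (λ i → num (dx i ωs)) 1 (suc (suc d)) (λ i → ≋-refl) (allFin n)) ΣN≋ΣNe)

    Rep-Lop-ω : ∀ c → Rep (Lop n c ωs) (invNum ⊗' Nθe ⊕' neg (constP (+ c) ⊗' ωNum ⊗' (Dp ⊗' Dp ⊗' Fp))) 2 (suc (suc d))
    Rep-Lop-ω c = Rep-+same (scaleR inv[n+1] (dθ ωs)) (negQ (scaleR (constA n (+ c)) ωs)) (invNum ⊗' Nθe) (neg (constP (+ c) ⊗' ωNum ⊗' (Dp ⊗' Dp ⊗' Fp))) 2 (suc (suc d))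
        (Rep-scale inv[n+1] (dθ ωs) Nθe 1 (suc (suc d)) (Rep-≋ (dθ ωs) (num (dθ ωs)) 1 (suc (suc d)) Nθe ≋-refl θω-num))
        (Rep-neg (scaleR (constA n (+ c)) ωs) (constP (+ c) ⊗' ωNum ⊗' (Dp ⊗' Dp ⊗' Fp)) 2 (suc (suc d))
          (Rep-rebase (scaleR (constA n (+ c)) ωs) (constP (+ c) ⊗' ωNum) 0 (suc d) (constP (+ c) ⊗' ωNum ⊗' (Dp ⊗' Dp ⊗' Fp)) 2 (suc (suc d))
             (Rep-scale (constA n (+ c)) ωs ωNum 0 (suc d) ≋-refl)
             (rsolve 4 (λ x D F P → x :* ((D :* (D :* con (+ 1))) :* (F :* (F :* P))) := x :* (D :* D :* F) :* (con (+ 1) :* (F :* P))) ≋-refl (constP (+ c) ⊗' ωNum) Dp Fp (pow Fp d))))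

    Rep-ω-next : ∀ j → Rep (ω n (incrementAt j VV)) (Ksd ⊗' ωNum ⊗' tPoly ⊗' xMonomial j ⊗' (Dp ⊗' Dp)) 2 (suc (suc d))
    Rep-ω-next j = Rep-rebase (ω n (incrementAt j VV)) (Ksd ⊗' ωNum ⊗' tPoly ⊗' xMonomial j) 0 (suc (suc d)) (Ksd ⊗' ωNum ⊗' tPoly ⊗' xMonomial j ⊗' (Dp ⊗' Dp)) 2 (suc (suc d)) (Rep-ω-incrementAt V0 V' j)
             (rsolve 4 (λ x D F P → x :* ((D :* (D :* con (+ 1))) :* (F :* (F :* P))) := x :* (D :* D) :* (con (+ 1) :* (F :* (F :* P)))) ≋-refl (Ksd ⊗' ωNum ⊗' tPoly ⊗' xMonomial j) Dp Fp (pow Fp d))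

    defect : Fin (suc n) → RatFun n
    defect j = Lop n (lookup VV j) ωs -Q ω n (incrementAt j VV)

    defect-in-dO : Fin (suc n) → RatFun n
    defect-in-dO Fin.zero = scaleR inv[n+1] Y
    defect-in-dO (Fin.suc i) = scaleR inv[n+1] Y -Q dx i ωs

    defect≈-x0 : defect Fin.zero ≈Q defect-in-dO Fin.zero
    defect≈-x0 = Rep-unique (defect Fin.zero) (defect-in-dO Fin.zero) (invNum ⊗' ΣNe) 2 (suc (suc d))
       (Rep-≋ (defect Fin.zero) (L0 ⊕' neg W0) 2 (suc (suc d)) (invNum ⊗' ΣNe)
          (Rep-+same (Lop n V0 ωs) (negQ (ω n (incrementAt Fin.zero VV))) L0 (neg W0) 2 (suc (suc d)) (Rep-Lop-ω V0) (Rep-neg (ω n (incrementAt Fin.zero VV)) W0 2 (suc (suc d)) (Rep-ω-next Fin.zero)))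
          (step-identity-x0 invNum Kd KΣ KV0 ωNum Dp Fp Ksd tPoly x0Poly sumXi Kn r1 r2 r3))
       Rep-Y
      where
      L0 W0 : Poly n
      L0 = invNum ⊗' Nθe ⊕' neg (constP (+ V0) ⊗' ωNum ⊗' (Dp ⊗' Dp ⊗' Fp))
      W0 = Ksd ⊗' ωNum ⊗' tPoly ⊗' xMonomial Fin.zero ⊗' (Dp ⊗' Dp)

    defect≈-xi : ∀ i → defect (Fin.suc i) ≈Q defect-in-dO (Fin.suc i)
    defect≈-xi i = Rep-unique (defect (Fin.suc i)) (defect-in-dO (Fin.suc i)) NR 2 (suc (suc d))
       (Rep-≋ (defect (Fin.suc i)) (L1 ⊕' neg W1) 2 (suc (suc d)) NR
          (Rep-+same (Lop n (lookup V' i) ωs) (negQ (ω n (incrementAt (Fin.suc i) VV))) L1 (neg W1) 2 (suc (suc d)) (Rep-Lop-ω (lookup V' i)) (Rep-neg (ω n (incrementAt (Fin.suc i) VV)) W1 2 (suc (suc d)) (Rep-ω-next (Fin.suc i))))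
          (step-identity-xi invNum Kd KΣ KV0 ωNum Dp Fp Ksd tPoly x0Poly sumXi Kn (constP (+ lookup V' i)) (xP n i) (Ku i) r1 r2 r3 (r4 i)))
       (Rep-+same (scaleR inv[n+1] Y) (negQ (dx i ωs)) (invNum ⊗' ΣNe) (neg (x∂ω-numForm i ⊗' Dp)) 2 (suc (suc d)) Rep-Y
          (Rep-neg (dx i ωs) (x∂ω-numForm i ⊗' Dp) 2 (suc (suc d)) (Rep-rebase (dx i ωs) (num (dx i ωs)) 1 (suc (suc d)) (x∂ω-numForm i ⊗' Dp) 2 (suc (suc d)) ≋-refl
             (≋-trans (rsolve 4 (λ x D F P → x :* ((D :* (D :* con (+ 1))) :* (F :* (F :* P))) := x :* D :* ((D :* con (+ 1)) :* (F :* (F :* P)))) ≋-refl (num (dx i ωs)) Dp Fp (pow Fp d))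
                      (⊗-congʳ (⊗-congʳ (x∂ω-num i) Dp) (den 1 (suc (suc d))))))))
      where
      NR L1 W1 : Poly n
      NR = invNum ⊗' ΣNe ⊕' neg (x∂ω-numForm i ⊗' Dp)
      L1 = invNum ⊗' Nθe ⊕' neg (constP (+ lookup V' i) ⊗' ωNum ⊗' (Dp ⊗' Dp ⊗' Fp))
      W1 = Ksd ⊗' ωNum ⊗' tPoly ⊗' xMonomial (Fin.suc i) ⊗' (Dp ⊗' Dp)


module Congruence (n : ℕ) where
  open OmegaStep n public
  open ThetaClosure θ-generator public

  Congruent : RatFun n → RatFun n → Set
  Congruent = CongMod n

  Congruent-≈ : ∀ {r s} → r ≈Q s → Congruent r s
  Congruent-≈ {r} {s} (mkQ e) = Span-null {dOfGen n} {r -Q s} (begin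
      num r ⊗' denom s ⊕' neg (num s) ⊗' denom r ≈⟨ ⊕-cong e (rsolve 2 (λ a b → (:- a) :* b := :- (a :* b)) ≋-refl (num s) (denom r)) ⟩
      num s ⊗' denom r ⊕' neg (num s ⊗' denom r) ≈⟨ mk (neg-inverseʳ≈ (num s ⊗' denom r)) ⟩
      [] ∎)
    where open ≋R

  Congruent-sym : ∀ {r s} → Congruent r s → Congruent s r
  Congruent-sym {r} {s} x = Span-≈ {dOfGen n} (Span-neg {dOfGen n} {r -Q s} x) (negQ-sub r s)

  Congruent-trans : ∀ {r s t} → Congruent r s → Congruent s t → Congruent r t
  Congruent-trans {r} {s} {t} x y = Span-≈ {dOfGen n} (Span-+ {dOfGen n} {r -Q s} {s -Q t} x y) (sub-trans r s t)

  Congruent-Lop : ∀ c {r s} → Congruent r s → Congruent (Lop n c r) (Lop n c s)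
  Congruent-Lop c {r} {s} x = Span-≈ {dOfGen n} (Span-sub {dOfGen n} {scaleR inv[n+1] (dθ (r -Q s))} {scaleR (constA n (+ c)) (r -Q s)}
                                 (Span-scale {dOfGen n} {dθ (r -Q s)} inv[n+1] (dOf-θ (r -Q s) x)) (Span-scale {dOfGen n} {r -Q s} (constA n (+ c)) x))
      (≈Q-sym (≈Q-trans (-Q-interchange (scaleR inv[n+1] (dθ r)) (scaleR (constA n (+ c)) r) (scaleR inv[n+1] (dθ s)) (scaleR (constA n (+ c)) s))
                 (-Q-cong (≈Q-trans (scale-sub inv[n+1] (dθ r) (dθ s)) (scale-cong inv[n+1] (θ-sub r s))) (scale-sub (constA n (+ c)) r s))))

  Congruent-fallθ : ∀ k {r s} → Congruent r s → Congruent (fallθ n k r) (fallθ n k s)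
  Congruent-fallθ zero x = x
  Congruent-fallθ (suc k) {r} {s} x = Congruent-Lop k {fallθ n k r} {fallθ n k s} (Congruent-fallθ k x)

  monomial-support : ∀ c a0 u0 a u → coeff n (monomial c a0 u0) a u ≢ + 0 → (a0 ≡ a) × (u0 ≡ u)
  monomial-support c a0 u0 a u nz = go (a0 ℕ.≟ a) (VecP.≡-dec ℤ._≟_ u0 u) nz
    where
    go : (d1 : Dec (a0 ≡ a)) (d2 : Dec (u0 ≡ u)) → (if ⌊ d1 ⌋ ∧ ⌊ d2 ⌋ then c else + 0) +ᶻ + 0 ≢ + 0 → (a0 ≡ a) × (u0 ≡ u)
    go (yes p) (yes q) _ = p , q
    go (yes p) (no _) h = ⊥-elim (h refl)
    go (no _) d2 h = ⊥-elim (h refl)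

  ω-generator : ∀ V → OfGen n (ω n V)
  ω-generator V = suc d , monomial (+ 1) d uv , 0 , s≤s z≤n , adm , supp ,
         cong (λ P → P /D^ 0 f^ suc d) (sym (trans (constP*monomial (+ (d !)) (+ 1) d uv) (cong (λ c → monomial c d uv) (ℤP.*-identityʳ (+ (d !))))))
    where
    d : ℕ
    d = Vec.sum V
    uv : Vec ℤ n
    uv = exponentVec V
    adm : Admissible n (monomial (+ 1) d uv)
    adm a u nz with monomial-support (+ 1) d uv a u nz
    ... | refl , refl = InDilate-ω V
    supp : SuppIn n (suc d) (monomial (+ 1) d uv)
    supp a u nz with monomial-support (+ 1) d uv a u nz
    ... | refl , refl = InDilate-ω-suc V

  ω∈Of : ∀ V → Of n (ω n V)
  ω∈Of V = Span-gen {OfGen n} (ω-generator V)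

  ω-step : ∀ (V : Vec ℕ (suc n)) j → Congruent (ω n (incrementAt j V)) (Lop n (lookup V j) (ω n V))
  ω-step (V0 ∷ V') j = Congruent-sym {Lop n (lookup (V0 ∷ V') j) ωs} {ω n (incrementAt j (V0 ∷ V'))} (Span-≈ {dOfGen n} (defect-in-dO∈dO j) (≈Q-sym (defect≈ j)))
    where
    open StepAt V0 V'
    Y∈dO : dOf n Y
    Y∈dO = Span-sum-gen {dOfGen n} (λ i → dx i ωs) (λ i → i , ωs , ω∈Of (V0 ∷ V') , refl) (allFin n)
    defect-in-dO∈dO : ∀ j → dOf n (defect-in-dO j)
    defect-in-dO∈dO Fin.zero = Span-scale {dOfGen n} {Y} inv[n+1] Y∈dO
    defect-in-dO∈dO (Fin.suc i) = Span-sub {dOfGen n} {scaleR inv[n+1] Y} {dx i ωs} (Span-scale {dOfGen n} {Y} inv[n+1] Y∈dO) (Span-gen {dOfGen n} (i , ωs , ω∈Of (V0 ∷ V') , refl))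
    defect≈ : ∀ j → defect j ≈Q defect-in-dO j
    defect≈ Fin.zero = defect≈-x0
    defect≈ (Fin.suc i) = defect≈-xi i

  incrementTimes : Fin (suc n) → ℕ → Vec ℕ (suc n) → Vec ℕ (suc n)
  incrementTimes j zero W = W
  incrementTimes j (suc x) W = incrementAt j (incrementTimes j x W)

  lookup-incrementTimes : ∀ j x W → lookup (incrementTimes j x W) j ≡ lookup W j ℕ.+ x
  lookup-incrementTimes j zero W = sym (ℕP.+-identityʳ _)
  lookup-incrementTimes j (suc x) W = trans (VecP.lookup∘updateAt j (incrementTimes j x W)) (trans (cong suc (lookup-incrementTimes j x W)) (sym (ℕP.+-suc _ x)))

  lookup-incrementTimes-other : ∀ j x W k → k ≢ j → lookup (incrementTimes j x W) k ≡ lookup W k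
  lookup-incrementTimes-other j zero W k ne = refl
  lookup-incrementTimes-other j (suc x) W k ne = trans (VecP.lookup∘updateAt′ k j ne (incrementTimes j x W)) (lookup-incrementTimes-other j x W k ne)

  ω-incrementTimes : ∀ j x W → lookup W j ≡ 0 → Congruent (ω n (incrementTimes j x W)) (fallθ n x (ω n W))
  ω-incrementTimes j zero W h = Congruent-≈ (≈Q-refl {ω n W})
  ω-incrementTimes j (suc x) W h = Congruent-trans {ω n (incrementTimes j (suc x) W)} {Lop n x (ω n (incrementTimes j x W))} {fallθ n (suc x) (ω n W)}
      (subst (λ c → Congruent (ω n (incrementTimes j (suc x) W)) (Lop n c (ω n (incrementTimes j x W)))) (trans (lookup-incrementTimes j x W) (cong (ℕ._+ x) h)) (ω-step (incrementTimes j x W) j))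
      (Congruent-Lop x {ω n (incrementTimes j x W)} {fallθ n x (ω n W)} (ω-incrementTimes j x W h))


module Iteration (n : ℕ) where
  open Congruence n public

  applyFalls : List ℕ → RatFun n
  applyFalls = List.foldr (fallθ n) (oneOverF n)

  foldr-fallθ≡applyFalls : ∀ {m} (U : Vec ℕ m) → Vec.foldr (λ _ → RatFun n) (fallθ n) (oneOverF n) U ≡ applyFalls (Vec.toList U)
  foldr-fallθ≡applyFalls [] = refl
  foldr-fallθ≡applyFalls (x ∷ U) = cong (fallθ n x) (foldr-fallθ≡applyFalls U)

  drop-length : ∀ {m} (U : Vec ℕ m) → List.drop m (Vec.toList U) ≡ []
  drop-length [] = refl
  drop-length (x ∷ U) = drop-length U

  drop-lookup : ∀ {m} (U : Vec ℕ m) j p → Fin.toℕ j ≡ p → List.drop p (Vec.toList U) ≡ lookup U j ∷ List.drop (suc p) (Vec.toList U)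
  drop-lookup (x ∷ U) Fin.zero .0 refl = refl
  drop-lookup (x ∷ U) (Fin.suc j) .(suc (Fin.toℕ j)) refl = drop-lookup U j (Fin.toℕ j) refl

  sum-replicate-0 : ∀ m → Vec.sum (replicate m 0) ≡ 0
  sum-replicate-0 zero = refl
  sum-replicate-0 (suc m) = sum-replicate-0 m

  ω-zero : ω n (replicate (suc n) 0) ≡ oneOverF n
  ω-zero = cong₂ (λ s v → ((+ (s !) , s , v) ∷ []) /D^ 0 f^ suc s) (sum-replicate-0 (suc n))
         (Vec-ext _ _ (λ i → trans (VecP.lookup∘tabulate (λ i → + lookup (replicate (suc n) 0) (Fin.suc i) -ᶻ + lookup (replicate (suc n) 0) Fin.zero) i) (trans (cong (λ a → + a -ᶻ + 0) (VecP.lookup-replicate {n = n} i 0)) (sym (VecP.lookup-replicate i (+ 0))))))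

  zeroPrefixEntry : ℕ → Vec ℕ (suc n) → Fin (suc n) → ℕ
  zeroPrefixEntry p U i = if ⌊ Fin.toℕ i ℕ.<? p ⌋ then 0 else lookup U i

  zeroPrefix : ℕ → Vec ℕ (suc n) → Vec ℕ (suc n)
  zeroPrefix p U = tabulate (zeroPrefixEntry p U)

  lookup-zeroPrefix-< : ∀ p U i → Fin.toℕ i ℕ.< p → lookup (zeroPrefix p U) i ≡ 0
  lookup-zeroPrefix-< p U i lt = trans (VecP.lookup∘tabulate (zeroPrefixEntry p U) i) (if-yes {x = 0} {y = lookup U i} (Fin.toℕ i ℕ.<? p) lt)

  lookup-zeroPrefix-≮ : ∀ p U i → ¬ Fin.toℕ i ℕ.< p → lookup (zeroPrefix p U) i ≡ lookup U i
  lookup-zeroPrefix-≮ p U i ≮ = trans (VecP.lookup∘tabulate (zeroPrefixEntry p U) i) (if-no {x = 0} {y = lookup U i} (Fin.toℕ i ℕ.<? p) ≮)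

  zeroPrefix-0 : ∀ U → zeroPrefix 0 U ≡ U
  zeroPrefix-0 U = Vec-ext _ _ (λ i → lookup-zeroPrefix-≮ 0 U i (λ ()))

  zeroPrefix-all : ∀ U → zeroPrefix (suc n) U ≡ replicate (suc n) 0
  zeroPrefix-all U = Vec-ext _ _ (λ i → trans (lookup-zeroPrefix-< (suc n) U i (FinP.toℕ<n i)) (sym (VecP.lookup-replicate i 0)))

  zeroPrefix-step : ∀ U j p → Fin.toℕ j ≡ p → zeroPrefix p U ≡ incrementTimes j (lookup U j) (zeroPrefix (suc p) U)
  zeroPrefix-step U j p tj = Vec-ext _ _ pointwise
    where
    pointwise : ∀ k → lookup (zeroPrefix p U) k ≡ lookup (incrementTimes j (lookup U j) (zeroPrefix (suc p) U)) k
    pointwise k with k Fin.≟ j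
    ... | yes refl = trans (lookup-zeroPrefix-≮ p U k (λ lt → ℕP.<-irrefl tj lt))
                       (sym (trans (lookup-incrementTimes k (lookup U k) (zeroPrefix (suc p) U))
                                   (cong (ℕ._+ lookup U k) (lookup-zeroPrefix-< (suc p) U k (subst (ℕ._< suc p) (sym tj) (ℕP.n<1+n p))))))
    ... | no k≢j with Fin.toℕ k ℕ.<? p
    ...   | yes lt = trans (lookup-zeroPrefix-< p U k lt)
                       (sym (trans (lookup-incrementTimes-other j (lookup U j) (zeroPrefix (suc p) U) k k≢j) (lookup-zeroPrefix-< (suc p) U k (ℕP.m<n⇒m<1+n lt))))
    ...   | no ≮ = trans (lookup-zeroPrefix-≮ p U k ≮)
                       (sym (trans (lookup-incrementTimes-other j (lookup U j) (zeroPrefix (suc p) U) k k≢j) (lookup-zeroPrefix-≮ (suc p) U k ≮suc)))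
      where
      ≮suc : ¬ Fin.toℕ k ℕ.< suc p
      ≮suc lt = k≢j (FinP.toℕ-injective (trans (ℕP.≤-antisym (ℕ.s≤s⁻¹ lt) (ℕP.≮⇒≥ ≮)) (sym tj)))

  ω-zeroPrefix : ∀ U q p → p ℕ.+ q ≡ suc n → Congruent (ω n (zeroPrefix p U)) (applyFalls (List.drop p (Vec.toList U)))
  ω-zeroPrefix U zero p e with trans (sym (ℕP.+-identityʳ p)) e
  ... | refl = subst₂ Congruent (sym (trans (cong (ω n) (zeroPrefix-all U)) ω-zero)) (cong applyFalls (sym (drop-length U)))
                 (Congruent-≈ (≈Q-refl {oneOverF n}))
  ω-zeroPrefix U (suc q) p e =
    subst₂ Congruent (sym (cong (ω n) (zeroPrefix-step U j p tj))) (sym (cong applyFalls (drop-lookup U j p tj)))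
      (Congruent-trans {ω n (incrementTimes j x W)} {fallθ n x (ω n W)} {fallθ n x (applyFalls (List.drop (suc p) (Vec.toList U)))}
        (ω-incrementTimes j x W (lookup-zeroPrefix-< (suc p) U j (subst (ℕ._< suc p) (sym tj) (ℕP.n<1+n p))))
        (Congruent-fallθ x (ω-zeroPrefix U q (suc p) (trans (sym (ℕP.+-suc p q)) e))))
    where
    lt : p ℕ.< suc n
    lt = subst (p ℕ.<_) e (ℕP.m<m+n p (s≤s z≤n))
    j : Fin (suc n)
    j = Fin.fromℕ< lt
    tj : Fin.toℕ j ≡ p
    tj = FinP.toℕ-fromℕ< lt
    x : ℕ
    x = lookup U j
    W : Vec ℕ (suc n)
    W = zeroPrefix (suc p) U


lemma3p3 : (n : ℕ) → 1 ≤ n → (U : Vec ℕ (suc n))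
    → ∃ (λ (i : Fin (suc n)) → lookup U i ≡ 0) → sum U < n
    → CongMod n (ω n U) (rhs n U)
lemma3p3 n _ U _ _ =
  subst₂ (CongMod n) (cong (ω n) (zeroPrefix-0 U)) (sym (foldr-fallθ≡applyFalls U))
    (ω-zeroPrefix U (suc n) 0 refl)
  where open Iteration n
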